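{- Fix $\epsilon,\delta \in (0,1)$, positive integers $d,k,m$, and a matrix $\mathbf{A} \in \mathbb{R}^{d\times m}$ whose columns $\mathbf{a}_1,\dots,\mathbf{a}_m$ satisfy $\|\mathbf{a}_i\|_2 = 1$ for every $i\in[m]$. There exists a tester with query complexity $O(k\epsilon^{ -2}\log(m/\delta))$ that, on an input vector $\mathbf{y}\in\mathbb{R}^d$, behaves as follows: (Completeness) if $\mathbf{y} = \mathbf{A}\mathbf{x}$ for some $\mathbf{x}\in \mathsf{Sp}^m_k$, the tester accepts with probability $1$; (Soundness) if $\|\mathbf{A}\mathbf{x}-\mathbf{y}\|_2 > \epsilon$ for every $\mathbf{x}\in\mathbb{R}^m$ with $\|\mathbf{x}\|_0 \le K$, where $K = O(k/\epsilon^2)$, the tester rejects with probability at least $1-\delta$. The running time of the tester is $\mathrm{poly}(m,k,1/\epsilon)$.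
   Context: $\mathcal{S}^{m-1}=\{\mathbf{x}\in\mathbb{R}^m:\|\mathbf{x}\|_2=1\}$, $\|\mathbf{x}\|_0$ is the number of nonzero coordinates of $\mathbf{x}$, and $\mathsf{Sp}^m_k=\{\mathbf{x}\in\mathcal{S}^{m-1}:\|\mathbf{x}\|_0\le k\}$. A tester (with the matrix $\mathbf{A}$ known to it) accesses its input $\mathbf{y}\in\mathbb{R}^d$ only through linear queries: it draws a random matrix $\mathbf{M}\in\mathbb{R}^{q\times d}$ (independent of the input) and observes $\mathbf{M}\mathbf{y}$; each inner product of a row of $\mathbf{M}$ with $\mathbf{y}$ is a query, and $q$ is the query complexity. The running time is the time spent on the query outcomes (the time to evaluate the queries is not counted).
   Formalization: The query complexity is bounded by C(1 + kε⁻² log(m/δ)); the added 1 only matters for m = 1 with δ near 1, where the stated expression tends to 0 and would force zero queries, with which no tester is both complete and sound. -}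

module Defs where

open import Level using (0ℓ)
open import Algebra.Bundles using (CommutativeRing; Semiring)
open import Algebra.Structures using (IsCommutativeRing)
import Algebra.Definitions.RawSemiring as RawSemiringDefinitions
open import Data.Fin.Base using (Fin; toℕ; fromℕ<)
open import Data.List.Base using (allFin; filter; length)
open import Data.Nat.Base as ℕ using (ℕ; _!)
import Data.Nat.Properties as ℕₚ
open import Data.Product using (∃; ∃₂; _×_)
open import Data.Vec.Functional using (Vector)
open import Relation.Binary.PropositionalEquality using (_≡_; _≢_)
open import Relation.Binary.Structures using (IsDecTotalOrder)
open import Relation.Nullary using (¬_; yes; no; ¬?)
open import Relation.Unary using (Pred; U; ∁; ⋃; _≐_)

------------------------------------------------------------------------
-- Real numbers

-- The real numbers, axiomatised as a Dedekind-complete ordered field.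
-- Classically there is exactly one up to isomorphism.

record CompleteOrderedField : Set₁ where
  infix  4 _≤_
  infixl 6 _+_
  infixl 7 _*_
  infix  8 -_
  infix  9 _⁻¹
  field
    ℝ    : Set
    _+_  : ℝ → ℝ → ℝ
    _*_  : ℝ → ℝ → ℝ
    -_   : ℝ → ℝ
    0#   : ℝ
    1#   : ℝ
    _⁻¹  : ℝ → ℝ
    _≤_  : ℝ → ℝ → Set

    isCommutativeRing : IsCommutativeRing _≡_ _+_ _*_ -_ 0# 1#
    0≢1               : 0# ≢ 1#
    *-inverseʳ        : ∀ x → x ≢ 0# → x * x ⁻¹ ≡ 1#
    -- A convention: it keeps 0# ⁻¹ from being an unspecified constant.
    0⁻¹≡0             : 0# ⁻¹ ≡ 0#

    isDecTotalOrder   : IsDecTotalOrder _≡_ _≤_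
    +-monoˡ-≤         : ∀ {x y} z → x ≤ y → x + z ≤ y + z
    *-nonneg          : ∀ {x y} → 0# ≤ x → 0# ≤ y → 0# ≤ x * y

  UpperBound : Pred ℝ 0ℓ → ℝ → Set
  UpperBound S b = ∀ x → S x → x ≤ b

  -- The value of sup is unspecified on empty or unbounded sets.
  field
    sup       : Pred ℝ 0ℓ → ℝ
    sup-upper : ∀ S → ∃ S → ∃ (UpperBound S) → UpperBound S (sup S)
    sup-least : ∀ S → ∃ S → ∃ (UpperBound S) →
                ∀ b → UpperBound S b → sup S ≤ b

  commutativeRing : CommutativeRing 0ℓ 0ℓ
  commutativeRing = record { isCommutativeRing = isCommutativeRing }

  open IsDecTotalOrder isDecTotalOrder public using (_≟_; _≤?_)
  open RawSemiringDefinitions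
    (Semiring.rawSemiring (CommutativeRing.semiring commutativeRing)) public
    using (_^_; sum) renaming (_×_ to _·_)

  infix 4 _<_
  _<_ : ℝ → ℝ → Set
  x < y = x ≤ y × x ≢ y

  infixl 6 _-_
  _-_ : ℝ → ℝ → ℝ
  x - y = x + - y

  fromℕ : ℕ → ℝ
  fromℕ n = n · 1#

  -- The square root of a nonnegative number.
  √ : ℝ → ℝ
  √ a = sup (λ x → x * x ≤ a)

  -- The first n terms of the exponential series at x.
  expSum : ℕ → ℝ → ℝ
  expSum n x = sum {n} (λ i → x ^ toℕ i * fromℕ (toℕ i !) ⁻¹)

  -- The natural logarithm of a number t ≥ 1: for x ≥ 0 the partial sums
  -- increase to exp x, so this is the supremum of the x ≥ 0 with exp x ≤ t.
  log : ℝ → ℝ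
  log t = sup (λ x → 0# ≤ x × (∀ n → expSum n x ≤ t))

  _⟶_ : (ℕ → ℝ) → ℝ → Set
  s ⟶ l = ∀ η → 0# < η →
          ∃ λ N → ∀ n → N ℕ.≤ n → s n ≤ l + η × l ≤ s n + η

module LinearAlgebra (R : CompleteOrderedField) where
  open CompleteOrderedField R

  Matrix : ℕ → ℕ → Set
  Matrix r c = Vector (Vector ℝ c) r

  column : ∀ {r c} → Matrix r c → Fin c → Vector ℝ r
  column A j i = A i j

  infixr 7 _*ᵥ_ _*ₘ_
  _*ᵥ_ : ∀ {r c} → Matrix r c → Vector ℝ c → Vector ℝ r
  (A *ᵥ x) i = sum (λ j → A i j * x j)

  _*ₘ_ : ∀ {r s c} → Matrix r s → Matrix s c → Matrix r c
  (A *ₘ B) i j = (A *ᵥ column B j) i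

  infixl 6 _-ᵥ_
  _-ᵥ_ : ∀ {n} → Vector ℝ n → Vector ℝ n → Vector ℝ n
  (x -ᵥ y) i = x i - y i

  ‖_‖₂ : ∀ {n} → Vector ℝ n → ℝ
  ‖ x ‖₂ = √ (sum (λ i → x i ^ 2))

  ‖_‖₀ : ∀ {n} → Vector ℝ n → ℕ
  ‖_‖₀ {n} x = length (filter (λ i → ¬? (x i ≟ 0#)) (allFin n))

  UnitSphere : ∀ m → Pred (Vector ℝ m) 0ℓ
  UnitSphere m x = ‖ x ‖₂ ≡ 1#

  Sp : ∀ m (k : ℕ) → Pred (Vector ℝ m) 0ℓ
  Sp m k x = UnitSphere m x × ‖ x ‖₀ ℕ.≤ k

------------------------------------------------------------------------
-- Probability

module Probability (R : CompleteOrderedField) where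
  open CompleteOrderedField R
  open LinearAlgebra R using (Matrix)

  record ProbabilitySpace : Set₁ where
    field
      Ω       : Set
      IsEvent : Pred Ω 0ℓ → Set
      -- Only the values of Pr on events are meaningful.
      Pr      : Pred Ω 0ℓ → ℝ

      event-≐ : ∀ E F → E ≐ F → IsEvent E → IsEvent F
      event-U : IsEvent U
      event-∁ : ∀ E → IsEvent E → IsEvent (∁ E)
      event-⋃ : ∀ (E : ℕ → Pred Ω 0ℓ) → (∀ n → IsEvent (E n)) →
                IsEvent (⋃ ℕ E)

      Pr-nonneg     : ∀ E → IsEvent E → 0# ≤ Pr E
      Pr-U          : Pr U ≡ 1#
      -- Taking an arbitrary F ≐ ⋃ ℕ E makes Pr respect _≐_ on events.
      Pr-σ-additive : ∀ (E : ℕ → Pred Ω 0ℓ) F →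
                      (∀ n → IsEvent (E n)) → IsEvent F →
                      (∀ i j ω → E i ω → E j ω → i ≡ j) →
                      F ≐ ⋃ ℕ E →
                      (λ n → sum {n} (λ i → Pr (E (toℕ i)))) ⟶ Pr F

  record RandomMatrix (q d : ℕ) : Set₁ where
    field
      space : ProbabilitySpace
    open ProbabilitySpace space public
    field
      matrix     : Ω → Matrix q d
      measurable : ∀ i j t → IsEvent (λ ω → matrix ω i j ≤ t)

------------------------------------------------------------------------
-- Programs for a real-arithmetic random access machine with unit costs:
-- natural-number registers (used for control and for indirect addressing)
-- and a memory whose cells each hold one real number.

data Parameter : Set where
  `d `m `k `q : Parameter

infixl 6 _⊕_ _⊖_

data NatExp : Set where
  lit   : ℕ → NatExp
  param : Parameter → NatExp
  reg   : ℕ → NatExp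
  _⊕_   : NatExp → NatExp → NatExp
  _⊖_   : NatExp → NatExp → NatExp

infixl 6 _⊞_ _⊟_
infixl 7 _⊠_ _⊘_

data RealExp : Set where
  nat             : NatExp → RealExp
  mem             : NatExp → RealExp
  `ε `δ           : RealExp
  `A[_,_]         : NatExp → NatExp → RealExp
  `M[_,_]         : NatExp → NatExp → RealExp
  `MA[_,_]        : NatExp → NatExp → RealExp
  `outcome[_]     : NatExp → RealExp
  _⊞_ _⊟_ _⊠_ _⊘_ : RealExp → RealExp → RealExp

data Test : Set where
  _≤ⁿ_ : NatExp → NatExp → Test
  _≤ʳ_ : RealExp → RealExp → Test

infixr 4 _⨾_
infix  5 reg[_]≔_ mem[_]≔_

data Program : Set where
  skip          : Program
  reg[_]≔_      : ℕ → NatExp → Program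
  mem[_]≔_      : NatExp → RealExp → Program
  _⨾_           : Program → Program → Program
  if_then_else_ : Test → Program → Program → Program
  while_loop_     : Test → Program → Program

sizeⁿ : NatExp → ℕ
sizeⁿ (lit _)   = 1
sizeⁿ (param _) = 1
sizeⁿ (reg _)   = 1
sizeⁿ (e ⊕ f)   = 1 ℕ.+ sizeⁿ e ℕ.+ sizeⁿ f
sizeⁿ (e ⊖ f)   = 1 ℕ.+ sizeⁿ e ℕ.+ sizeⁿ f

sizeʳ : RealExp → ℕ
sizeʳ (nat e)       = 1 ℕ.+ sizeⁿ e
sizeʳ (mem e)       = 1 ℕ.+ sizeⁿ e
sizeʳ `ε            = 1
sizeʳ `δ            = 1
sizeʳ `A[ e , f ]   = 1 ℕ.+ sizeⁿ e ℕ.+ sizeⁿ f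
sizeʳ `M[ e , f ]   = 1 ℕ.+ sizeⁿ e ℕ.+ sizeⁿ f
sizeʳ `MA[ e , f ]  = 1 ℕ.+ sizeⁿ e ℕ.+ sizeⁿ f
sizeʳ `outcome[ e ] = 1 ℕ.+ sizeⁿ e
sizeʳ (e ⊞ f)       = 1 ℕ.+ sizeʳ e ℕ.+ sizeʳ f
sizeʳ (e ⊟ f)       = 1 ℕ.+ sizeʳ e ℕ.+ sizeʳ f
sizeʳ (e ⊠ f)       = 1 ℕ.+ sizeʳ e ℕ.+ sizeʳ f
sizeʳ (e ⊘ f)       = 1 ℕ.+ sizeʳ e ℕ.+ sizeʳ f

sizeᵗ : Test → ℕ
sizeᵗ (e ≤ⁿ f) = 1 ℕ.+ sizeⁿ e ℕ.+ sizeⁿ f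
sizeᵗ (e ≤ʳ f) = 1 ℕ.+ sizeʳ e ℕ.+ sizeʳ f

update : ∀ {A : Set} → (ℕ → A) → ℕ → A → ℕ → A
update f i v j with i ℕₚ.≟ j
... | yes _ = v
... | no  _ = f j

module Execution (R : CompleteOrderedField) where
  open CompleteOrderedField R
  open LinearAlgebra R

  -- What a program may read. The sketch M A of the columns of A does not
  -- depend on the tested vector, so, like the query outcomes, it is read at
  -- unit cost per entry. The tested vector itself occurs only in outcomes.
  record Input : Set where
    field
      d m k q  : ℕ
      ε δ      : ℝ
      A        : Matrix d m
      M        : Matrix q d
      outcomes : Vector ℝ q

  -- Entries outside the range of indices read as 0.
  entry : ∀ {n} → Vector ℝ n → ℕ → ℝ
  entry {n} v i with i ℕₚ.<? n
  ... | yes i<n = v (fromℕ< i<n)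
  ... | no  _   = 0#

  entry₂ : ∀ {r c} → Matrix r c → ℕ → ℕ → ℝ
  entry₂ A i j = entry (λ i′ → entry (A i′) j) i

  record State : Set where
    constructor ⟨_,_⟩
    field
      registers : ℕ → ℕ
      memory    : ℕ → ℝ
  open State public

  initial : State
  initial = ⟨ (λ _ → 0) , (λ _ → 0#) ⟩

  module _ (I : Input) where
    open Input I

    ⟦_⟧ᵖ : Parameter → ℕ
    ⟦ `d ⟧ᵖ = d
    ⟦ `m ⟧ᵖ = m
    ⟦ `k ⟧ᵖ = k
    ⟦ `q ⟧ᵖ = q

    ⟦_⟧ⁿ : NatExp → State → ℕ
    ⟦ lit n ⟧ⁿ   s = n
    ⟦ param p ⟧ⁿ s = ⟦ p ⟧ᵖ
    ⟦ reg r ⟧ⁿ   s = registers s r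
    ⟦ e ⊕ f ⟧ⁿ   s = ⟦ e ⟧ⁿ s ℕ.+ ⟦ f ⟧ⁿ s
    ⟦ e ⊖ f ⟧ⁿ   s = ⟦ e ⟧ⁿ s ℕ.∸ ⟦ f ⟧ⁿ s

    ⟦_⟧ʳ : RealExp → State → ℝ
    ⟦ nat e ⟧ʳ         s = fromℕ (⟦ e ⟧ⁿ s)
    ⟦ mem e ⟧ʳ         s = memory s (⟦ e ⟧ⁿ s)
    ⟦ `ε ⟧ʳ            s = ε
    ⟦ `δ ⟧ʳ            s = δ
    ⟦ `A[ e , f ] ⟧ʳ   s = entry₂ A (⟦ e ⟧ⁿ s) (⟦ f ⟧ⁿ s)
    ⟦ `M[ e , f ] ⟧ʳ   s = entry₂ M (⟦ e ⟧ⁿ s) (⟦ f ⟧ⁿ s)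
    ⟦ `MA[ e , f ] ⟧ʳ  s = entry₂ (M *ₘ A) (⟦ e ⟧ⁿ s) (⟦ f ⟧ⁿ s)
    ⟦ `outcome[ e ] ⟧ʳ s = entry outcomes (⟦ e ⟧ⁿ s)
    ⟦ e ⊞ f ⟧ʳ         s = ⟦ e ⟧ʳ s + ⟦ f ⟧ʳ s
    ⟦ e ⊟ f ⟧ʳ         s = ⟦ e ⟧ʳ s - ⟦ f ⟧ʳ s
    ⟦ e ⊠ f ⟧ʳ         s = ⟦ e ⟧ʳ s * ⟦ f ⟧ʳ s
    ⟦ e ⊘ f ⟧ʳ         s = ⟦ e ⟧ʳ s * ⟦ f ⟧ʳ s ⁻¹

    ⟦_⟧ᵗ : Test → State → Set
    ⟦ e ≤ⁿ f ⟧ᵗ s = ⟦ e ⟧ⁿ s ℕ.≤ ⟦ f ⟧ⁿ s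
    ⟦ e ≤ʳ f ⟧ᵗ s = ⟦ e ⟧ʳ s ≤ ⟦ f ⟧ʳ s

    -- c , s ⇓ s′ in-time t: started in state s, the program c halts in
    -- state s′ after t steps.
    infix 3 _,_⇓_in-time_
    data _,_⇓_in-time_ : Program → State → State → ℕ → Set where
      ⇓-skip : ∀ {s} → skip , s ⇓ s in-time 1

      ⇓-reg : ∀ {r e s} →
        (reg[ r ]≔ e) , s
          ⇓ ⟨ update (registers s) r (⟦ e ⟧ⁿ s) , memory s ⟩
          in-time 1 ℕ.+ sizeⁿ e

      ⇓-mem : ∀ {a e s} →
        (mem[ a ]≔ e) , s
          ⇓ ⟨ registers s , update (memory s) (⟦ a ⟧ⁿ s) (⟦ e ⟧ʳ s) ⟩
          in-time 1 ℕ.+ sizeⁿ a ℕ.+ sizeʳ e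

      ⇓-seq : ∀ {c₁ c₂ s s′ s″ t₁ t₂} →
        c₁ , s ⇓ s′ in-time t₁ → c₂ , s′ ⇓ s″ in-time t₂ →
        (c₁ ⨾ c₂) , s ⇓ s″ in-time t₁ ℕ.+ t₂

      ⇓-if-true : ∀ {b c₁ c₂ s s′ t} → ⟦ b ⟧ᵗ s →
        c₁ , s ⇓ s′ in-time t →
        (if b then c₁ else c₂) , s ⇓ s′ in-time sizeᵗ b ℕ.+ t

      ⇓-if-false : ∀ {b c₁ c₂ s s′ t} → ¬ ⟦ b ⟧ᵗ s →
        c₂ , s ⇓ s′ in-time t →
        (if b then c₁ else c₂) , s ⇓ s′ in-time sizeᵗ b ℕ.+ t

      ⇓-while-true : ∀ {b c s s′ s″ t₁ t₂} → ⟦ b ⟧ᵗ s →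
        c , s ⇓ s′ in-time t₁ → (while b loop c) , s′ ⇓ s″ in-time t₂ →
        (while b loop c) , s ⇓ s″ in-time sizeᵗ b ℕ.+ t₁ ℕ.+ t₂

      ⇓-while-false : ∀ {b c s} → ¬ ⟦ b ⟧ᵗ s →
        (while b loop c) , s ⇓ s in-time sizeᵗ b

  HaltsIn : Program → Input → ℕ → Set
  HaltsIn c I t = ∃ λ s → _,_⇓_in-time_ I c initial s t

  -- The verdict is left in register 0.
  Accepts : Program → Input → Set
  Accepts c I =
    ∃₂ λ s t → _,_⇓_in-time_ I c initial s t × registers s 0 ≢ 0

  Rejects : Program → Input → Set
  Rejects c I =
    ∃₂ λ s t → _,_⇓_in-time_ I c initial s t × registers s 0 ≡ 0

------------------------------------------------------------------------
-- Testers

module Testing (R : CompleteOrderedField) where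
  open CompleteOrderedField R
  open LinearAlgebra R
  open Probability R
  open Execution R

  -- A tester for the matrix A: it draws the query matrix without access to
  -- the tested vector and hands the outcomes to a program. The program is a
  -- parameter, so that one program can serve all problem sizes.
  record Tester (program : Program) (ε δ : ℝ) (k : ℕ)
                {d m : ℕ} (A : Matrix d m) : Set₁ where
    field
      q       : ℕ
      queries : RandomMatrix q d
    open RandomMatrix queries public

    input : Vector ℝ d → Ω → Input
    input y ω = record
      { d = d ; m = m ; k = k ; q = q ; ε = ε ; δ = δ ; A = A
      ; M = matrix ω ; outcomes = matrix ω *ᵥ y }

    Accept : Vector ℝ d → Pred Ω 0ℓ
    Accept y ω = Accepts program (input y ω)

    Reject : Vector ℝ d → Pred Ω 0ℓ
    Reject y ω = Rejects program (input y ω)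

    -- Worst case over the tested vector and the drawn matrix.
    RunsWithin : ℝ → Set
    RunsWithin T = ∀ y ω →
      ∃ λ t → HaltsIn program (input y ω) t × fromℕ t ≤ T

{-# OPTIONS --safe #-}
-- A k-sparse unit vector x has ‖x‖₁ ≤ √k, so A x lies in κ conv {±aᵢ} for the
-- integer κ with κ² just above k. Approximate Carathéodory: adding at every
-- step a vertex ±κ aᵢ - y which does not correlate positively with the current
-- residual keeps the squared residual O(k t) after t steps, so the average of
-- T = O(k / ε²) vertices is T-sparse and ε-close to y. All this only uses inner
-- products and is run on a sketch. Soundness needs that the sketch does not
-- shrink the residual of any of the (2m)^T averages: for one random sign query a
-- constant lower bound holds with constant probability (second and fourth
-- moments), so n queries fail together with probability exponentially small in
-- n, and a union bound applies. That no column is stretched is enforced by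
-- replacing bad sketches by 0; they are rare by a bound on the moments of ‖Φ a‖².
--
-- The running time may not depend on δ. When the random sketch would have more
-- than m rows it is replaced by an orthonormal basis of the range of A, together
-- with one random query orthogonal to the range that detects y outside of it.

module Submission where

open import Defs
open import Level using (0ℓ)
open import Algebra.Bundles using (CommutativeRing)
import Algebra.Properties.CommutativeMonoid.Sum
import Algebra.Properties.CommutativeSemiring.Exp
import Algebra.Properties.Ring
import Algebra.Properties.Semiring.Exp
import Algebra.Properties.Semiring.Mult
import Algebra.Properties.Semiring.Sum
import Algebra.Solver.Ring
open import Algebra.Solver.Ring.AlmostCommutativeRing using (fromCommutativeRing; _-Raw-AlmostCommutative⟶_)
open import Axiom.ExcludedMiddle using (ExcludedMiddle)
open import Data.Empty using (⊥-elim)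
open import Data.Fin.Base using (Fin; zero; suc; toℕ; fromℕ<)
import Data.Fin.Properties as Finₚ
open import Data.Integer.Base as ℤ using (ℤ; -[1+_])
import Data.Integer.Properties as ℤₚ
open import Data.List.Base as List using (length; filter)
open import Data.Maybe.Base using (Maybe; just; nothing)
open import Data.Nat.Base as ℕ using (ℕ; zero; suc; NonZero; _!)
import Data.Nat.Properties as ℕₚ
import Data.Nat.Solver
open import Data.Product using (Σ-syntax; ∃; ∃-syntax; _×_; _,_; proj₁; proj₂)
open import Data.Sum.Base using (_⊎_; inj₁; inj₂)
open import Data.Unit.Base using (⊤; tt)
open import Data.Vec.Base using (Vec; []; _∷_; lookup)
open import Data.Vec.Functional using (Vector)
open import Function.Base using (_∘_; const; id)
open import Relation.Binary.Bundles using (Poset)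
open import Relation.Binary.PropositionalEquality
  using (_≡_; _≢_; refl; sym; trans; cong; cong₂; subst; subst₂)
import Relation.Binary.Reasoning.PartialOrder
open import Relation.Binary.Structures using (IsDecTotalOrder)
open import Relation.Nullary using (¬_; Dec; yes; no; ¬?)
open import Relation.Nullary.Decidable using (decidable-stable)
open import Relation.Unary using (Pred; Decidable; ∁; U; ⋃; _≐_)

-- Acceptance must be sure, so whatever the greedy argument uses about a sketch (squared columns at
-- most 16, a vanishing check row) holds for every draw; only soundness is probabilistic. Soundness
-- is one-sided: a sketch may stretch a residual as much as it likes, but must not shrink it. The
-- union bound ranges over (2 m)^T paths, so each may fail with probability about δ (2 m)^(-T). With
-- 2^ℓ ≥ m / δ this takes w T ℓ rows, and T = O(k / ε²), ℓ = O(log (m / δ)) give the number of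
-- queries. Constants: (9 / 10)^w ≤ 1 / 32 fixes w = 33; up to probability 16^(-T ℓ) a squared norm
-- loses at most the factor θ = 4 w; the squared sketched residual stays below 160 k T; hence T is
-- the least number with T ε² > 160 θ k. The summand 1 in the query bound is for m = 1, where log (m
-- / δ) can be arbitrarily close to 0.

module OrderedField (R : CompleteOrderedField) where
  open CompleteOrderedField R public
  open CommutativeRing commutativeRing public
    using (+-assoc; +-comm; +-identityˡ; +-identityʳ; -‿inverseʳ;
           *-assoc; *-comm; *-identityˡ; *-identityʳ; zeroˡ; zeroʳ; distribˡ; distribʳ;
           semiring; ring; commutativeSemiring; +-commutativeMonoid)
  open IsDecTotalOrder isDecTotalOrder public
    using () renaming (refl to ≤-refl; reflexive to ≤-reflexive; trans to ≤-trans;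
                       antisym to ≤-antisym; total to ≤-total; isPartialOrder to ≤-isPartialOrder)

  ≤-poset : Poset 0ℓ 0ℓ 0ℓ
  ≤-poset = record { isPartialOrder = ≤-isPartialOrder }

  module ≤-Reasoning = Relation.Binary.Reasoning.PartialOrder ≤-poset

  private
    module Rg = Algebra.Properties.Ring ring
    module Mu = Algebra.Properties.Semiring.Mult semiring

  -- Natural numbers in the field, and a ring solver with integer constants

  fromℕ-+ : ∀ a b → fromℕ (a ℕ.+ b) ≡ fromℕ a + fromℕ b
  fromℕ-+ a b = Mu.×-homo-+ 1# a b

  fromℕ-* : ∀ a b → fromℕ (a ℕ.* b) ≡ fromℕ a * fromℕ b
  fromℕ-* a b = Mu.×1-homo-* a b

  fromℕ-1 : fromℕ 1 ≡ 1#
  fromℕ-1 = +-identityʳ 1#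

  private
    -- Sending + 1 to 1# itself lets the solver use 1# as a constant.
    fromℕ′ : ℕ → ℝ
    fromℕ′ 0             = 0#
    fromℕ′ 1             = 1#
    fromℕ′ (suc (suc n)) = fromℕ (suc (suc n))

    fromℤ : ℤ → ℝ
    fromℤ (ℤ.+ n)  = fromℕ′ n
    fromℤ -[1+ n ] = - fromℕ′ (suc n)

    fromℤ-+ⁿ : ∀ n → fromℤ (ℤ.+ n) ≡ fromℕ n
    fromℤ-+ⁿ 0             = refl
    fromℤ-+ⁿ 1             = sym fromℕ-1
    fromℤ-+ⁿ (suc (suc n)) = refl

    fromℤ-neg : ∀ i → fromℤ (ℤ.- i) ≡ - fromℤ i
    fromℤ-neg (ℤ.+ 0)         = sym Rg.-0#≈0#
    fromℤ-neg (ℤ.+ suc n)     = refl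
    fromℤ-neg -[1+ n ]      = sym (Rg.-‿involutive _)

    fromℤ-⊖ : ∀ a b → fromℤ (a ℤ.⊖ b) ≡ fromℕ a - fromℕ b
    fromℤ-⊖ a zero = trans (cong fromℤ (ℤₚ.⊖-≥ {a} {0} ℕ.z≤n))
      (trans (fromℤ-+ⁿ a) (sym (trans (cong (fromℕ a +_) Rg.-0#≈0#) (+-identityʳ _))))
    fromℤ-⊖ zero (suc b) = trans (cong -_ (fromℤ-+ⁿ (suc b))) (sym (+-identityˡ _))
    fromℤ-⊖ (suc a) (suc b) = trans (cong fromℤ (ℤₚ.[1+m]⊖[1+n]≡m⊖n a b))
      (trans (fromℤ-⊖ a b) (sym (trans (cong ((1# + fromℕ a) +_) (sym (Rg.-‿+-comm 1# (fromℕ b))))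
        (trans (+-assoc 1# (fromℕ a) _) (trans (cong (1# +_)
          (trans (sym (+-assoc (fromℕ a) (- 1#) _)) (trans (cong (_+ - fromℕ b) (+-comm (fromℕ a) (- 1#)))
            (+-assoc _ _ _))))
          (trans (sym (+-assoc 1# (- 1#) _)) (trans (cong (_+ (fromℕ a - fromℕ b)) (-‿inverseʳ 1#)) (+-identityˡ _))))))))

    fromℤ-+ : ∀ i j → fromℤ (i ℤ.+ j) ≡ fromℤ i + fromℤ j
    fromℤ-+ (ℤ.+ a) (ℤ.+ b) = trans (fromℤ-+ⁿ (a ℕ.+ b)) (trans (fromℕ-+ a b)
      (sym (cong₂ _+_ (fromℤ-+ⁿ a) (fromℤ-+ⁿ b))))
    fromℤ-+ (ℤ.+ a) -[1+ b ] = trans (fromℤ-⊖ a (suc b))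
      (sym (cong₂ _+_ (fromℤ-+ⁿ a) (cong -_ (fromℤ-+ⁿ (suc b)))))
    fromℤ-+ -[1+ a ] (ℤ.+ b) = trans (fromℤ-⊖ b (suc a))
      (trans (+-comm _ _) (sym (cong₂ _+_ (cong -_ (fromℤ-+ⁿ (suc a))) (fromℤ-+ⁿ b))))
    fromℤ-+ -[1+ a ] -[1+ b ] = trans (cong -_ (trans (cong (λ c → fromℤ (ℤ.+ suc c)) (sym (ℕₚ.+-suc a b)))
        (trans (fromℤ-+ⁿ (suc a ℕ.+ suc b)) (fromℕ-+ (suc a) (suc b)))))
      (trans (sym (Rg.-‿+-comm _ _))
        (sym (cong₂ _+_ (cong -_ (fromℤ-+ⁿ (suc a))) (cong -_ (fromℤ-+ⁿ (suc b))))))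

    fromℤ-*⁺ : ∀ a b → fromℤ (ℤ.+ a ℤ.* ℤ.+ b) ≡ fromℤ (ℤ.+ a) * fromℤ (ℤ.+ b)
    fromℤ-*⁺ a b = trans (cong fromℤ (sym (ℤₚ.pos-* a b))) (trans (fromℤ-+ⁿ (a ℕ.* b))
      (trans (fromℕ-* a b) (sym (cong₂ _*_ (fromℤ-+ⁿ a) (fromℤ-+ⁿ b)))))

    fromℤ-* : ∀ i j → fromℤ (i ℤ.* j) ≡ fromℤ i * fromℤ j
    fromℤ-* (ℤ.+ a) (ℤ.+ b) = fromℤ-*⁺ a b
    fromℤ-* (ℤ.+ a) -[1+ b ] = trans (cong fromℤ (sym (ℤₚ.neg-distribʳ-* (ℤ.+ a) (ℤ.+ suc b))))
      (trans (fromℤ-neg (ℤ.+ a ℤ.* ℤ.+ suc b)) (trans (cong -_ (fromℤ-*⁺ a (suc b))) (Rg.-‿distribʳ-* _ _)))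
    fromℤ-* -[1+ a ] (ℤ.+ b) = trans (cong fromℤ (sym (ℤₚ.neg-distribˡ-* (ℤ.+ suc a) (ℤ.+ b))))
      (trans (fromℤ-neg (ℤ.+ suc a ℤ.* ℤ.+ b)) (trans (cong -_ (fromℤ-*⁺ (suc a) b)) (Rg.-‿distribˡ-* _ _)))
    fromℤ-* -[1+ a ] -[1+ b ] = trans (fromℤ-*⁺ (suc a) (suc b))
      (sym (trans (sym (Rg.-‿distribˡ-* _ _)) (trans (cong -_ (sym (Rg.-‿distribʳ-* _ _))) (Rg.-‿involutive _))))

    fromℤ-morphism : ℤ.+-*-rawRing -Raw-AlmostCommutative⟶ fromCommutativeRing commutativeRing
    fromℤ-morphism = record
      { ⟦_⟧ = fromℤ ; +-homo = fromℤ-+ ; *-homo = fromℤ-* ; -‿homo = fromℤ-neg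
      ; 0-homo = refl ; 1-homo = refl }

    fromℤ-≟ : ∀ i j → Maybe (fromℤ i ≡ fromℤ j)
    fromℤ-≟ i j with i ℤₚ.≟ j
    ... | yes i≡j = just (cong fromℤ i≡j)
    ... | no  _   = nothing

  module Solver = Algebra.Solver.Ring ℤ.+-*-rawRing (fromCommutativeRing commutativeRing) fromℤ-morphism fromℤ-≟
  open Solver public using (solve; con; _:+_; _:*_; _:-_; :-_; _:=_; Polynomial)

  c# : ∀ {n} → ℕ → Polynomial n
  c# n = con (ℤ.+ n)

  open ≤-Reasoning

  -- Order arithmetic

  -- Reduces an inequality to a nonnegative slack and an identity that the ring solver can check;
  -- most polynomial estimates below have this shape.
  ≤-via : ∀ {x y} z → 0# ≤ z → y ≡ x + z → x ≤ y
  ≤-via {x} {y} z 0≤z y≡ = begin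
    x        ≡⟨ solve 1 (λ x → x := c# 0 :+ x) refl x ⟩
    0# + x   ≤⟨ +-monoˡ-≤ x 0≤z ⟩
    z + x    ≡⟨ solve 2 (λ z x → z :+ x := x :+ z) refl z x ⟩
    x + z    ≡⟨ y≡ ⟨
    y        ∎

  0≤- : ∀ {x y} → x ≤ y → 0# ≤ y - x
  0≤- {x} {y} x≤y = begin
    0#    ≡⟨ -‿inverseʳ x ⟨
    x - x ≤⟨ +-monoˡ-≤ (- x) x≤y ⟩
    y - x ∎

  +-monoʳ-≤ : ∀ {x y} z → x ≤ y → z + x ≤ z + y
  +-monoʳ-≤ {x} {y} z x≤y = ≤-via (y - x) (0≤- x≤y) (solve 3 (λ x y z → z :+ y := (z :+ x) :+ (y :- x)) refl x y z)

  +-mono-≤ : ∀ {x y u v} → x ≤ y → u ≤ v → x + u ≤ y + v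
  +-mono-≤ {x} {y} {u} {v} x≤y u≤v = ≤-trans (+-monoˡ-≤ u x≤y) (+-monoʳ-≤ y u≤v)

  +-nonneg : ∀ {x y} → 0# ≤ x → 0# ≤ y → 0# ≤ x + y
  +-nonneg {x} {y} 0≤x 0≤y = subst (_≤ x + y) (+-identityʳ 0#) (+-mono-≤ 0≤x 0≤y)

  *-monoˡ-≤ : ∀ {x y z} → 0# ≤ z → x ≤ y → z * x ≤ z * y
  *-monoˡ-≤ {x} {y} {z} 0≤z x≤y = ≤-via (z * (y - x)) (*-nonneg 0≤z (0≤- x≤y))
    (solve 3 (λ x y z → z :* y := (z :* x) :+ z :* (y :- x)) refl x y z)

  *-monoʳ-≤ : ∀ {x y z} → 0# ≤ z → x ≤ y → x * z ≤ y * z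
  *-monoʳ-≤ {x} {y} {z} 0≤z x≤y = subst₂ _≤_ (*-comm z x) (*-comm z y) (*-monoˡ-≤ 0≤z x≤y)

  *-mono-≤ : ∀ {x y u v} → 0# ≤ x → 0# ≤ v → x ≤ y → u ≤ v → x * u ≤ y * v
  *-mono-≤ 0≤x 0≤v x≤y u≤v = ≤-trans (*-monoˡ-≤ 0≤x u≤v) (*-monoʳ-≤ 0≤v x≤y)

  neg-mono-≤ : ∀ {x y} → x ≤ y → - y ≤ - x
  neg-mono-≤ {x} {y} x≤y = ≤-via (y - x) (0≤- x≤y) (solve 2 (λ x y → :- x := :- y :+ (y :- x)) refl x y)

  square-nonneg : ∀ x → 0# ≤ x * x
  square-nonneg x with ≤-total 0# x
  ... | inj₁ 0≤x = *-nonneg 0≤x 0≤x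
  ... | inj₂ x≤0 = subst (0# ≤_) (solve 1 (λ x → (c# 0 :- x) :* (c# 0 :- x) := x :* x) refl x)
                     (*-nonneg (0≤- x≤0) (0≤- x≤0))

  0≤1 : 0# ≤ 1#
  0≤1 = subst (0# ≤_) (*-identityʳ 1#) (square-nonneg 1#)

  fromℕ-nonneg : ∀ n → 0# ≤ fromℕ n
  fromℕ-nonneg zero    = ≤-refl
  fromℕ-nonneg (suc n) = +-nonneg 0≤1 (fromℕ-nonneg n)

  fromℕ-mono : ∀ {m n} → m ℕ.≤ n → fromℕ m ≤ fromℕ n
  fromℕ-mono {n = n} ℕ.z≤n = fromℕ-nonneg n
  fromℕ-mono (ℕ.s≤s m≤n)   = +-monoʳ-≤ 1# (fromℕ-mono m≤n)

  ≰⇒< : ∀ {x y} → ¬ (x ≤ y) → y < x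
  ≰⇒< {x} {y} x≰y with ≤-total x y
  ... | inj₁ x≤y = ⊥-elim (x≰y x≤y)
  ... | inj₂ y≤x = y≤x , λ y≡x → x≰y (≤-reflexive (sym y≡x))

  <⇒≱ : ∀ {x y} → x < y → ¬ (y ≤ x)
  <⇒≱ (x≤y , x≢y) y≤x = x≢y (≤-antisym x≤y y≤x)

  <-≤-trans : ∀ {x y z} → x < y → y ≤ z → x < z
  <-≤-trans x<y y≤z = ≰⇒< λ z≤x → <⇒≱ x<y (≤-trans y≤z z≤x)

  ≤-<-trans : ∀ {x y z} → x ≤ y → y < z → x < z
  ≤-<-trans x≤y y<z = ≰⇒< λ z≤x → <⇒≱ y<z (≤-trans z≤x x≤y)

  0<1 : 0# < 1#
  0<1 = 0≤1 , 0≢1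

  0<- : ∀ {x y} → x < y → 0# < y - x
  0<- {x} {y} (x≤y , x≢y) = 0≤- x≤y , λ eq → x≢y
    (trans (sym (+-identityʳ x)) (trans (cong (x +_) eq) (solve 2 (λ x y → x :+ (y :- x) := y) refl x y)))

  <-via : ∀ {x y} z → 0# < z → y ≡ x + z → x < y
  <-via {x} {y} z (0≤z , 0≢z) y≡ = ≤-via z 0≤z y≡ , λ x≡y → 0≢z (trans (sym (-‿inverseʳ x))
    (trans (cong (_- x) (trans x≡y y≡)) (solve 2 (λ x z → (x :+ z) :- x := z) refl x z)))

  +-pos-nonneg : ∀ {x y} → 0# < x → 0# ≤ y → 0# < x + y
  +-pos-nonneg {x} {y} 0<x 0≤y = <-≤-trans 0<x (≤-via y 0≤y refl)

  <⇒≢ : ∀ {x} → 0# < x → x ≢ 0#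
  <⇒≢ (_ , 0≢x) x≡0 = 0≢x (sym x≡0)

  integral : ∀ {x y} → x ≢ 0# → x * y ≡ 0# → y ≡ 0#
  integral {x} {y} x≢0 xy≡0 = begin-equality
    y               ≡⟨ *-identityˡ y ⟨
    1# * y          ≡⟨ cong (_* y) (*-inverseʳ x x≢0) ⟨
    x * x ⁻¹ * y    ≡⟨ solve 3 (λ x i y → x :* i :* y := i :* (x :* y)) refl x (x ⁻¹) y ⟩
    x ⁻¹ * (x * y)  ≡⟨ cong (x ⁻¹ *_) xy≡0 ⟩
    x ⁻¹ * 0#       ≡⟨ zeroʳ _ ⟩
    0#              ∎

  *-pos : ∀ {x y} → 0# < x → 0# < y → 0# < x * y
  *-pos 0<x 0<y = *-nonneg (proj₁ 0<x) (proj₁ 0<y) ,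
    λ eq → <⇒≢ 0<y (integral (<⇒≢ 0<x) (sym eq))

  *-cancelˡ-≤ : ∀ {x y z} → 0# < z → z * x ≤ z * y → x ≤ y
  *-cancelˡ-≤ {x} {y} {z} 0<z zx≤zy with x ≤? y
  ... | yes x≤y = x≤y
  ... | no  x≰y = ⊥-elim (<⇒≱ (<-via (z * (x - y)) (*-pos 0<z (0<- (≰⇒< x≰y)))
          (solve 3 (λ x y z → z :* x := z :* y :+ z :* (x :- y)) refl x y z)) zx≤zy)

  *-monoˡ-< : ∀ {x y z} → 0# < z → x < y → z * x < z * y
  *-monoˡ-< {x} {y} {z} 0<z x<y = <-via (z * (y - x)) (*-pos 0<z (0<- x<y))
    (solve 3 (λ x y z → z :* y := z :* x :+ z :* (y :- x)) refl x y z)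

  ⁻¹-pos : ∀ {x} → 0# < x → 0# < x ⁻¹
  ⁻¹-pos {x} 0<x = ≰⇒< λ i≤0 → <⇒≱ 0<1 (begin
    1#       ≡⟨ *-inverseʳ x (<⇒≢ 0<x) ⟨
    x * x ⁻¹ ≤⟨ *-monoˡ-≤ (proj₁ 0<x) i≤0 ⟩
    x * 0#   ≡⟨ zeroʳ x ⟩
    0#       ∎)

  fromℕ-pos : ∀ n → .{{NonZero n}} → 0# < fromℕ n
  fromℕ-pos (suc n) = +-pos-nonneg 0<1 (fromℕ-nonneg n)

  fromℕ-cancel-≤ : ∀ {m n} → fromℕ m ≤ fromℕ n → m ℕ.≤ n
  fromℕ-cancel-≤ {m} {n} le with m ℕₚ.≤? n
  ... | yes m≤n = m≤n
  ... | no m≰n = ⊥-elim (<⇒≱ (<-≤-trans (<-via 1# 0<1 (+-comm 1# (fromℕ n))) (fromℕ-mono (ℕₚ.≰⇒> m≰n))) le)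

  square-cancel-≤ : ∀ {x y} → 0# ≤ y → x * x ≤ y * y → x ≤ y
  square-cancel-≤ {x} {y} 0≤y xx≤yy with x ≤? y
  ... | yes x≤y = x≤y
  ... | no  x≰y = ⊥-elim (<⇒≱ (<-via ((x - y) * (x - y) + (y + y) * (x - y))
          (+-pos-nonneg (*-pos 0<d 0<d) (*-nonneg (+-nonneg 0≤y 0≤y) (proj₁ 0<d)))
          (solve 2 (λ x y → x :* x := y :* y :+ ((x :- y) :* (x :- y) :+ (y :+ y) :* (x :- y))) refl x y)) xx≤yy)
    where 0<d = 0<- (≰⇒< x≰y)

  ^-nonneg : ∀ {x} n → 0# ≤ x → 0# ≤ x ^ n
  ^-nonneg zero    0≤x = 0≤1
  ^-nonneg (suc n) 0≤x = *-nonneg 0≤x (^-nonneg n 0≤x)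

  ^-pos : ∀ {x} n → 0# < x → 0# < x ^ n
  ^-pos zero    0<x = 0<1
  ^-pos (suc n) 0<x = *-pos 0<x (^-pos n 0<x)

  ^-mono-≤ : ∀ {x y} n → 0# ≤ x → x ≤ y → x ^ n ≤ y ^ n
  ^-mono-≤ zero    0≤x x≤y = ≤-refl
  ^-mono-≤ (suc n) 0≤x x≤y = *-mono-≤ 0≤x (^-nonneg n (≤-trans 0≤x x≤y)) x≤y (^-mono-≤ n 0≤x x≤y)

  1≤^ : ∀ {x} n → 1# ≤ x → 1# ≤ x ^ n
  1≤^ zero    1≤x = ≤-refl
  1≤^ {x} (suc n) 1≤x = begin
    1#       ≡⟨ *-identityʳ 1# ⟨
    1# * 1#  ≤⟨ *-mono-≤ 0≤1 (^-nonneg n (≤-trans 0≤1 1≤x)) 1≤x (1≤^ n 1≤x) ⟩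
    x * x ^ n ∎

  ^-monoʳ-≤ : ∀ {x a b} → 1# ≤ x → a ℕ.≤ b → x ^ a ≤ x ^ b
  ^-monoʳ-≤ {b = b} 1≤x ℕ.z≤n       = 1≤^ b 1≤x
  ^-monoʳ-≤ 1≤x (ℕ.s≤s a≤b) = *-monoˡ-≤ (≤-trans 0≤1 1≤x) (^-monoʳ-≤ 1≤x a≤b)

  open Algebra.Properties.Semiring.Exp semiring public using (^-homo-*; ^-assocʳ)
  open Algebra.Properties.CommutativeSemiring.Exp commutativeSemiring public using (^-distrib-*)

  fromℕ-^ : ∀ a n → fromℕ (a ℕ.^ n) ≡ fromℕ a ^ n
  fromℕ-^ a zero    = fromℕ-1
  fromℕ-^ a (suc n) = trans (fromℕ-* a (a ℕ.^ n)) (cong (fromℕ a *_) (fromℕ-^ a n))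

  square : ∀ x → x ^ 2 ≡ x * x
  square x = cong (x *_) (*-identityʳ x)

least : {P : Pred ℕ 0ℓ} → Decidable P → ∀ N → P N → ∃[ n ] P n × (∀ j → j ℕ.< n → ¬ P j)
least P? zero pN = zero , pN , λ _ ()
least P? (suc N) pN with P? zero
... | yes p0 = zero , p0 , λ _ ()
... | no ¬p0 with least (P? ∘ suc) N pN
... | n , pn , below = suc n , pn , λ { zero _ → ¬p0 ; (suc j) (ℕ.s≤s j<n) → below j j<n }

-- Consequences of completeness: square roots and the Archimedean property

module Completeness (R : CompleteOrderedField) where
  open OrderedField R
  open ≤-Reasoning

  ⁻¹-unique : ∀ {x y} → x * y ≡ 1# → y ≡ x ⁻¹
  ⁻¹-unique {x} {y} xy≡1 = begin-equality
    y              ≡⟨ *-identityˡ y ⟨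
    1# * y         ≡⟨ cong (_* y) (*-inverseʳ x x≢0) ⟨
    x * x ⁻¹ * y   ≡⟨ solve 3 (λ x i y → x :* i :* y := i :* (x :* y)) refl x (x ⁻¹) y ⟩
    x ⁻¹ * (x * y) ≡⟨ cong (x ⁻¹ *_) xy≡1 ⟩
    x ⁻¹ * 1#      ≡⟨ *-identityʳ _ ⟩
    x ⁻¹           ∎
    where
      x≢0 : x ≢ 0#
      x≢0 x≡0 = 0≢1 (trans (sym (zeroˡ y)) (trans (cong (_* y) (sym x≡0)) xy≡1))

  *-cancelˡ-≡ : ∀ {x y z} → 0# < z → z * x ≡ z * y → x ≡ y
  *-cancelˡ-≡ 0<z eq = ≤-antisym (*-cancelˡ-≤ 0<z (≤-reflexive eq)) (*-cancelˡ-≤ 0<z (≤-reflexive (sym eq)))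

  private
    rootSet : ℝ → Pred ℝ 0ℓ
    rootSet a x = x * x ≤ a

    rootSet-inhabited : ∀ {a} → 0# ≤ a → ∃ (rootSet a)
    rootSet-inhabited 0≤a = 0# , ≤-trans (≤-reflexive (zeroˡ 0#)) 0≤a

    rootSet-bounded : ∀ {a} → 0# ≤ a → ∃ (UpperBound (rootSet a))
    rootSet-bounded {a} 0≤a = a + 1# , λ x xx≤a → square-cancel-≤ (+-nonneg 0≤a 0≤1)
      (≤-trans xx≤a (≤-via (a * a + (a + 1#)) (+-nonneg (square-nonneg a) (+-nonneg 0≤a 0≤1))
        (solve 1 (λ a → (a :+ c# 1) :* (a :+ c# 1) := a :+ (a :* a :+ (a :+ c# 1))) refl a)))

  √-upper : ∀ {a x} → 0# ≤ a → x * x ≤ a → x ≤ √ a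
  √-upper 0≤a = sup-upper _ (rootSet-inhabited 0≤a) (rootSet-bounded 0≤a) _

  √-nonneg : ∀ {a} → 0# ≤ a → 0# ≤ √ a
  √-nonneg 0≤a = √-upper 0≤a (≤-trans (≤-reflexive (zeroˡ 0#)) 0≤a)

  -- If the square of the supremum s fell short of a, a slightly larger s + h would still belong to
  -- the set; if it exceeded a, a smaller s - h would already bound the set.
  √-square : ∀ {a} → 0# ≤ a → √ a * √ a ≡ a
  √-square {a} 0≤a with √ a * √ a ≤? a | a ≤? √ a * √ a
  ... | yes ss≤a | yes a≤ss = ≤-antisym ss≤a a≤ss
  ... | yes _ | no a≰ss = ⊥-elim (<⇒≱ (<-via h 0<h refl) (√-upper 0≤a (begin
      (s + h) * (s + h)           ≡⟨ solve 2 (λ s h → (s :+ h) :* (s :+ h) := s :* s :+ h :* (s :+ s :+ h)) refl s h ⟩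
      s * s + h * (s + s + h)     ≤⟨ +-monoʳ-≤ (s * s) (*-monoˡ-≤ (proj₁ 0<h) (+-monoʳ-≤ (s + s) h≤1)) ⟩
      s * s + h * (s + s + 1#)    ≤⟨ +-monoʳ-≤ (s * s) (*-monoˡ-≤ (proj₁ 0<h) (≤-via e (proj₁ 0<e) refl)) ⟩
      s * s + h * w               ≡⟨ cong (s * s +_) hw≡e ⟩
      s * s + e                   ≡⟨ solve 2 (λ s a → s :* s :+ (a :- s :* s) := a) refl s a ⟩
      a                           ∎)))
    where
      s = √ a
      e = a - s * s
      w = s + s + 1# + e
      -- The denominator is large enough for both h ≤ 1 and h (2 s + 1) ≤ e.
      h = e * w ⁻¹
      0<e : 0# < e
      0<e = 0<- (≰⇒< a≰ss)
      0<w : 0# < w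
      0<w = subst (0# <_) (solve 2 (λ s e → e :+ (s :+ s :+ c# 1) := s :+ s :+ c# 1 :+ e) refl s e)
        (+-pos-nonneg 0<e (+-nonneg (+-nonneg (√-nonneg 0≤a) (√-nonneg 0≤a)) 0≤1))
      0<h : 0# < h
      0<h = *-pos 0<e (⁻¹-pos 0<w)
      hw≡e : h * w ≡ e
      hw≡e = begin-equality
        e * w ⁻¹ * w   ≡⟨ solve 3 (λ e i w → e :* i :* w := e :* (w :* i)) refl e (w ⁻¹) w ⟩
        e * (w * w ⁻¹) ≡⟨ cong (e *_) (*-inverseʳ w (<⇒≢ 0<w)) ⟩
        e * 1#         ≡⟨ *-identityʳ e ⟩
        e              ∎
      h≤1 : h ≤ 1#
      h≤1 = *-cancelˡ-≤ 0<w (begin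
        w * h  ≡⟨ *-comm w h ⟩
        h * w  ≡⟨ hw≡e ⟩
        e      ≤⟨ ≤-via (s + s + 1#) (+-nonneg (+-nonneg (√-nonneg 0≤a) (√-nonneg 0≤a)) 0≤1)
                    (solve 2 (λ s e → s :+ s :+ c# 1 :+ e := e :+ (s :+ s :+ c# 1)) refl s e) ⟩
        w      ≡⟨ *-identityʳ w ⟨
        w * 1# ∎)
  ... | no ss≰a | _ = ⊥-elim (<⇒≱ 0<h (begin
      h         ≡⟨ solve 2 (λ s h → h := h :- s :+ s) refl s h ⟩
      h - s + s ≤⟨ +-monoʳ-≤ (h - s) s≤s-h ⟩
      h - s + (s - h) ≡⟨ solve 2 (λ s h → h :- s :+ (s :- h) := c# 0) refl s h ⟩
      0#        ∎))
    where
      s = √ a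
      0<s : 0# < s
      0<s = ≰⇒< λ s≤0 → ss≰a (≤-trans (≤-reflexive
        (trans (cong (λ x → x * x) (≤-antisym s≤0 (√-nonneg 0≤a))) (zeroˡ 0#))) 0≤a)
      e = s * s - a
      -- The Newton step: (s - h)² = a + h², still at least a.
      h = e * (s + s) ⁻¹
      0<2s : 0# < s + s
      0<2s = +-pos-nonneg 0<s (proj₁ 0<s)
      0<h : 0# < h
      0<h = *-pos (0<- (≰⇒< ss≰a)) (⁻¹-pos 0<2s)
      2sh≡e : (s + s) * h ≡ e
      2sh≡e = begin-equality
        (s + s) * (e * (s + s) ⁻¹) ≡⟨ solve 3 (λ e i w → w :* (e :* i) := e :* (w :* i)) refl e ((s + s) ⁻¹) (s + s) ⟩
        e * ((s + s) * (s + s) ⁻¹) ≡⟨ cong (e *_) (*-inverseʳ _ (<⇒≢ 0<2s)) ⟩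
        e * 1#         ≡⟨ *-identityʳ e ⟩
        e              ∎
      0≤s-h : 0# ≤ s - h
      0≤s-h = *-cancelˡ-≤ 0<2s (begin
        (s + s) * 0#             ≡⟨ zeroʳ _ ⟩
        0#                       ≤⟨ +-nonneg (square-nonneg s) 0≤a ⟩
        s * s + a                ≡⟨ solve 2 (λ s a → s :* s :+ a := (s :+ s) :* s :- (s :* s :- a)) refl s a ⟩
        (s + s) * s - e          ≡⟨ cong (λ x → (s + s) * s - x) 2sh≡e ⟨
        (s + s) * s - (s + s) * h ≡⟨ solve 2 (λ s h → (s :+ s) :* s :- (s :+ s) :* h := (s :+ s) :* (s :- h)) refl s h ⟩
        (s + s) * (s - h)        ∎)
      s≤s-h : s ≤ s - h
      s≤s-h = sup-least _ (rootSet-inhabited 0≤a) (rootSet-bounded 0≤a) (s - h) λ x xx≤a →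
        square-cancel-≤ 0≤s-h (≤-trans xx≤a (≤-via (h * h) (square-nonneg h) (begin-equality
          (s - h) * (s - h)           ≡⟨ solve 2 (λ s h → (s :- h) :* (s :- h) := s :* s :- (s :+ s) :* h :+ h :* h) refl s h ⟩
          s * s - (s + s) * h + h * h ≡⟨ cong (λ x → s * s - x + h * h) 2sh≡e ⟩
          s * s - e + h * h           ≡⟨ solve 3 (λ s a h → s :* s :- (s :* s :- a) :+ h :* h := a :+ h :* h) refl s a h ⟩
          a + h * h                   ∎)))

  -- The supremum s of the naturals would be at most s - 1, because n + 1 ≤ s for every n.
  archimedean : ∀ x → ¬ (∀ n → fromℕ n ≤ x)
  archimedean x bounded = <⇒≱ 0<1 (begin
      1#           ≡⟨ solve 1 (λ s → c# 1 := c# 1 :- s :+ s) refl s ⟩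
      1# - s + s   ≤⟨ +-monoʳ-≤ (1# - s) s≤s-1 ⟩
      1# - s + (s - 1#) ≡⟨ solve 1 (λ s → c# 1 :- s :+ (s :- c# 1) := c# 0) refl s ⟩
      0#           ∎)
    where
      S : Pred ℝ 0ℓ
      S y = ∃[ n ] fromℕ n ≡ y
      inhabited : ∃ S
      inhabited = 0# , 0 , refl
      above : ∃ (UpperBound S)
      above = x , λ { _ (n , refl) → bounded n }
      s = sup S
      s≤s-1 : s ≤ s - 1#
      s≤s-1 = sup-least S inhabited above (s - 1#) λ { _ (n , refl) →
        ≤-via _ (0≤- (sup-upper S inhabited above _ (suc n , refl)))
          (solve 2 (λ s n → s :- c# 1 := n :+ (s :- (c# 1 :+ n))) refl s (fromℕ n)) }

  -- Unlike `sum` it grows at the far end, so partial sums of a series and the running total of a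
  -- program loop extend it by computation.
  sumℕ : ℕ → (ℕ → ℝ) → ℝ
  sumℕ zero    f = 0#
  sumℕ (suc n) f = sumℕ n f + f n

  sumℕ-front : ∀ n f → sumℕ (suc n) f ≡ f 0 + sumℕ n (f ∘ suc)
  sumℕ-front zero    f = +-comm _ _
  sumℕ-front (suc n) f = trans (cong (_+ f (suc n)) (sumℕ-front n f)) (+-assoc _ _ _)

  sum≡sumℕ : ∀ n f → sum {n} (f ∘ toℕ) ≡ sumℕ n f
  sum≡sumℕ zero    f = refl
  sum≡sumℕ (suc n) f = trans (cong (f 0 +_) (sum≡sumℕ n (f ∘ suc))) (sym (sumℕ-front n f))

  sumℕ-mono : ∀ n {f g} → (∀ i → f i ≤ g i) → sumℕ n f ≤ sumℕ n g
  sumℕ-mono zero    le = ≤-refl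
  sumℕ-mono (suc n) le = +-mono-≤ (sumℕ-mono n le) (le n)

  ½ : ℝ
  ½ = (1# + 1#) ⁻¹

  0<2 : 0# < 1# + 1#
  0<2 = +-pos-nonneg 0<1 0≤1

  1≤2 : 1# ≤ 1# + 1#
  1≤2 = ≤-via 1# 0≤1 refl

  ½-pos : 0# < ½
  ½-pos = ⁻¹-pos 0<2

  ½+½ : ½ + ½ ≡ 1#
  ½+½ = trans (solve 1 (λ h → h :+ h := (c# 1 :+ c# 1) :* h) refl ½) (*-inverseʳ _ (<⇒≢ 0<2))

-- Formal power series: exp, cosh, the Gaussian series, and a lower bound on the logarithm

module Sequences (R : CompleteOrderedField) where
  open OrderedField R
  open Completeness R
  open ≤-Reasoning

  -- Cauchy product of coefficient sequences; sequences stand for formal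
  -- power series, and ∂ and shift are d/dx and multiplication by x.
  conv : (ℕ → ℝ) → (ℕ → ℝ) → ℕ → ℝ
  conv f g zero    = f 0 * g 0
  conv f g (suc n) = f 0 * g (suc n) + conv (f ∘ suc) g n

  shift : (ℕ → ℝ) → ℕ → ℝ
  shift f zero    = 0#
  shift f (suc n) = f n

  ∂ : (ℕ → ℝ) → ℕ → ℝ
  ∂ f n = fromℕ (suc n) * f (suc n)

  conv-cong : ∀ {f f′ g g′} n → (∀ i → f i ≡ f′ i) → (∀ i → g i ≡ g′ i) → conv f g n ≡ conv f′ g′ n
  conv-cong zero    ff gg = cong₂ _*_ (ff 0) (gg 0)
  conv-cong (suc n) ff gg = cong₂ _+_ (cong₂ _*_ (ff 0) (gg (suc n))) (conv-cong n (ff ∘ suc) gg)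

  conv-mono : ∀ {f f′ g g′} n → (∀ i → 0# ≤ f i) → (∀ i → f i ≤ f′ i) →
              (∀ i → 0# ≤ g i) → (∀ i → g i ≤ g′ i) → conv f g n ≤ conv f′ g′ n
  conv-mono zero    0f ff 0g gg = *-mono-≤ (0f 0) (≤-trans (0g 0) (gg 0)) (ff 0) (gg 0)
  conv-mono (suc n) 0f ff 0g gg = +-mono-≤
    (*-mono-≤ (0f 0) (≤-trans (0g (suc n)) (gg (suc n))) (ff 0) (gg (suc n)))
    (conv-mono n (0f ∘ suc) (ff ∘ suc) 0g gg)

  conv-nonneg : ∀ {f g} n → (∀ i → 0# ≤ f i) → (∀ i → 0# ≤ g i) → 0# ≤ conv f g n
  conv-nonneg zero    0f 0g = *-nonneg (0f 0) (0g 0)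
  conv-nonneg (suc n) 0f 0g = +-nonneg (*-nonneg (0f 0) (0g (suc n))) (conv-nonneg n (0f ∘ suc) 0g)

  conv-addˡ : ∀ f f′ g n → conv (λ i → f i + f′ i) g n ≡ conv f g n + conv f′ g n
  conv-addˡ f f′ g zero    = distribʳ _ _ _
  conv-addˡ f f′ g (suc n) = trans (cong ((f 0 + f′ 0) * g (suc n) +_) (conv-addˡ (f ∘ suc) (f′ ∘ suc) g n))
    (solve 5 (λ a b c d e → (a :+ b) :* c :+ (d :+ e) := a :* c :+ d :+ (b :* c :+ e)) refl
      (f 0) (f′ 0) (g (suc n)) (conv (f ∘ suc) g n) (conv (f′ ∘ suc) g n))

  conv-addʳ : ∀ f g g′ n → conv f (λ i → g i + g′ i) n ≡ conv f g n + conv f g′ n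
  conv-addʳ f g g′ zero    = distribˡ _ _ _
  conv-addʳ f g g′ (suc n) = trans (cong (f 0 * (g (suc n) + g′ (suc n)) +_) (conv-addʳ (f ∘ suc) g g′ n))
    (solve 5 (λ a b c d e → c :* (a :+ b) :+ (d :+ e) := c :* a :+ d :+ (c :* b :+ e)) refl
      (g (suc n)) (g′ (suc n)) (f 0) (conv (f ∘ suc) g n) (conv (f ∘ suc) g′ n))

  conv-scaleˡ : ∀ c f g n → conv (λ i → c * f i) g n ≡ c * conv f g n
  conv-scaleˡ c f g zero    = *-assoc _ _ _
  conv-scaleˡ c f g (suc n) = trans (cong (c * f 0 * g (suc n) +_) (conv-scaleˡ c (f ∘ suc) g n))
    (solve 4 (λ c a b d → c :* a :* b :+ c :* d := c :* (a :* b :+ d)) refl c (f 0) (g (suc n)) (conv (f ∘ suc) g n))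

  conv-scaleʳ : ∀ c f g n → conv f (λ i → c * g i) n ≡ c * conv f g n
  conv-scaleʳ c f g zero    = solve 3 (λ c a b → a :* (c :* b) := c :* (a :* b)) refl c (f 0) (g 0)
  conv-scaleʳ c f g (suc n) = trans (cong (f 0 * (c * g (suc n)) +_) (conv-scaleʳ c (f ∘ suc) g n))
    (solve 4 (λ c a b d → a :* (c :* b) :+ c :* d := c :* (a :* b :+ d)) refl c (f 0) (g (suc n)) (conv (f ∘ suc) g n))

  conv-shiftˡ : ∀ f g n → conv (shift f) g n ≡ shift (conv f g) n
  conv-shiftˡ f g zero    = zeroˡ _
  conv-shiftˡ f g (suc n) = trans (cong (_+ conv f g n) (zeroˡ _)) (+-identityˡ _)

  conv-shiftʳ : ∀ f g n → conv f (shift g) n ≡ shift (conv f g) n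
  conv-shiftʳ f g zero          = zeroʳ _
  conv-shiftʳ f g (suc zero)    = trans (cong (_ +_) (zeroʳ _)) (+-identityʳ _)
  conv-shiftʳ f g (suc (suc n)) = cong (f 0 * g (suc n) +_) (conv-shiftʳ (f ∘ suc) g (suc n))

  -- The product rule. With it, series identities follow by comparing derivatives and cancelling n +
  -- 1, so no binomial coefficients occur.
  leibniz : ∀ f g n → fromℕ (suc n) * conv f g (suc n) ≡ conv (∂ f) g n + conv f (∂ g) n
  leibniz f g zero = solve 5 (λ a b c d o → o :* (a :* d :+ b :* c) := (o :* b) :* c :+ a :* (o :* d)) refl
    (f 0) (f 1) (g 0) (g 1) (fromℕ 1)
  leibniz f g (suc n) = begin-equality
    (1# + N) * (f 0 * g (2 ℕ.+ n) + conv f′ g (suc n))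
      ≡⟨ solve 4 (λ N a b c → (c# 1 :+ N) :* (a :* b :+ c) := (c# 1 :+ N) :* a :* b :+ (c :+ N :* c)) refl
           N (f 0) (g (2 ℕ.+ n)) (conv f′ g (suc n)) ⟩
    (1# + N) * f 0 * g (2 ℕ.+ n) + (conv f′ g (suc n) + N * conv f′ g (suc n))
      ≡⟨ cong (λ x → (1# + N) * f 0 * g (2 ℕ.+ n) + (conv f′ g (suc n) + x)) (leibniz f′ g n) ⟩
    (1# + N) * f 0 * g (2 ℕ.+ n) + (conv f′ g (suc n) + (conv (∂ f′) g n + conv f′ (∂ g) n))
      ≡⟨ solve 6 (λ N a b c d e → (c# 1 :+ N) :* a :* b :+ (c :+ (d :+ e)) := c :+ d :+ (a :* ((c# 1 :+ N) :* b) :+ e)) refl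
           N (f 0) (g (2 ℕ.+ n)) (conv f′ g (suc n)) (conv (∂ f′) g n) (conv f′ (∂ g) n) ⟩
    conv f′ g (suc n) + conv (∂ f′) g n + conv f (∂ g) (suc n)
      ≡⟨ cong (λ x → conv f′ g (suc n) + x + conv f (∂ g) (suc n)) (conv-shiftˡ (∂ f′) g (suc n)) ⟨
    conv f′ g (suc n) + conv (shift (∂ f′)) g (suc n) + conv f (∂ g) (suc n)
      ≡⟨ cong (_+ conv f (∂ g) (suc n)) (conv-addˡ f′ (shift (∂ f′)) g (suc n)) ⟨
    conv (λ i → f′ i + shift (∂ f′) i) g (suc n) + conv f (∂ g) (suc n)
      ≡⟨ cong (_+ conv f (∂ g) (suc n)) (conv-cong (suc n) ∂f≡ (λ _ → refl)) ⟨
    conv (∂ f) g (suc n) + conv f (∂ g) (suc n) ∎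
    where
      N  = fromℕ (suc n)
      f′ = f ∘ suc
      ∂f≡ : ∀ i → ∂ f i ≡ f′ i + shift (∂ f′) i
      ∂f≡ zero    = solve 1 (λ x → (c# 1 :+ c# 0) :* x := x :+ c# 0) refl (f 1)
      ∂f≡ (suc i) = solve 2 (λ n x → (c# 1 :+ n) :* x := x :+ n :* x) refl (fromℕ (suc i)) (f (2 ℕ.+ i))

  ∂-cancel : ∀ {x y} n → fromℕ (suc n) * x ≡ fromℕ (suc n) * y → x ≡ y
  ∂-cancel n = *-cancelˡ-≡ (fromℕ-pos (suc n))

  expCoeff : ℝ → ℕ → ℝ
  expCoeff x i = x ^ i * fromℕ (i !) ⁻¹

  expCoeff-0 : ∀ x → expCoeff x 0 ≡ 1#
  expCoeff-0 x = trans (cong (1# *_) (sym (⁻¹-unique (trans (cong (_* 1#) fromℕ-1) (*-identityʳ 1#))))) (*-identityʳ 1#)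

  ∂-expCoeff : ∀ x n → ∂ (expCoeff x) n ≡ x * expCoeff x n
  ∂-expCoeff x n = begin-equality
    N * (x * x ^ n * fromℕ (suc n !) ⁻¹) ≡⟨ solve 4 (λ N x y i → N :* (x :* y :* i) := x :* (y :* (N :* i))) refl N x (x ^ n) (fromℕ (suc n !) ⁻¹) ⟩
    x * (x ^ n * (N * fromℕ (suc n !) ⁻¹)) ≡⟨ cong (λ y → x * (x ^ n * y)) (⁻¹-unique inverse) ⟩
    x * (x ^ n * fromℕ (n !) ⁻¹) ∎
    where
      N = fromℕ (suc n)
      inverse : fromℕ (n !) * (N * fromℕ (suc n !) ⁻¹) ≡ 1#
      inverse = begin-equality
        fromℕ (n !) * (N * fromℕ (suc n !) ⁻¹) ≡⟨ solve 3 (λ a b c → a :* (b :* c) := b :* a :* c) refl (fromℕ (n !)) N _ ⟩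
        N * fromℕ (n !) * fromℕ (suc n !) ⁻¹   ≡⟨ cong (_* fromℕ (suc n !) ⁻¹) (fromℕ-* (suc n) (n !)) ⟨
        fromℕ (suc n !) * fromℕ (suc n !) ⁻¹   ≡⟨ *-inverseʳ _ (<⇒≢ (fromℕ-pos (suc n !) {{suc n ℕₚ.!≢0}})) ⟩
        1# ∎

  expCoeff-nonneg : ∀ {x} n → 0# ≤ x → 0# ≤ expCoeff x n
  expCoeff-nonneg n 0≤x = *-nonneg (^-nonneg n 0≤x) (proj₁ (⁻¹-pos (fromℕ-pos (n !) {{n ℕₚ.!≢0}})))

  -- Both sides satisfy f' = (x + y) f and have constant term 1.
  conv-expCoeff : ∀ x y n → conv (expCoeff x) (expCoeff y) n ≡ expCoeff (x + y) n
  conv-expCoeff x y zero = trans (cong₂ _*_ (expCoeff-0 x) (expCoeff-0 y)) (trans (*-identityʳ 1#) (sym (expCoeff-0 (x + y))))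
  conv-expCoeff x y (suc n) = ∂-cancel n (begin-equality
    fromℕ (suc n) * conv (expCoeff x) (expCoeff y) (suc n) ≡⟨ leibniz _ _ n ⟩
    conv (∂ (expCoeff x)) (expCoeff y) n + conv (expCoeff x) (∂ (expCoeff y)) n
      ≡⟨ cong₂ _+_ (conv-cong n (∂-expCoeff x) (λ _ → refl)) (conv-cong n (λ _ → refl) (∂-expCoeff y)) ⟩
    conv (λ i → x * expCoeff x i) (expCoeff y) n + conv (expCoeff x) (λ i → y * expCoeff y i) n
      ≡⟨ cong₂ _+_ (conv-scaleˡ x _ _ n) (conv-scaleʳ y _ _ n) ⟩
    x * conv (expCoeff x) (expCoeff y) n + y * conv (expCoeff x) (expCoeff y) n ≡⟨ distribʳ _ x y ⟨
    (x + y) * conv (expCoeff x) (expCoeff y) n ≡⟨ cong ((x + y) *_) (conv-expCoeff x y n) ⟩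
    (x + y) * expCoeff (x + y) n ≡⟨ ∂-expCoeff (x + y) n ⟨
    fromℕ (suc n) * expCoeff (x + y) (suc n) ∎)

  -- The coefficients of exp (s t² / 2) as a series in t.
  gaussCoeff : ℝ → ℕ → ℝ
  gaussCoeff s 0             = 1#
  gaussCoeff s 1             = 0#
  gaussCoeff s (suc (suc n)) = s * gaussCoeff s n * fromℕ (2 ℕ.+ n) ⁻¹

  ∂-gaussCoeff : ∀ s n → ∂ (gaussCoeff s) n ≡ s * shift (gaussCoeff s) n
  ∂-gaussCoeff s zero    = trans (zeroʳ _) (sym (zeroʳ _))
  ∂-gaussCoeff s (suc n) = begin-equality
    N * (s * gaussCoeff s n * N ⁻¹) ≡⟨ solve 3 (λ N g i → N :* (g :* i) := g :* (N :* i)) refl N (s * gaussCoeff s n) (N ⁻¹) ⟩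
    s * gaussCoeff s n * (N * N ⁻¹) ≡⟨ cong (s * gaussCoeff s n *_) (*-inverseʳ N (<⇒≢ (fromℕ-pos (2 ℕ.+ n)))) ⟩
    s * gaussCoeff s n * 1#         ≡⟨ *-identityʳ _ ⟩
    s * gaussCoeff s n ∎
    where N = fromℕ (2 ℕ.+ n)

  gaussCoeff-nonneg : ∀ {s} n → 0# ≤ s → 0# ≤ gaussCoeff s n
  gaussCoeff-nonneg 0 0≤s = 0≤1
  gaussCoeff-nonneg 1 0≤s = ≤-refl
  gaussCoeff-nonneg (suc (suc n)) 0≤s =
    *-nonneg (*-nonneg 0≤s (gaussCoeff-nonneg n 0≤s)) (proj₁ (⁻¹-pos (fromℕ-pos (2 ℕ.+ n))))

  -- Both sides satisfy f' = (s + t) u f in the series variable u. The factor u is the `shift`, so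
  -- the induction descends by two.
  conv-gaussCoeff : ∀ s t n → conv (gaussCoeff s) (gaussCoeff t) n ≡ gaussCoeff (s + t) n
  conv-gaussCoeff s t zero    = *-identityʳ 1#
  conv-gaussCoeff s t (suc n) = ∂-cancel n (begin-equality
    fromℕ (suc n) * conv (gaussCoeff s) (gaussCoeff t) (suc n) ≡⟨ leibniz _ _ n ⟩
    conv (∂ (gaussCoeff s)) (gaussCoeff t) n + conv (gaussCoeff s) (∂ (gaussCoeff t)) n
      ≡⟨ cong₂ _+_ (conv-cong n (∂-gaussCoeff s) (λ _ → refl)) (conv-cong n (λ _ → refl) (∂-gaussCoeff t)) ⟩
    conv (λ i → s * shift (gaussCoeff s) i) (gaussCoeff t) n + conv (gaussCoeff s) (λ i → t * shift (gaussCoeff t) i) n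
      ≡⟨ cong₂ _+_ (conv-scaleˡ s _ _ n) (conv-scaleʳ t _ _ n) ⟩
    s * conv (shift (gaussCoeff s)) (gaussCoeff t) n + t * conv (gaussCoeff s) (shift (gaussCoeff t)) n
      ≡⟨ cong₂ (λ a b → s * a + t * b) (conv-shiftˡ _ _ n) (conv-shiftʳ _ _ n) ⟩
    s * shift (conv (gaussCoeff s) (gaussCoeff t)) n + t * shift (conv (gaussCoeff s) (gaussCoeff t)) n ≡⟨ distribʳ _ s t ⟨
    (s + t) * shift (conv (gaussCoeff s) (gaussCoeff t)) n ≡⟨ cong ((s + t) *_) (earlier n) ⟩
    (s + t) * shift (gaussCoeff (s + t)) n ≡⟨ ∂-gaussCoeff (s + t) n ⟨
    fromℕ (suc n) * gaussCoeff (s + t) (suc n) ∎)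
    where
      earlier : ∀ n → shift (conv (gaussCoeff s) (gaussCoeff t)) n ≡ shift (gaussCoeff (s + t)) n
      earlier zero    = refl
      earlier (suc n) = conv-gaussCoeff s t n

  -- The series of cosh (x u) in u, the moment generating function of x times a fair sign.
  coshCoeff : ℝ → ℕ → ℝ
  coshCoeff x n = ½ * (expCoeff x n + expCoeff (- x) n)

  private
    ∂²-expCoeff : ∀ x n → fromℕ (suc n) * (fromℕ (2 ℕ.+ n) * expCoeff x (2 ℕ.+ n)) ≡ x * x * expCoeff x n
    ∂²-expCoeff x n = begin-equality
      fromℕ (suc n) * (fromℕ (2 ℕ.+ n) * expCoeff x (2 ℕ.+ n)) ≡⟨ cong (fromℕ (suc n) *_) (∂-expCoeff x (suc n)) ⟩
      fromℕ (suc n) * (x * expCoeff x (suc n)) ≡⟨ solve 3 (λ a b c → a :* (b :* c) := b :* (a :* c)) refl (fromℕ (suc n)) x _ ⟩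
      x * (fromℕ (suc n) * expCoeff x (suc n)) ≡⟨ cong (x *_) (∂-expCoeff x n) ⟩
      x * (x * expCoeff x n) ≡⟨ *-assoc x x _ ⟨
      x * x * expCoeff x n ∎

  ∂²-coshCoeff : ∀ x n → fromℕ (suc n) * (fromℕ (2 ℕ.+ n) * coshCoeff x (2 ℕ.+ n)) ≡ x * x * coshCoeff x n
  ∂²-coshCoeff x n = begin-equality
    a * (b * (½ * (c + d)))         ≡⟨ solve 5 (λ a b h c d → a :* (b :* (h :* (c :+ d))) := h :* (a :* (b :* c) :+ a :* (b :* d))) refl a b ½ c d ⟩
    ½ * (a * (b * c) + a * (b * d)) ≡⟨ cong₂ (λ u v → ½ * (u + v)) (∂²-expCoeff x n) (∂²-expCoeff (- x) n) ⟩
    ½ * (x * x * e + - x * - x * f) ≡⟨ solve 4 (λ h x e f → h :* (x :* x :* e :+ :- x :* :- x :* f) := x :* x :* (h :* (e :+ f))) refl ½ x e f ⟩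
    x * x * coshCoeff x n           ∎
    where
      a = fromℕ (suc n)
      b = fromℕ (2 ℕ.+ n)
      c = expCoeff x (2 ℕ.+ n)
      d = expCoeff (- x) (2 ℕ.+ n)
      e = expCoeff x n
      f = expCoeff (- x) n

  expCoeff-1 : ∀ x → expCoeff x 1 ≡ x
  expCoeff-1 x = trans (cong (x * 1# *_) (sym (⁻¹-unique (trans (cong (_* 1#) fromℕ-1) (*-identityʳ 1#)))))
    (trans (*-identityʳ _) (*-identityʳ x))

  coshCoeff-0 : ∀ x → coshCoeff x 0 ≡ 1#
  coshCoeff-0 x = trans (cong₂ (λ a b → ½ * (a + b)) (expCoeff-0 x) (expCoeff-0 (- x)))
    (trans (solve 1 (λ h → h :* (c# 1 :+ c# 1) := h :+ h) refl ½) ½+½)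

  coshCoeff-1 : ∀ x → coshCoeff x 1 ≡ 0#
  coshCoeff-1 x = trans (cong₂ (λ a b → ½ * (a + b)) (expCoeff-1 x) (expCoeff-1 (- x)))
    (solve 2 (λ h x → h :* (x :+ :- x) := c# 0) refl ½ x)

  coshCoeff-nonneg : ∀ x n → 0# ≤ coshCoeff x n
  coshCoeff-nonneg x 0 = ≤-trans 0≤1 (≤-reflexive (sym (coshCoeff-0 x)))
  coshCoeff-nonneg x 1 = ≤-reflexive (sym (coshCoeff-1 x))
  coshCoeff-nonneg x (suc (suc n)) = *-cancelˡ-≤ (fromℕ-pos (2 ℕ.+ n)) (*-cancelˡ-≤ (fromℕ-pos (suc n)) (begin
    fromℕ (suc n) * (fromℕ (2 ℕ.+ n) * 0#) ≡⟨ solve 2 (λ a b → a :* (b :* c# 0) := c# 0) refl (fromℕ (suc n)) (fromℕ (2 ℕ.+ n)) ⟩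
    0#                                     ≤⟨ *-nonneg (square-nonneg x) (coshCoeff-nonneg x n) ⟩
    x * x * coshCoeff x n                  ≡⟨ ∂²-coshCoeff x n ⟨
    fromℕ (suc n) * (fromℕ (2 ℕ.+ n) * coshCoeff x (2 ℕ.+ n)) ∎))

  -- From degree n to n + 2 both coefficients are multiplied by x², but that of cosh is divided by
  -- (n + 1) (n + 2) and that of the Gaussian series only by n + 2.
  coshCoeff≤gaussCoeff : ∀ x n → coshCoeff x n ≤ gaussCoeff (x * x) n
  coshCoeff≤gaussCoeff x 0 = ≤-reflexive (coshCoeff-0 x)
  coshCoeff≤gaussCoeff x 1 = ≤-reflexive (coshCoeff-1 x)
  coshCoeff≤gaussCoeff x (suc (suc n)) = *-cancelˡ-≤ (fromℕ-pos (2 ℕ.+ n)) (begin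
    N * coshCoeff x (2 ℕ.+ n)  ≤⟨ ≤-via (fromℕ n * (N * coshCoeff x (2 ℕ.+ n)))
         (*-nonneg (fromℕ-nonneg n) (*-nonneg (fromℕ-nonneg (2 ℕ.+ n)) (coshCoeff-nonneg x (2 ℕ.+ n))))
         (solve 2 (λ n y → (c# 1 :+ n) :* y := y :+ n :* y) refl (fromℕ n) (N * coshCoeff x (2 ℕ.+ n))) ⟩
    fromℕ (suc n) * (N * coshCoeff x (2 ℕ.+ n)) ≡⟨ ∂²-coshCoeff x n ⟩
    x * x * coshCoeff x n      ≤⟨ *-monoˡ-≤ (square-nonneg x) (coshCoeff≤gaussCoeff x n) ⟩
    x * x * gaussCoeff (x * x) n ≡⟨ ∂-gaussCoeff (x * x) (suc n) ⟨
    N * gaussCoeff (x * x) (2 ℕ.+ n) ∎)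
    where N = fromℕ (2 ℕ.+ n)

  private
    partialSums : (ℕ → ℝ) → ℕ → ℝ
    partialSums f n = sumℕ (suc n) f

    -- Taking partial sums is multiplication by 1 / (1 - u), which may be moved to one of the
    -- factors.
    partialSums-conv : ∀ f g n → partialSums (conv f g) n ≡ conv f (partialSums g) n
    partialSums-conv f g zero    = trans (+-identityˡ _) (cong (f 0 *_) (sym (+-identityˡ (g 0))))
    partialSums-conv f g (suc n) = begin-equality
      partialSums (conv f g) n + conv f g (suc n)             ≡⟨ cong (_+ conv f g (suc n)) (partialSums-conv f g n) ⟩
      conv f (partialSums g) n + conv f g (suc n)             ≡⟨ cong (_+ conv f g (suc n)) (conv-shiftʳ f (partialSums g) (suc n)) ⟨
      conv f (shift (partialSums g)) (suc n) + conv f g (suc n) ≡⟨ conv-addʳ f (shift (partialSums g)) g (suc n) ⟨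
      conv f (λ i → shift (partialSums g) i + g i) (suc n)    ≡⟨ conv-cong {f} (suc n) (λ _ → refl) (λ { zero → refl ; (suc i) → refl }) ⟩
      conv f (partialSums g) (suc n) ∎

    conv-const : ∀ f c n → conv f (const c) n ≡ c * partialSums f n
    conv-const f c zero    = trans (*-comm _ _) (cong (c *_) (sym (+-identityˡ _)))
    conv-const f c (suc n) = trans (cong (f 0 * c +_) (conv-const (f ∘ suc) c n))
      (trans (solve 3 (λ a c s → a :* c :+ c :* s := c :* (a :+ s)) refl (f 0) c _) (cong (c *_) (sym (sumℕ-front (suc n) f))))

    expCoeff-½ : ∀ i → expCoeff ½ i ≤ ½ ^ i
    expCoeff-½ zero    = ≤-reflexive (expCoeff-0 ½)
    expCoeff-½ (suc i) = begin
      expCoeff ½ (suc i)                 ≤⟨ ≤-via (fromℕ i * expCoeff ½ (suc i))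
        (*-nonneg (fromℕ-nonneg i) (expCoeff-nonneg (suc i) (proj₁ ½-pos))) (solve 2 (λ n y → (c# 1 :+ n) :* y := y :+ n :* y) refl (fromℕ i) _) ⟩
      fromℕ (suc i) * expCoeff ½ (suc i) ≡⟨ ∂-expCoeff ½ i ⟩
      ½ * expCoeff ½ i                   ≤⟨ *-monoˡ-≤ (proj₁ ½-pos) (expCoeff-½ i) ⟩
      ½ * ½ ^ i ∎

    geometric : ∀ n → sumℕ n (½ ^_) + (½ ^ n + ½ ^ n) ≡ 1# + 1#
    geometric zero    = +-identityˡ _
    geometric (suc n) = trans (cong (λ x → sumℕ n (½ ^_) + ½ ^ n + x) (trans (sym (distribʳ (½ ^ n) ½ ½)) (trans (cong (_* ½ ^ n) ½+½) (*-identityˡ _))))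
      (trans (+-assoc _ _ _) (geometric n))

    partialSums-½ : ∀ n → partialSums (expCoeff ½) n ≤ 1# + 1#
    partialSums-½ n = ≤-trans (sumℕ-mono (suc n) expCoeff-½)
      (≤-via _ (+-nonneg (^-nonneg (suc n) (proj₁ ½-pos)) (^-nonneg (suc n) (proj₁ ½-pos))) (sym (geometric (suc n))))

    sumℕ-nonneg : ∀ n {f} → (∀ i → 0# ≤ f i) → 0# ≤ sumℕ n f
    sumℕ-nonneg zero    0f = ≤-refl
    sumℕ-nonneg (suc n) 0f = +-nonneg (sumℕ-nonneg n 0f) (0f n)

    expCoeff-zero : ∀ n → partialSums (expCoeff 0#) n ≡ 1#
    expCoeff-zero zero    = trans (+-identityˡ _) (expCoeff-0 0#)
    expCoeff-zero (suc n) = trans (cong₂ _+_ (expCoeff-zero n) (trans (cong (_* fromℕ (suc n !) ⁻¹) (zeroˡ _)) (zeroˡ _))) (+-identityʳ 1#)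

    half-nonneg : ∀ p → 0# ≤ fromℕ p * ½
    half-nonneg p = *-nonneg (fromℕ-nonneg p) (proj₁ ½-pos)

    -- exp ½ ≤ 2 by comparison with a geometric series; multiplying p such factors gives exp (p / 2)
    -- ≤ 2^p, here for all partial sums.
    partialSums-half : ∀ p n → partialSums (expCoeff (fromℕ p * ½)) n ≤ (1# + 1#) ^ p
    partialSums-half zero n = ≤-reflexive (trans (sumℕ-cong (suc n) {expCoeff (0# * ½)} (λ i → cong (λ x → expCoeff x i) (zeroˡ ½))) (expCoeff-zero n))
      where
        sumℕ-cong : ∀ n {f g} → (∀ i → f i ≡ g i) → sumℕ n f ≡ sumℕ n g
        sumℕ-cong n eq = ≤-antisym (sumℕ-mono n (≤-reflexive ∘ eq)) (sumℕ-mono n (≤-reflexive ∘ sym ∘ eq))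
    partialSums-half (suc p) n = begin
      partialSums (expCoeff (fromℕ (suc p) * ½)) n ≤⟨ sumℕ-mono (suc n) (λ i → ≤-reflexive (cong (λ x → expCoeff x i) (solve 2 (λ p h → (c# 1 :+ p) :* h := p :* h :+ h) refl (fromℕ p) ½))) ⟩
      partialSums (expCoeff (fromℕ p * ½ + ½)) n  ≤⟨ sumℕ-mono (suc n) (λ i → ≤-reflexive (sym (conv-expCoeff (fromℕ p * ½) ½ i))) ⟩
      partialSums (conv (expCoeff (fromℕ p * ½)) (expCoeff ½)) n ≡⟨ partialSums-conv _ _ n ⟩
      conv (expCoeff (fromℕ p * ½)) (partialSums (expCoeff ½)) n ≤⟨ conv-mono n (λ i → expCoeff-nonneg i (half-nonneg p)) (λ _ → ≤-refl)
        (λ i → sumℕ-nonneg (suc i) (λ j → expCoeff-nonneg j (proj₁ ½-pos))) partialSums-½ ⟩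
      conv (expCoeff (fromℕ p * ½)) (const (1# + 1#)) n ≡⟨ conv-const _ _ n ⟩
      (1# + 1#) * partialSums (expCoeff (fromℕ p * ½)) n ≤⟨ *-monoˡ-≤ (proj₁ 0<2) (partialSums-half p n) ⟩
      (1# + 1#) ^ suc p ∎

  -- Since exp (p / 2) ≤ 2^p ≤ t, the number p / 2 is in the set whose supremum is log t. The
  -- logarithm occurs only in the upper bound on the number of queries, so it has to be bounded from
  -- below.
  log-lower : ∀ p t → (1# + 1#) ^ p ≤ t → fromℕ p ≤ (1# + 1#) * log t
  log-lower p t 2^p≤t = begin
    fromℕ p                    ≡⟨ *-identityʳ _ ⟨
    fromℕ p * 1#               ≡⟨ cong (fromℕ p *_) ½+½ ⟨
    fromℕ p * (½ + ½)          ≡⟨ solve 2 (λ p h → p :* (h :+ h) := (c# 1 :+ c# 1) :* (p :* h)) refl (fromℕ p) ½ ⟩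
    (1# + 1#) * (fromℕ p * ½)  ≤⟨ *-monoˡ-≤ (proj₁ 0<2) (sup-upper _ (_ , member) (t , bounded) _ member) ⟩
    (1# + 1#) * log t          ∎
    where
      member : 0# ≤ fromℕ p * ½ × (∀ n → expSum n (fromℕ p * ½) ≤ t)
      member = half-nonneg p , λ
        { zero    → ≤-trans (^-nonneg p (proj₁ 0<2)) 2^p≤t
        ; (suc n) → ≤-trans (≤-reflexive (sum≡sumℕ (suc n) (expCoeff (fromℕ p * ½)))) (≤-trans (partialSums-half p n) 2^p≤t) }
      -- The partial sum 1 + x ≤ t already gives x ≤ t.
      bounded : UpperBound (λ x → 0# ≤ x × (∀ n → expSum n x ≤ t)) t
      bounded x (0≤x , below) = begin
        x                 ≤⟨ ≤-via 1# 0≤1 refl ⟩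
        x + 1#            ≡⟨ solve 1 (λ x → x :+ c# 1 := c# 1 :+ (x :+ c# 0)) refl x ⟩
        1# + (x + 0#)     ≡⟨ cong₂ (λ a b → a + (b + 0#)) (expCoeff-0 x) (expCoeff-1 x) ⟨
        expSum 2 x        ≤⟨ below 2 ⟩
        t                 ∎

-- Finite sums

module Sums (R : CompleteOrderedField) where
  open OrderedField R
  open Algebra.Properties.Semiring.Sum semiring public using (*-distribˡ-sum; *-distribʳ-sum)
  open Algebra.Properties.CommutativeMonoid.Sum +-commutativeMonoid public using (∑-distrib-+; ∑-comm)
  open Algebra.Properties.CommutativeMonoid.Sum +-commutativeMonoid public using (sum-cong-≗; sum-replicate-zero)

  sum-mono : ∀ {n} {f g : Vector ℝ n} → (∀ i → f i ≤ g i) → sum f ≤ sum g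
  sum-mono {zero}  le = ≤-refl
  sum-mono {suc n} le = +-mono-≤ (le zero) (sum-mono (le ∘ suc))

  sum-nonneg : ∀ {n} {f : Vector ℝ n} → (∀ i → 0# ≤ f i) → 0# ≤ sum f
  sum-nonneg {zero}  0≤f = ≤-refl
  sum-nonneg {suc n} 0≤f = +-nonneg (0≤f zero) (sum-nonneg (0≤f ∘ suc))

  sum-const : ∀ n x → sum {n} (const x) ≡ fromℕ n * x
  sum-const zero    x = sym (zeroˡ x)
  sum-const (suc n) x = trans (cong (x +_) (sum-const n x))
    (solve 2 (λ n x → x :+ n :* x := (c# 1 :+ n) :* x) refl (fromℕ n) x)

  term≤sum : ∀ {n} {f : Vector ℝ n} → (∀ i → 0# ≤ f i) → ∀ i → f i ≤ sum f
  term≤sum {suc n} {f} 0≤f zero    = ≤-via _ (sum-nonneg (0≤f ∘ suc)) refl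
  term≤sum {suc n} {f} 0≤f (suc i) = ≤-trans (term≤sum (0≤f ∘ suc) i) (≤-via _ (0≤f zero) (+-comm _ _))

-- Finite probability spaces, products and union bounds

module FiniteProbability (em : ExcludedMiddle 0ℓ) (R : CompleteOrderedField) where
  open OrderedField R
  open Completeness R
  open Sequences R
  open Sums R
  open Probability R
  open ≤-Reasoning

  -- Given by the expectation functional instead of point masses, so that a product space is an
  -- iterated expectation and conditioning on the first coordinate is computation.
  record FiniteSpace : Set₁ where
    field
      Ω      : Set
      𝔼      : (Ω → ℝ) → ℝ
      𝔼-mono : ∀ {f g} → (∀ ω → f ω ≤ g ω) → 𝔼 f ≤ 𝔼 g
      𝔼-+    : ∀ f g → 𝔼 (λ ω → f ω + g ω) ≡ 𝔼 f + 𝔼 g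
      𝔼-*    : ∀ c f → 𝔼 (λ ω → c * f ω) ≡ c * 𝔼 f
      𝔼-1    : 𝔼 (const 1#) ≡ 1#
      -- A form of compactness: it is what turns countable unions into finite ones.
      bounded : (f : Ω → ℕ) → ∃[ N ] (∀ ω → f ω ℕ.≤ N)

  -- Excluded middle decides every predicate, so all subsets of Ω can serve as events.
  indicator : Set → ℝ
  indicator P with em {P}
  ... | yes _ = 1#
  ... | no  _ = 0#

  indicator-true : ∀ {P} → P → indicator P ≡ 1#
  indicator-true {P} p with em {P}
  ... | yes _ = refl
  ... | no ¬p = ⊥-elim (¬p p)

  indicator-false : ∀ {P} → ¬ P → indicator P ≡ 0#
  indicator-false {P} ¬p with em {P}
  ... | yes p = ⊥-elim (¬p p)
  ... | no  _ = refl

  indicator-nonneg : ∀ P → 0# ≤ indicator P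
  indicator-nonneg P with em {P}
  ... | yes _ = 0≤1
  ... | no  _ = ≤-refl

  indicator-≤ : ∀ {P x} → 0# ≤ x → (P → 1# ≤ x) → indicator P ≤ x
  indicator-≤ {P} 0≤x 1≤x with em {P}
  ... | yes p = 1≤x p
  ... | no  _ = 0≤x

  indicator-∁ : ∀ P → indicator (¬ P) ≡ 1# - indicator P
  indicator-∁ P with em {P}
  ... | yes p = trans (indicator-false λ ¬p → ¬p p) (sym (-‿inverseʳ 1#))
  ... | no ¬p = trans (indicator-true ¬p) (solve 0 (c# 1 := c# 1 :- c# 0) refl)

  module Expectation (F : FiniteSpace) where
    open FiniteSpace F public

    𝔼-cong : ∀ {f g} → (∀ ω → f ω ≡ g ω) → 𝔼 f ≡ 𝔼 g
    𝔼-cong eq = ≤-antisym (𝔼-mono (≤-reflexive ∘ eq)) (𝔼-mono (≤-reflexive ∘ sym ∘ eq))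

    𝔼-const : ∀ c → 𝔼 (const c) ≡ c
    𝔼-const c = begin-equality
      𝔼 (const c)           ≡⟨ 𝔼-cong (λ _ → sym (*-identityʳ c)) ⟩
      𝔼 (λ _ → c * 1#)      ≡⟨ 𝔼-* c (const 1#) ⟩
      c * 𝔼 (const 1#)      ≡⟨ cong (c *_) 𝔼-1 ⟩
      c * 1#                ≡⟨ *-identityʳ c ⟩
      c                     ∎

    𝔼-nonneg : ∀ {f} → (∀ ω → 0# ≤ f ω) → 0# ≤ 𝔼 f
    𝔼-nonneg 0≤f = ≤-trans (≤-reflexive (sym (𝔼-const 0#))) (𝔼-mono 0≤f)

    𝔼-sumℕ : ∀ n (f : Ω → ℕ → ℝ) → 𝔼 (λ ω → sumℕ n (f ω)) ≡ sumℕ n (λ i → 𝔼 (λ ω → f ω i))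
    𝔼-sumℕ zero    f = 𝔼-const 0#
    𝔼-sumℕ (suc n) f = trans (𝔼-+ _ _) (cong (_+ 𝔼 (λ ω → f ω n)) (𝔼-sumℕ n f))

    𝔼-conv : ∀ a (g : Ω → ℕ → ℝ) n → 𝔼 (λ ω → conv a (g ω) n) ≡ conv a (λ i → 𝔼 (λ ω → g ω i)) n
    𝔼-conv a g zero    = 𝔼-* (a 0) _
    𝔼-conv a g (suc n) = trans (𝔼-+ _ _) (cong₂ _+_ (𝔼-* (a 0) _) (𝔼-conv (a ∘ suc) g n))

    ℙ : Pred Ω 0ℓ → ℝ
    ℙ E = 𝔼 (λ ω → indicator (E ω))

    ℙ-nonneg : ∀ E → 0# ≤ ℙ E
    ℙ-nonneg E = 𝔼-nonneg (λ ω → indicator-nonneg (E ω))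

    ℙ-mono : ∀ {E G} → (∀ ω → E ω → G ω) → ℙ E ≤ ℙ G
    ℙ-mono {E} {G} sub = 𝔼-mono λ ω → indicator-≤ (indicator-nonneg (G ω)) λ e → ≤-reflexive (sym (indicator-true (sub ω e)))

    ℙ-sure : ∀ {E} → (∀ ω → E ω) → ℙ E ≡ 1#
    ℙ-sure sure = trans (𝔼-cong (λ ω → indicator-true (sure ω))) 𝔼-1

    ℙ-impossible : ∀ {E} → (∀ ω → ¬ E ω) → ℙ E ≡ 0#
    ℙ-impossible never = trans (𝔼-cong (λ ω → indicator-false (never ω))) (𝔼-const 0#)

    ℙ-∁ : ∀ E → ℙ (∁ E) ≡ 1# - ℙ E
    ℙ-∁ E = begin-equality
      𝔼 (λ ω → indicator (¬ E ω))          ≡⟨ 𝔼-cong (λ ω → trans (indicator-∁ (E ω)) (solve 1 (λ x → c# 1 :- x := c# 1 :+ (:- c# 1) :* x) refl (indicator (E ω)))) ⟩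
      𝔼 (λ ω → 1# + - 1# * indicator (E ω)) ≡⟨ 𝔼-+ _ _ ⟩
      𝔼 (const 1#) + 𝔼 (λ ω → - 1# * indicator (E ω)) ≡⟨ cong₂ _+_ 𝔼-1 (𝔼-* (- 1#) _) ⟩
      1# + - 1# * ℙ E ≡⟨ solve 1 (λ x → c# 1 :+ (:- c# 1) :* x := c# 1 :- x) refl (ℙ E) ⟩
      1# - ℙ E ∎

    ℙ-∪ : ∀ E G → ℙ (λ ω → E ω ⊎ G ω) ≤ ℙ E + ℙ G
    ℙ-∪ E G = ≤-trans (𝔼-mono λ ω → indicator-≤ (+-nonneg (indicator-nonneg (E ω)) (indicator-nonneg (G ω)))
        λ { (inj₁ e) → ≤-via _ (indicator-nonneg (G ω)) (cong (_+ indicator (G ω)) (indicator-true e))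
          ; (inj₂ g) → ≤-via _ (indicator-nonneg (E ω)) (trans (+-comm _ _) (cong (_+ indicator (E ω)) (indicator-true g))) })
      (≤-reflexive (𝔼-+ _ _))

    markov : ∀ {E f} c → (∀ ω → 0# ≤ f ω) → (∀ ω → E ω → c ≤ f ω) → c * ℙ E ≤ 𝔼 f
    markov {E} {f} c 0≤f c≤f = ≤-trans (≤-reflexive (sym (𝔼-* c _))) (𝔼-mono bound)
      where
        bound : ∀ ω → c * indicator (E ω) ≤ f ω
        bound ω with em {E ω}
        ... | yes e = ≤-trans (≤-reflexive (*-identityʳ c)) (c≤f ω e)
        ... | no  _ = ≤-trans (≤-reflexive (zeroʳ c)) (0≤f ω)

    sumℕ-none : ∀ n {P : ℕ → Set} → (∀ i → i ℕ.< n → ¬ P i) → sumℕ n (indicator ∘ P) ≡ 0#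
    sumℕ-none zero    none = refl
    sumℕ-none (suc n) none = trans (cong₂ _+_ (sumℕ-none n (λ i i<n → none i (ℕₚ.m<n⇒m<1+n i<n)))
      (indicator-false (none n ℕₚ.≤-refl))) (+-identityʳ 0#)

    sumℕ-unique : ∀ n {P : ℕ → Set} i → i ℕ.< n → P i → (∀ j → P j → i ≡ j) → sumℕ n (indicator ∘ P) ≡ 1#
    sumℕ-unique (suc n) {P} i i<1+n pi uniq with i ℕₚ.≟ n
    ... | yes refl = trans (cong₂ _+_ (sumℕ-none n (λ j j<n pj → ℕₚ.<⇒≢ j<n (sym (uniq j pj)))) (indicator-true pi)) (+-identityˡ 1#)
    ... | no  i≢n  = trans (cong₂ _+_ (sumℕ-unique n {P} i (ℕₚ.≤∧≢⇒< (ℕₚ.≤-pred i<1+n) i≢n) pi uniq)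
                       (indicator-false (λ pn → i≢n (uniq n pn)))) (+-identityʳ 1#)

    -- The index of the set that contains ω is a function on Ω and thus bounded by some N. Beyond N
    -- the partial sums are equal to ℙ G, not merely close to it.
    ℙ-σ-additive : ∀ (E : ℕ → Pred Ω 0ℓ) G → (∀ i j ω → E i ω → E j ω → i ≡ j) → G ≐ ⋃ ℕ E →
                   (λ n → sum {n} (λ i → ℙ (E (toℕ i)))) ⟶ ℙ G
    ℙ-σ-additive E G disjoint (G⊆⋃ , ⋃⊆G) η 0<η = suc N , λ n N<n →
        let eq = exact n N<n in
        ≤-via η (proj₁ 0<η) (cong (_+ η) (sym eq)) , ≤-via η (proj₁ 0<η) (cong (_+ η) eq)
      where
        index : Ω → ℕ
        index ω with em {G ω}
        ... | yes g = proj₁ (G⊆⋃ g)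
        ... | no  _ = 0
        N = proj₁ (bounded index)
        pointwise : ∀ n → N ℕ.< n → ∀ ω → sumℕ n (λ i → indicator (E i ω)) ≡ indicator (G ω)
        pointwise n N<n ω with em {G ω} | proj₂ (bounded index) ω
        ... | yes g | i≤N = sumℕ-unique n {λ i → E i ω} (proj₁ (G⊆⋃ g)) (ℕₚ.≤-<-trans i≤N N<n) (proj₂ (G⊆⋃ g))
                              (λ j → disjoint _ j ω (proj₂ (G⊆⋃ g)))
        ... | no ¬g | _   = sumℕ-none n {λ i → E i ω} (λ i _ e → ¬g (⋃⊆G (i , e)))
        exact : ∀ n → N ℕ.< n → sum {n} (λ i → ℙ (E (toℕ i))) ≡ ℙ G
        exact n N<n = trans (sum≡sumℕ n (ℙ ∘ E)) (trans (sym (𝔼-sumℕ n (λ ω i → indicator (E i ω)))) (𝔼-cong (pointwise n N<n)))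

    probabilitySpace : ProbabilitySpace
    probabilitySpace = record
      { Ω = Ω
      ; IsEvent = λ _ → ⊤
      ; Pr = ℙ
      ; event-≐ = λ _ _ _ _ → tt
      ; event-U = tt
      ; event-∁ = λ _ _ → tt
      ; event-⋃ = λ _ _ → tt
      ; Pr-nonneg = λ E _ → ℙ-nonneg E
      ; Pr-U = ℙ-sure {U} (λ _ → tt)
      ; Pr-σ-additive = λ E G _ _ → ℙ-σ-additive E G
      }

  -- Stands for "A has at most N elements". In this form the property passes to products and vectors
  -- without any enumeration of them.
  UnionBound : Set → ℕ → Set₁
  UnionBound A N = ∀ F → let open Expectation F in ∀ (E : A → Pred Ω 0ℓ) β → 0# ≤ β →
                   (∀ a → ℙ (E a) ≤ β) → ℙ (λ ω → ∃[ a ] E a ω) ≤ fromℕ N * β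

  unionBound-Fin : ∀ n → UnionBound (Fin n) n
  unionBound-Fin zero F E β 0≤β each = ≤-trans (≤-reflexive (ℙ-impossible (λ { _ (() , _) }))) (≤-reflexive (sym (zeroˡ β)))
    where open Expectation F
  unionBound-Fin (suc n) F E β 0≤β each = begin
    ℙ (λ ω → ∃[ a ] E a ω)                          ≤⟨ ℙ-mono (λ { ω (zero , e) → inj₁ e ; ω (suc a , e) → inj₂ (a , e) }) ⟩
    ℙ (λ ω → E zero ω ⊎ ∃[ a ] E (suc a) ω)         ≤⟨ ℙ-∪ _ _ ⟩
    ℙ (E zero) + ℙ (λ ω → ∃[ a ] E (suc a) ω)       ≤⟨ +-mono-≤ (each zero) (unionBound-Fin n F (E ∘ suc) β 0≤β (each ∘ suc)) ⟩
    β + fromℕ n * β                                 ≡⟨ solve 2 (λ n x → x :+ n :* x := (c# 1 :+ n) :* x) refl (fromℕ n) β ⟩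
    fromℕ (suc n) * β                               ∎
    where open Expectation F

  unionBound-× : ∀ {A B a b} → UnionBound A a → UnionBound B b → UnionBound (A × B) (a ℕ.* b)
  unionBound-× {a = a} {b} ubA ubB F E β 0≤β each = begin
    ℙ (λ ω → ∃[ p ] E p ω)                ≤⟨ ℙ-mono (λ { ω ((x , y) , e) → x , y , e }) ⟩
    ℙ (λ ω → ∃[ x ] ∃[ y ] E (x , y) ω)   ≤⟨ ubA F _ (fromℕ b * β) (*-nonneg (fromℕ-nonneg b) 0≤β)
                                               (λ x → ubB F _ β 0≤β (λ y → each (x , y))) ⟩
    fromℕ a * (fromℕ b * β)               ≡⟨ *-assoc _ _ _ ⟨
    fromℕ a * fromℕ b * β                 ≡⟨ cong (_* β) (fromℕ-* a b) ⟨
    fromℕ (a ℕ.* b) * β                   ∎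
    where open Expectation F

  unionBound-Vec : ∀ {A a} → UnionBound A a → ∀ n → UnionBound (Vec A n) (a ℕ.^ n)
  unionBound-Vec ub zero F E β 0≤β each = begin
    ℙ (λ ω → ∃[ v ] E v ω)  ≤⟨ ℙ-mono (λ { ω ([] , e) → e }) ⟩
    ℙ (E [])                ≤⟨ each [] ⟩
    β                       ≡⟨ *-identityˡ β ⟨
    1# * β                  ≡⟨ cong (_* β) fromℕ-1 ⟨
    fromℕ 1 * β             ∎
    where open Expectation F
  unionBound-Vec {A} {a} ub (suc n) F E β 0≤β each = begin
    ℙ (λ ω → ∃[ v ] E v ω)                 ≤⟨ ℙ-mono (λ { ω (x ∷ v , e) → (x , v) , e }) ⟩
    ℙ (λ ω → ∃[ p ] E (proj₁ p ∷ proj₂ p) ω) ≤⟨ unionBound-× {a = a} {a ℕ.^ n} ub (unionBound-Vec {A} {a} ub n) F _ β 0≤β (λ p → each (proj₁ p ∷ proj₂ p)) ⟩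
    fromℕ (a ℕ.* a ℕ.^ n) * β              ∎
    where open Expectation F

  bound-Fin : ∀ n (f : Fin n → ℕ) → ∃[ N ] (∀ i → f i ℕ.≤ N)
  bound-Fin zero    f = 0 , λ ()
  bound-Fin (suc n) f with bound-Fin n (f ∘ suc)
  ... | N , f≤N = f zero ℕ.⊔ N , λ { zero → ℕₚ.m≤m⊔n _ N ; (suc i) → ℕₚ.≤-trans (f≤N i) (ℕₚ.m≤n⊔m _ N) }

  uniform : ∀ n → .{{NonZero n}} → FiniteSpace
  uniform n = record
    { Ω       = Fin n
    ; 𝔼       = λ f → w * sum f
    ; 𝔼-mono  = λ le → *-monoˡ-≤ (proj₁ (⁻¹-pos (fromℕ-pos n))) (sum-mono le)
    ; 𝔼-+     = λ f g → trans (cong (w *_) (∑-distrib-+ f g)) (distribˡ w _ _)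
    ; 𝔼-*     = λ c f → trans (cong (w *_) (sym (*-distribˡ-sum c f)))
                  (solve 3 (λ w c s → w :* (c :* s) := c :* (w :* s)) refl w c (sum f))
    ; 𝔼-1     = trans (cong (w *_) (trans (sum-const n 1#) (*-identityʳ _)))
                  (trans (*-comm w _) (*-inverseʳ _ (<⇒≢ (fromℕ-pos n))))
    ; bounded = bound-Fin n
    }
    where w = fromℕ n ⁻¹

  module _ (F : FiniteSpace) where
    open FiniteSpace F

    𝔼-Vec : ∀ n → (Vec Ω n → ℝ) → ℝ
    𝔼-Vec zero    f = f []
    𝔼-Vec (suc n) f = 𝔼 (λ a → 𝔼-Vec n (λ v → f (a ∷ v)))

    bound-Vec : ∀ n (f : Vec Ω n → ℕ) → ∃[ N ] (∀ v → f v ℕ.≤ N)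
    bound-Vec zero    f = f [] , λ { [] → ℕₚ.≤-refl }
    bound-Vec (suc n) f with bounded (λ a → proj₁ (bound-Vec n (λ v → f (a ∷ v))))
    ... | N , each = N , λ { (a ∷ v) → ℕₚ.≤-trans (proj₂ (bound-Vec n (λ v → f (a ∷ v))) v) (each a) }

    private
      module E = Expectation F

      mono : ∀ n {f g} → (∀ v → f v ≤ g v) → 𝔼-Vec n f ≤ 𝔼-Vec n g
      mono zero    le = le []
      mono (suc n) le = 𝔼-mono (λ a → mono n (λ v → le (a ∷ v)))

      additive : ∀ n f g → 𝔼-Vec n (λ v → f v + g v) ≡ 𝔼-Vec n f + 𝔼-Vec n g
      additive zero    f g = refl
      additive (suc n) f g = trans (E.𝔼-cong (λ a → additive n _ _)) (𝔼-+ _ _)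

      homogeneous : ∀ n c f → 𝔼-Vec n (λ v → c * f v) ≡ c * 𝔼-Vec n f
      homogeneous zero    c f = refl
      homogeneous (suc n) c f = trans (E.𝔼-cong (λ a → homogeneous n c _)) (𝔼-* c _)

      normalised : ∀ n → 𝔼-Vec n (const 1#) ≡ 1#
      normalised zero    = refl
      normalised (suc n) = trans (E.𝔼-cong (λ a → normalised n)) 𝔼-1

    power : ℕ → FiniteSpace
    power n = record
      { Ω       = Vec Ω n
      ; 𝔼       = 𝔼-Vec n
      ; 𝔼-mono  = mono n
      ; 𝔼-+     = additive n
      ; 𝔼-*     = homogeneous n
      ; 𝔼-1     = normalised n
      ; bounded = bound-Vec n
      }

    ∏ : ∀ {n} → (Ω → ℝ) → Vec Ω n → ℝ
    ∏ f []      = 1#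
    ∏ f (a ∷ v) = f a * ∏ f v

    -- Independence of the coordinates.
    𝔼-∏ : ∀ n f → 𝔼-Vec n (∏ f) ≡ 𝔼 f ^ n
    𝔼-∏ zero    f = refl
    𝔼-∏ (suc n) f = begin-equality
      𝔼 (λ a → 𝔼-Vec n (λ v → f a * ∏ f v))  ≡⟨ E.𝔼-cong (λ a → trans (homogeneous n (f a) (∏ f)) (trans (*-comm _ _) (cong (_* f a) (𝔼-∏ n f)))) ⟩
      𝔼 (λ a → 𝔼 f ^ n * f a)                ≡⟨ 𝔼-* _ f ⟩
      𝔼 f ^ n * 𝔼 f                          ≡⟨ *-comm _ _ ⟩
      𝔼 f * 𝔼 f ^ n                          ∎

n!≤m^n : ∀ {m} n → n ℕ.≤ m → n ! ℕ.≤ m ℕ.^ n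
n!≤m^n zero    _   = ℕₚ.≤-refl
n!≤m^n (suc n) n<m = ℕₚ.*-mono-≤ n<m (n!≤m^n n (ℕₚ.<⇒≤ n<m))

-- Random signs: moments and the lower tail of the energy

module Rademacher (em : ExcludedMiddle 0ℓ) (R : CompleteOrderedField) where
  open OrderedField R
  open Completeness R
  open Sequences R
  open Sums R
  open FiniteProbability em R
  open ≤-Reasoning

  coin : FiniteSpace
  coin = uniform 2

  sign : Fin 2 → ℝ
  sign zero    = 1#
  sign (suc _) = - 1#

  infix 8 _·±_
  _·±_ : ∀ {d} → Vec (Fin 2) d → Vector ℝ d → ℝ
  []      ·± v = 0#
  (a ∷ r) ·± v = sign a * v zero + r ·± (v ∘ suc)

  sumSq : ∀ {d} → Vector ℝ d → ℝ
  sumSq v = sum (λ i → v i * v i)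

  sumSq-nonneg : ∀ {d} (v : Vector ℝ d) → 0# ≤ sumSq v
  sumSq-nonneg v = sum-nonneg (λ i → square-nonneg (v i))

  private
    module C = Expectation coin
    module S d = Expectation (power coin d)

  𝔼± : ∀ d → (Vec (Fin 2) d → ℝ) → ℝ
  𝔼± d = 𝔼-Vec coin d

  𝔼-coin : ∀ f → C.𝔼 f ≡ ½ * (f zero + f (suc zero))
  𝔼-coin f = cong₂ _*_ (cong _⁻¹ (cong (1# +_) (+-identityʳ 1#))) (cong (f zero +_) (+-identityʳ _))

  𝔼-·±-suc : ∀ {d} (g : ℝ → ℝ) (v : Vector ℝ (suc d)) → 𝔼± (suc d) (λ r → g (r ·± v)) ≡
             ½ * (𝔼± d (λ r → g (v zero + r ·± (v ∘ suc))) + 𝔼± d (λ r → g (- v zero + r ·± (v ∘ suc))))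
  𝔼-·±-suc {d} g v = trans (𝔼-coin (λ a → 𝔼± d (λ r → g ((a ∷ r) ·± v)))) (cong₂ (λ x y → ½ * (x + y))
    (S.𝔼-cong d (λ r → cong (λ x → g (x + r ·± (v ∘ suc))) (*-identityˡ (v zero))))
    (S.𝔼-cong d (λ r → cong (λ x → g (x + r ·± (v ∘ suc))) (solve 1 (λ x → (:- c# 1) :* x := :- x) refl (v zero)))))

  private
    moment : ∀ {d} → Vector ℝ d → ℕ → ℝ
    moment {d} v n = 𝔼± d (λ r → expCoeff (r ·± v) n)

    -- The moment generating function of a sum of independent signs is a product of factors cosh (vᵢ
    -- u); this splits off the first.
    moment-suc : ∀ {d} (v : Vector ℝ (suc d)) n → moment v n ≡ conv (coshCoeff (v zero)) (moment (v ∘ suc)) n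
    moment-suc {d} v n = begin-equality
      moment v n ≡⟨ 𝔼-·±-suc (λ x → expCoeff x n) v ⟩
      ½ * (𝔼± d (λ r → expCoeff (x + r ·± (v ∘ suc)) n) + 𝔼± d (λ r → expCoeff (- x + r ·± (v ∘ suc)) n))
        ≡⟨ cong₂ (λ a b → ½ * (a + b)) (split x) (split (- x)) ⟩
      ½ * (conv (expCoeff x) M n + conv (expCoeff (- x)) M n) ≡⟨ cong (½ *_) (conv-addˡ _ _ M n) ⟨
      ½ * conv (λ i → expCoeff x i + expCoeff (- x) i) M n    ≡⟨ conv-scaleˡ ½ _ M n ⟨
      conv (coshCoeff x) M n ∎
      where
        x = v zero
        M = moment (v ∘ suc)
        split : ∀ y → 𝔼± d (λ r → expCoeff (y + r ·± (v ∘ suc)) n) ≡ conv (expCoeff y) M n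
        split y = trans (S.𝔼-cong d (λ r → sym (conv-expCoeff y _ n))) (S.𝔼-conv d (expCoeff y) (λ r → expCoeff (r ·± (v ∘ suc))) n)

    moment-nonneg : ∀ {d} (v : Vector ℝ d) n → 0# ≤ moment v n
    moment-nonneg {zero}  v n = expCoeff-nonneg n ≤-refl
    moment-nonneg {suc d} v n = ≤-trans (conv-nonneg n (coshCoeff-nonneg (v zero)) (moment-nonneg (v ∘ suc))) (≤-reflexive (sym (moment-suc v n)))

    expCoeff≤gaussCoeff-0 : ∀ n → expCoeff 0# n ≤ gaussCoeff 0# n
    expCoeff≤gaussCoeff-0 zero    = ≤-reflexive (expCoeff-0 0#)
    expCoeff≤gaussCoeff-0 (suc n) = ≤-trans (≤-reflexive (trans (cong (_* fromℕ (suc n !) ⁻¹) (zeroˡ _)) (zeroˡ _))) (gaussCoeff-nonneg (suc n) ≤-refl)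

  -- The sub-Gaussian bound E exp (u X) ≤ exp (s u² / 2), kept coefficient by coefficient so that
  -- single moments can be read off.
  𝔼-expCoeff-·± : ∀ {d} (v : Vector ℝ d) n → 𝔼± d (λ r → expCoeff (r ·± v) n) ≤ gaussCoeff (sumSq v) n
  𝔼-expCoeff-·± {zero}  v n = expCoeff≤gaussCoeff-0 n
  𝔼-expCoeff-·± {suc d} v n = begin
    moment v n                                              ≡⟨ moment-suc v n ⟩
    conv (coshCoeff (v zero)) (moment (v ∘ suc)) n          ≤⟨ conv-mono n (coshCoeff-nonneg (v zero)) (coshCoeff≤gaussCoeff (v zero))
                                                                 (moment-nonneg (v ∘ suc)) (𝔼-expCoeff-·± (v ∘ suc)) ⟩
    conv (gaussCoeff (v zero * v zero)) (gaussCoeff (sumSq (v ∘ suc))) n ≡⟨ conv-gaussCoeff _ _ n ⟩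
    gaussCoeff (sumSq v) n ∎

  𝔼-·±² : ∀ {d} (v : Vector ℝ d) → 𝔼± d (λ r → r ·± v * r ·± v) ≡ sumSq v
  𝔼-·±² {zero}  v = zeroˡ 0#
  𝔼-·±² {suc d} v = begin-equality
    𝔼± (suc d) (λ r → r ·± v * r ·± v) ≡⟨ 𝔼-·±-suc (λ x → x * x) v ⟩
    ½ * (𝔼± d (λ r → (x + X r) * (x + X r)) + 𝔼± d (λ r → (- x + X r) * (- x + X r)))
      ≡⟨ cong (½ *_) (trans (sym (S.𝔼-+ d _ _)) (S.𝔼-cong d (λ r →
           solve 2 (λ x y → (x :+ y) :* (x :+ y) :+ (:- x :+ y) :* (:- x :+ y) := (c# 1 :+ c# 1) :* (x :* x) :+ (c# 1 :+ c# 1) :* (y :* y)) refl x (X r)))) ⟩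
    ½ * 𝔼± d (λ r → (1# + 1#) * (x * x) + (1# + 1#) * (X r * X r)) ≡⟨ cong (½ *_) (trans (S.𝔼-+ d _ _) (cong₂ _+_ (S.𝔼-const d _) (S.𝔼-* d _ _))) ⟩
    ½ * ((1# + 1#) * (x * x) + (1# + 1#) * 𝔼± d (λ r → X r * X r)) ≡⟨ cong (λ y → ½ * ((1# + 1#) * (x * x) + (1# + 1#) * y)) (𝔼-·±² (v ∘ suc)) ⟩
    ½ * ((1# + 1#) * (x * x) + (1# + 1#) * sumSq (v ∘ suc)) ≡⟨ solve 3 (λ h a b → h :* ((c# 1 :+ c# 1) :* a :+ (c# 1 :+ c# 1) :* b) := (h :+ h) :* (a :+ b)) refl ½ (x * x) _ ⟩
    (½ + ½) * sumSq v ≡⟨ cong (_* sumSq v) ½+½ ⟩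
    1# * sumSq v      ≡⟨ *-identityˡ _ ⟩
    sumSq v           ∎
    where
      x = v zero
      X : Vec (Fin 2) d → ℝ
      X r = r ·± (v ∘ suc)

  private
    expCoeff-4 : ∀ x → fromℕ 24 * expCoeff x 4 ≡ x * x * (x * x)
    expCoeff-4 x = begin-equality
      fromℕ 24 * e 4 ≡⟨ solve 1 (λ y → c# 24 :* y := c# 2 :* (c# 3 :* (c# 4 :* y))) refl (e 4) ⟩
      fromℕ 2 * (fromℕ 3 * (fromℕ 4 * e 4)) ≡⟨ cong (λ y → fromℕ 2 * (fromℕ 3 * y)) (∂-expCoeff x 3) ⟩
      fromℕ 2 * (fromℕ 3 * (x * e 3)) ≡⟨ solve 2 (λ x y → c# 2 :* (c# 3 :* (x :* y)) := x :* (c# 2 :* (c# 3 :* y))) refl x (e 3) ⟩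
      x * (fromℕ 2 * (fromℕ 3 * e 3)) ≡⟨ cong (λ y → x * (fromℕ 2 * y)) (∂-expCoeff x 2) ⟩
      x * (fromℕ 2 * (x * e 2)) ≡⟨ solve 2 (λ x y → x :* (c# 2 :* (x :* y)) := x :* x :* (c# 2 :* y)) refl x (e 2) ⟩
      x * x * (fromℕ 2 * e 2) ≡⟨ cong (x * x *_) (∂-expCoeff x 1) ⟩
      x * x * (x * e 1) ≡⟨ cong (λ y → x * x * (x * y)) (expCoeff-1 x) ⟩
      x * x * (x * x) ∎
      where e = expCoeff x

    gaussCoeff-4 : ∀ s → fromℕ 24 * gaussCoeff s 4 ≡ fromℕ 3 * (s * s)
    gaussCoeff-4 s = begin-equality
      fromℕ 24 * g 4 ≡⟨ solve 1 (λ y → c# 24 :* y := c# 3 :* (c# 2 :* (c# 4 :* y))) refl (g 4) ⟩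
      fromℕ 3 * (fromℕ 2 * (fromℕ 4 * g 4)) ≡⟨ cong (λ y → fromℕ 3 * (fromℕ 2 * y)) (∂-gaussCoeff s 3) ⟩
      fromℕ 3 * (fromℕ 2 * (s * g 2)) ≡⟨ solve 2 (λ s y → c# 3 :* (c# 2 :* (s :* y)) := c# 3 :* (s :* (c# 2 :* y))) refl s (g 2) ⟩
      fromℕ 3 * (s * (fromℕ 2 * g 2)) ≡⟨ cong (λ y → fromℕ 3 * (s * y)) (trans (∂-gaussCoeff s 1) (*-identityʳ s)) ⟩
      fromℕ 3 * (s * s) ∎
      where g = gaussCoeff s

  -- The coefficient of u⁴ in exp (s u² / 2) is s² / 8, and 4! / 8 = 3.
  𝔼-·±⁴ : ∀ {d} (v : Vector ℝ d) → 𝔼± d (λ r → r ·± v * r ·± v * (r ·± v * r ·± v)) ≤ fromℕ 3 * (sumSq v * sumSq v)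
  𝔼-·±⁴ {d} v = begin
    𝔼± d (λ r → r ·± v * r ·± v * (r ·± v * r ·± v)) ≡⟨ S.𝔼-cong d (λ r → expCoeff-4 (r ·± v)) ⟨
    𝔼± d (λ r → fromℕ 24 * expCoeff (r ·± v) 4)      ≡⟨ S.𝔼-* d (fromℕ 24) _ ⟩
    fromℕ 24 * 𝔼± d (λ r → expCoeff (r ·± v) 4)      ≤⟨ *-monoˡ-≤ (fromℕ-nonneg 24) (𝔼-expCoeff-·± v 4) ⟩
    fromℕ 24 * gaussCoeff (sumSq v) 4                ≡⟨ gaussCoeff-4 (sumSq v) ⟩
    fromℕ 3 * (sumSq v * sumSq v)                    ∎

  energy : ∀ {d n} → Vec (Vec (Fin 2) d) n → Vector ℝ d → ℝ
  energy []      v = 0#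
  energy (r ∷ Φ) v = r ·± v * r ·± v + energy Φ v

  energy-nonneg : ∀ {d n} (Φ : Vec (Vec (Fin 2) d) n) v → 0# ≤ energy Φ v
  energy-nonneg []      v = ≤-refl
  energy-nonneg (r ∷ Φ) v = +-nonneg (square-nonneg _) (energy-nonneg Φ v)

  signMatrix : ℕ → ℕ → FiniteSpace
  signMatrix n d = power (power coin d) n

  module LowerTail {d} (v : Vector ℝ d) (0<s : 0# < sumSq v) where
    private
      s = sumSq v

    -- A row costs a factor ½ when its squared product with v exceeds s / 4, so the product over all
    -- rows is 2^(-N) for the number N of such rows. Bounding its expectation is a Chernoff bound
    -- for N.
    weight : Vec (Fin 2) d → ℝ
    weight r with fromℕ 4 * (r ·± v * r ·± v) ≤? s
    ... | yes _ = 1#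
    ... | no  _ = ½

    weight-nonneg : ∀ r → 0# ≤ weight r
    weight-nonneg r with fromℕ 4 * (r ·± v * r ·± v) ≤? s
    ... | yes _ = 0≤1
    ... | no  _ = proj₁ ½-pos

    -- The parabola 15 s² + 2 (x² − 3 s)² dominates 30 s² times the weight, and
    -- its expectation only involves the second and fourth moments.
    weight≤ : ∀ r → let t = r ·± v * r ·± v in
              fromℕ 30 * (s * s) * weight r ≤ fromℕ 15 * (s * s) + fromℕ 2 * ((t - fromℕ 3 * s) * (t - fromℕ 3 * s))
    weight≤ r with fromℕ 4 * (r ·± v * r ·± v) ≤? s
    -- The difference is 3 s² - 12 s t + 2 t²; rewritten with s = u + 4 t, where u ≥ 0, it has only
    -- nonnegative terms.
    ... | yes 4t≤s = ≤-via (fromℕ 2 * (t * t) + fromℕ 12 * (t * u) + fromℕ 3 * (u * u))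
          (+-nonneg (+-nonneg (*-nonneg (fromℕ-nonneg 2) (square-nonneg t)) (*-nonneg (fromℕ-nonneg 12) (*-nonneg (square-nonneg (r ·± v)) (0≤- 4t≤s))))
            (*-nonneg (fromℕ-nonneg 3) (square-nonneg u)))
          (solve 2 (λ s t → c# 15 :* (s :* s) :+ c# 2 :* ((t :- c# 3 :* s) :* (t :- c# 3 :* s)) :=
             c# 30 :* (s :* s) :* c# 1 :+ (c# 2 :* (t :* t) :+ c# 12 :* (t :* (s :- c# 4 :* t)) :+ c# 3 :* ((s :- c# 4 :* t) :* (s :- c# 4 :* t)))) refl s t)
      where
        t = r ·± v * r ·± v
        u = s - fromℕ 4 * t
    ... | no _ = ≤-via (fromℕ 2 * (y * y)) (*-nonneg (fromℕ-nonneg 2) (square-nonneg y)) (cong (_+ fromℕ 2 * (y * y)) (begin-equality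
          fromℕ 15 * (s * s)            ≡⟨ *-identityʳ _ ⟨
          fromℕ 15 * (s * s) * 1#       ≡⟨ cong (fromℕ 15 * (s * s) *_) ½+½ ⟨
          fromℕ 15 * (s * s) * (½ + ½)  ≡⟨ solve 2 (λ s h → c# 15 :* (s :* s) :* (h :+ h) := c# 30 :* (s :* s) :* h) refl s ½ ⟩
          fromℕ 30 * (s * s) * ½ ∎))
      where
        y = r ·± v * r ·± v - fromℕ 3 * s

    -- The expanded parabola has expectation at most (33 - 12 + 2 · 3) s² = 27 s², against the
    -- factor 30 s² of the weight.
    𝔼-weight : fromℕ 10 * 𝔼± d weight ≤ fromℕ 9
    𝔼-weight = *-cancelˡ-≤ (*-pos (*-pos 0<s 0<s) (fromℕ-pos 3)) (begin
      s * s * fromℕ 3 * (fromℕ 10 * 𝔼± d weight) ≡⟨ solve 2 (λ s w → s :* s :* c# 3 :* (c# 10 :* w) := c# 30 :* (s :* s) :* w) refl s (𝔼± d weight) ⟩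
      fromℕ 30 * (s * s) * 𝔼± d weight           ≡⟨ S.𝔼-* d _ weight ⟨
      𝔼± d (λ r → fromℕ 30 * (s * s) * weight r) ≤⟨ S.𝔼-mono d weight≤ ⟩
      𝔼± d (λ r → fromℕ 15 * (s * s) + fromℕ 2 * ((t r - fromℕ 3 * s) * (t r - fromℕ 3 * s)))
        ≡⟨ S.𝔼-cong d (λ r → solve 2 (λ s t → c# 15 :* (s :* s) :+ c# 2 :* ((t :- c# 3 :* s) :* (t :- c# 3 :* s)) :=
             c# 33 :* (s :* s) :+ ((:- c# 12 :* s) :* t :+ c# 2 :* (t :* t))) refl s (t r)) ⟩
      𝔼± d (λ r → fromℕ 33 * (s * s) + (- fromℕ 12 * s * t r + fromℕ 2 * (t r * t r)))
        ≡⟨ trans (S.𝔼-+ d _ _) (cong₂ _+_ (S.𝔼-const d _) (trans (S.𝔼-+ d _ _) (cong₂ _+_ (S.𝔼-* d _ _) (S.𝔼-* d _ _)))) ⟩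
      fromℕ 33 * (s * s) + (- fromℕ 12 * s * 𝔼± d t + fromℕ 2 * 𝔼± d (λ r → t r * t r))
        ≤⟨ +-monoʳ-≤ _ (+-mono-≤ (≤-reflexive (cong (- fromℕ 12 * s *_) (𝔼-·±² v))) (*-monoˡ-≤ (fromℕ-nonneg 2) (𝔼-·±⁴ v))) ⟩
      fromℕ 33 * (s * s) + (- fromℕ 12 * s * s + fromℕ 2 * (fromℕ 3 * (s * s)))
        ≡⟨ solve 1 (λ s → c# 33 :* (s :* s) :+ ((:- c# 12 :* s) :* s :+ c# 2 :* (c# 3 :* (s :* s))) := s :* s :* c# 3 :* c# 9) refl s ⟩
      s * s * fromℕ 3 * fromℕ 9 ∎)
      where
        t : Vec (Fin 2) d → ℝ
        t r = r ·± v * r ·± v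

    -- The witness N counts the rows of weight ½; each of them contributes more than s / 4 to the
    -- energy.
    ∏-weight : ∀ {n} (Φ : Vec (Vec (Fin 2) d) n) →
               ∃[ N ] ((1# + 1#) ^ N * ∏ (power coin d) weight Φ ≡ 1# × fromℕ N * s ≤ fromℕ 4 * energy Φ v)
    ∏-weight [] = 0 , *-identityˡ 1# , ≤-reflexive (trans (zeroˡ s) (sym (zeroʳ _)))
    ∏-weight (r ∷ Φ) with fromℕ 4 * (r ·± v * r ·± v) ≤? s | ∏-weight Φ
    ... | yes _ | N , eq , le = N , trans (cong ((1# + 1#) ^ N *_) (*-identityˡ _)) eq ,
          ≤-trans le (*-monoˡ-≤ (fromℕ-nonneg 4) (≤-via _ (square-nonneg _) (+-comm _ _)))
    ... | no 4t≰s | N , eq , le = suc N , (begin-equality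
          (1# + 1#) * P * (½ * W)  ≡⟨ solve 3 (λ p h w → (c# 1 :+ c# 1) :* p :* (h :* w) := (h :+ h) :* (p :* w)) refl P ½ W ⟩
          (½ + ½) * (P * W)        ≡⟨ cong₂ _*_ ½+½ eq ⟩
          1# * 1#                  ≡⟨ *-identityˡ 1# ⟩
          1#                       ∎) , (begin
          (1# + fromℕ N) * s       ≡⟨ solve 2 (λ n s → (c# 1 :+ n) :* s := s :+ n :* s) refl (fromℕ N) s ⟩
          s + fromℕ N * s          ≤⟨ +-mono-≤ (proj₁ (≰⇒< 4t≰s)) le ⟩
          fromℕ 4 * (r ·± v * r ·± v) + fromℕ 4 * energy Φ v ≡⟨ distribˡ _ _ _ ⟨
          fromℕ 4 * energy (r ∷ Φ) v ∎)
      where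
        P = (1# + 1#) ^ N
        W = ∏ (power coin d) weight Φ

    fromℕ-*^-mono : ∀ a b c w → a ℕ.* b ℕ.^ w ℕ.≤ c ℕ.^ w → fromℕ a * fromℕ b ^ w ≤ fromℕ c ^ w
    fromℕ-*^-mono a b c w le = subst₂ _≤_ (trans (fromℕ-* a (b ℕ.^ w)) (cong (fromℕ a *_) (fromℕ-^ b w))) (fromℕ-^ c w) (fromℕ-mono le)

    module _ (w : ℕ) (large : 32 ℕ.* 9 ℕ.^ w ℕ.≤ 10 ℕ.^ w) where
      𝔼-weight^ : fromℕ 32 * 𝔼± d weight ^ w ≤ 1#
      𝔼-weight^ = *-cancelˡ-≤ (subst (0# <_) (fromℕ-^ 10 w) (fromℕ-pos (10 ℕ.^ w) {{ℕₚ.m^n≢0 10 w}})) (begin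
        fromℕ 10 ^ w * (fromℕ 32 * 𝔼± d weight ^ w) ≡⟨ solve 3 (λ a b c → a :* (b :* c) := b :* (a :* c)) refl (fromℕ 10 ^ w) (fromℕ 32) _ ⟩
        fromℕ 32 * (fromℕ 10 ^ w * 𝔼± d weight ^ w) ≡⟨ cong (fromℕ 32 *_) (^-distrib-* (fromℕ 10) (𝔼± d weight) w) ⟨
        fromℕ 32 * (fromℕ 10 * 𝔼± d weight) ^ w ≤⟨ *-monoˡ-≤ (fromℕ-nonneg 32) (^-mono-≤ w (*-nonneg (fromℕ-nonneg 10) (S.𝔼-nonneg d weight-nonneg)) 𝔼-weight) ⟩
        fromℕ 32 * fromℕ 9 ^ w ≤⟨ fromℕ-*^-mono 32 9 10 w large ⟩
        fromℕ 10 ^ w           ≡⟨ *-identityʳ _ ⟨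
        fromℕ 10 ^ w * 1# ∎)

      -- Small energy leaves at most n rows of weight ½, so the product of the weights is at least
      -- 2^(-n). Its expectation over n blocks of w rows is at most 32^(-n), and Markov's inequality
      -- gives the quotient 16^(-n).
      lower-tail : ∀ n → let open Expectation (signMatrix (w ℕ.* n) d) in
                   fromℕ 16 ^ n * ℙ (λ Φ → fromℕ 4 * energy Φ v ≤ fromℕ n * s) ≤ 1#
      lower-tail n = begin
        fromℕ 16 ^ n * ℙ small                        ≤⟨ *-monoˡ-≤ (^-nonneg n (fromℕ-nonneg 16)) (≤-trans (≤-reflexive (sym (*-identityˡ _))) (markov {small} 1# nonneg bound)) ⟩
        fromℕ 16 ^ n * 𝔼 (λ Φ → (1# + 1#) ^ n * ∏ (power coin d) weight Φ) ≡⟨ cong (fromℕ 16 ^ n *_) (trans (𝔼-* _ _) (cong ((1# + 1#) ^ n *_) (trans (𝔼-∏ (power coin d) (w ℕ.* n) weight) (sym (^-assocʳ (𝔼± d weight) w n))))) ⟩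
        fromℕ 16 ^ n * ((1# + 1#) ^ n * (𝔼± d weight ^ w) ^ n) ≡⟨ trans (^-distrib-* (fromℕ 16) ((1# + 1#) * 𝔼± d weight ^ w) n) (cong (fromℕ 16 ^ n *_) (^-distrib-* (1# + 1#) (𝔼± d weight ^ w) n)) ⟨
        (fromℕ 16 * ((1# + 1#) * 𝔼± d weight ^ w)) ^ n ≡⟨ cong (_^ n) (solve 1 (λ x → c# 16 :* ((c# 1 :+ c# 1) :* x) := c# 32 :* x) refl (𝔼± d weight ^ w)) ⟩
        (fromℕ 32 * 𝔼± d weight ^ w) ^ n ≤⟨ ^-mono-≤ n (*-nonneg (fromℕ-nonneg 32) (^-nonneg w (S.𝔼-nonneg d weight-nonneg))) 𝔼-weight^ ⟩
        1# ^ n ≡⟨ one^ n ⟩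
        1# ∎
        where
          open Expectation (signMatrix (w ℕ.* n) d)
          small : Pred Ω 0ℓ
          small Φ = fromℕ 4 * energy Φ v ≤ fromℕ n * s
          one^ : ∀ n → 1# ^ n ≡ 1#
          one^ zero    = refl
          one^ (suc n) = trans (*-identityˡ _) (one^ n)
          ∏-nonneg : ∀ {n} (Φ : Vec (Vec (Fin 2) d) n) → 0# ≤ ∏ (power coin d) weight Φ
          ∏-nonneg []      = 0≤1
          ∏-nonneg (r ∷ Φ) = *-nonneg (weight-nonneg r) (∏-nonneg Φ)
          nonneg : ∀ Φ → 0# ≤ (1# + 1#) ^ n * ∏ (power coin d) weight Φ
          nonneg Φ = *-nonneg (^-nonneg n (proj₁ 0<2)) (∏-nonneg Φ)
          bound : ∀ Φ → small Φ → 1# ≤ (1# + 1#) ^ n * ∏ (power coin d) weight Φ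
          bound Φ isSmall with ∏-weight Φ
          ... | N , eq , le = ≤-trans (≤-reflexive (sym eq)) (*-monoʳ-≤ (∏-nonneg Φ) (^-monoʳ-≤ {a = N} {n} 1≤2
                (fromℕ-cancel-≤ {N} {n} (*-cancelˡ-≤ 0<s (subst₂ _≤_ (*-comm _ s) (*-comm _ s) (≤-trans le isSmall))))))

-- Upper tail of the energy of a unit vector

module UpperTail (em : ExcludedMiddle 0ℓ) (R : CompleteOrderedField) where
  open OrderedField R
  open Completeness R
  open Sequences R
  open FiniteProbability em R
  open Rademacher em R
  open ≤-Reasoning

  private
    module S d = Expectation (power coin d)

    -- Adds two successors at a time, in step with the recurrences of the series.
    double : ℕ → ℕ
    double zero    = zero
    double (suc p) = suc (suc (double p))

    fromℕ-double : ∀ p → fromℕ (double p) ≡ (1# + 1#) * fromℕ p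
    fromℕ-double zero    = sym (zeroʳ _)
    fromℕ-double (suc p) = trans (cong (λ x → 1# + (1# + x)) (fromℕ-double p))
      (solve 1 (λ p → c# 1 :+ (c# 1 :+ (c# 1 :+ c# 1) :* p) := (c# 1 :+ c# 1) :* (c# 1 :+ p)) refl (fromℕ p))

    -- (2p)! / p!
    ratio : ℕ → ℝ
    ratio zero    = 1#
    ratio (suc p) = (1# + 1#) * (fromℕ (suc (double p)) * ratio p)

    ratio-nonneg : ∀ p → 0# ≤ ratio p
    ratio-nonneg zero    = 0≤1
    ratio-nonneg (suc p) = *-nonneg (proj₁ 0<2) (*-nonneg (fromℕ-nonneg (suc (double p))) (ratio-nonneg p))

    -- x^(2 p) / p! is (2 p)! / p! times the term of degree 2 p of exp x, so moments of a square
    -- become even moments, which the sub-Gaussian bound controls.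
    expCoeff-square : ∀ x p → expCoeff (x * x) p ≡ ratio p * expCoeff x (double p)
    expCoeff-square x zero    = trans (expCoeff-0 (x * x)) (sym (trans (*-identityˡ _) (expCoeff-0 x)))
    expCoeff-square x (suc p) = ∂-cancel p (begin-equality
      fromℕ (suc p) * expCoeff (x * x) (suc p) ≡⟨ ∂-expCoeff (x * x) p ⟩
      x * x * expCoeff (x * x) p               ≡⟨ cong (x * x *_) (expCoeff-square x p) ⟩
      x * x * (r * e (double p))               ≡⟨ solve 3 (λ x r e → x :* x :* (r :* e) := r :* (x :* (x :* e))) refl x r _ ⟩
      r * (x * (x * e (double p)))             ≡⟨ cong (λ y → r * (x * y)) (∂-expCoeff x (double p)) ⟨
      r * (x * (fromℕ a * e a))                ≡⟨ solve 4 (λ x r a e → r :* (x :* (a :* e)) := r :* (a :* (x :* e))) refl x r (fromℕ a) _ ⟩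
      r * (fromℕ a * (x * e a))                ≡⟨ cong (λ y → r * (fromℕ a * y)) (∂-expCoeff x a) ⟨
      r * (fromℕ a * (fromℕ (suc a) * e (suc a))) ≡⟨ cong (λ y → r * (fromℕ a * (y * e (suc a)))) (fromℕ-double (suc p)) ⟩
      r * (fromℕ a * ((1# + 1#) * fromℕ (suc p) * e (suc a))) ≡⟨ solve 5 (λ r a t p e → r :* (a :* (t :* p :* e)) := p :* (t :* (a :* r) :* e)) refl r (fromℕ a) (1# + 1#) (fromℕ (suc p)) _ ⟩
      fromℕ (suc p) * (ratio (suc p) * e (suc a)) ∎)
      where
        e = expCoeff x
        r = ratio p
        a = suc (double p)

    -- The left side is the central binomial coefficient of 2 p, which is at most 4^p, divided by
    -- 2^p.
    ratio-gaussCoeff : ∀ p → ratio p * gaussCoeff 1# (double p) ≤ (1# + 1#) ^ p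
    ratio-gaussCoeff zero    = ≤-reflexive (*-identityˡ 1#)
    ratio-gaussCoeff (suc p) = *-cancelˡ-≤ (fromℕ-pos (suc a)) (begin
      fromℕ (suc a) * ((1# + 1#) * (fromℕ a * r) * g (suc a)) ≡⟨ solve 4 (λ b a r e → b :* ((c# 1 :+ c# 1) :* (a :* r) :* e) := (c# 1 :+ c# 1) :* (a :* r) :* (b :* e)) refl (fromℕ (suc a)) (fromℕ a) r (g (suc a)) ⟩
      (1# + 1#) * (fromℕ a * r) * (fromℕ (suc a) * g (suc a)) ≡⟨ cong ((1# + 1#) * (fromℕ a * r) *_) (∂-gaussCoeff 1# a) ⟩
      (1# + 1#) * (fromℕ a * r) * (1# * g (double p)) ≡⟨ solve 3 (λ a r e → (c# 1 :+ c# 1) :* (a :* r) :* (c# 1 :* e) := a :* ((c# 1 :+ c# 1) :* (r :* e))) refl (fromℕ a) r (g (double p)) ⟩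
      fromℕ a * ((1# + 1#) * (r * g (double p))) ≤⟨ *-mono-≤ (fromℕ-nonneg a) (^-nonneg (suc p) (proj₁ 0<2)) (fromℕ-mono (ℕₚ.n≤1+n a)) (*-monoˡ-≤ (proj₁ 0<2) (ratio-gaussCoeff p)) ⟩
      fromℕ (suc a) * (1# + 1#) ^ suc p ∎)
      where
        g = gaussCoeff 1#
        r = ratio p
        a = suc (double p)

    -- Consecutive terms of the sum have ratio ½, so the sum is at most twice its largest term.
    conv-geometric : ∀ {c} n → 0# ≤ c → conv ((1# + 1#) ^_) (λ i → c * fromℕ 4 ^ i) n ≤ (1# + 1#) * c * fromℕ 4 ^ n
    conv-geometric {c} zero 0≤c = ≤-via c 0≤c (solve 1 (λ c → (c# 1 :+ c# 1) :* c :* c# 1 := c# 1 :* (c :* c# 1) :+ c) refl c)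
    conv-geometric {c} (suc n) 0≤c = begin
      1# * (c * (fromℕ 4 * f)) + conv (λ i → (1# + 1#) * (1# + 1#) ^ i) (λ i → c * fromℕ 4 ^ i) n
        ≡⟨ cong (1# * (c * (fromℕ 4 * f)) +_) (conv-scaleˡ (1# + 1#) _ _ n) ⟩
      1# * (c * (fromℕ 4 * f)) + (1# + 1#) * conv ((1# + 1#) ^_) (λ i → c * fromℕ 4 ^ i) n
        ≤⟨ +-monoʳ-≤ _ (*-monoˡ-≤ (proj₁ 0<2) (conv-geometric n 0≤c)) ⟩
      1# * (c * (fromℕ 4 * f)) + (1# + 1#) * ((1# + 1#) * c * f)
        ≡⟨ solve 2 (λ c f → c# 1 :* (c :* (c# 4 :* f)) :+ (c# 1 :+ c# 1) :* ((c# 1 :+ c# 1) :* c :* f) := (c# 1 :+ c# 1) :* c :* (c# 4 :* f)) refl c f ⟩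
      (1# + 1#) * c * (fromℕ 4 * f) ∎
      where f = fromℕ 4 ^ n

  𝔼-convˡ : ∀ F → let open FiniteSpace F in
            ∀ (g : Ω → ℕ → ℝ) b n → 𝔼 (λ ω → conv (g ω) b n) ≡ conv (λ i → 𝔼 (λ ω → g ω i)) b n
  𝔼-convˡ F g b zero    = trans (E.𝔼-cong (λ ω → *-comm (g ω 0) (b 0))) (trans (E.𝔼-* (b 0) _) (*-comm _ _))
    where module E = Expectation F
  𝔼-convˡ F g b (suc n) = trans (E.𝔼-+ _ _) (cong₂ _+_
      (trans (E.𝔼-cong (λ ω → *-comm (g ω 0) (b (suc n)))) (trans (E.𝔼-* (b (suc n)) _) (*-comm _ _)))
      (𝔼-convˡ F (λ ω → g ω ∘ suc) b n))
    where module E = Expectation F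

  module _ {d} (a : Vector ℝ d) (s≡1 : sumSq a ≡ 1#) where
    𝔼-expCoeff-square : ∀ p → 𝔼± d (λ r → expCoeff (r ·± a * r ·± a) p) ≤ (1# + 1#) ^ p
    𝔼-expCoeff-square p = begin
      𝔼± d (λ r → expCoeff (r ·± a * r ·± a) p)            ≡⟨ S.𝔼-cong d (λ r → expCoeff-square (r ·± a) p) ⟩
      𝔼± d (λ r → ratio p * expCoeff (r ·± a) (double p))  ≡⟨ S.𝔼-* d (ratio p) _ ⟩
      ratio p * 𝔼± d (λ r → expCoeff (r ·± a) (double p))  ≤⟨ *-monoˡ-≤ (ratio-nonneg p) (𝔼-expCoeff-·± a (double p)) ⟩
      ratio p * gaussCoeff (sumSq a) (double p)            ≡⟨ cong (λ s → ratio p * gaussCoeff s (double p)) s≡1 ⟩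
      ratio p * gaussCoeff 1# (double p)                   ≤⟨ ratio-gaussCoeff p ⟩
      (1# + 1#) ^ p                                        ∎

    𝔼-energy : ℕ → ℕ → ℝ
    𝔼-energy n p = 𝔼-Vec (power coin d) n (λ Φ → expCoeff (energy Φ a) p)

    𝔼-energy-nonneg : ∀ n p → 0# ≤ 𝔼-energy n p
    𝔼-energy-nonneg n p = 𝔼-nonneg (λ Φ → expCoeff-nonneg p (energy-nonneg Φ a))
      where open Expectation (signMatrix n d)

    𝔼-energy-suc : ∀ n p → 𝔼-energy (suc n) p ≡ conv (λ i → 𝔼± d (λ r → expCoeff (r ·± a * r ·± a) i)) (𝔼-energy n) p
    𝔼-energy-suc n p = begin-equality
      𝔼± d (λ r → 𝔼 (λ Φ → expCoeff (r ·± a * r ·± a + energy Φ a) p))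
        ≡⟨ S.𝔼-cong d (λ r → trans (𝔼-cong (λ Φ → sym (conv-expCoeff (r ·± a * r ·± a) (energy Φ a) p)))
             (𝔼-conv (expCoeff (r ·± a * r ·± a)) (λ Φ → expCoeff (energy Φ a)) p)) ⟩
      𝔼± d (λ r → conv (expCoeff (r ·± a * r ·± a)) (𝔼-energy n) p)
        ≡⟨ 𝔼-convˡ (power coin d) (λ r → expCoeff (r ·± a * r ·± a)) (𝔼-energy n) p ⟩
      conv (λ i → 𝔼± d (λ r → expCoeff (r ·± a * r ·± a) i)) (𝔼-energy n) p ∎
      where open Expectation (signMatrix n d)

    -- Each row contributes a series dominated by 1 / (1 - 2 u). Relaxing the rate from 2 to 4
    -- absorbs every further row at the price of a factor 2.
    𝔼-energy-≤ : ∀ n p → 𝔼-energy n p ≤ (1# + 1#) ^ n * fromℕ 4 ^ p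
    𝔼-energy-≤ zero zero    = ≤-reflexive (trans (expCoeff-0 0#) (sym (*-identityˡ 1#)))
    𝔼-energy-≤ zero (suc p) = ≤-trans (≤-reflexive (trans (cong (_* fromℕ (suc p !) ⁻¹) (zeroˡ _)) (zeroˡ _)))
      (*-nonneg 0≤1 (^-nonneg (suc p) (fromℕ-nonneg 4)))
    𝔼-energy-≤ (suc n) p = begin
      𝔼-energy (suc n) p ≡⟨ 𝔼-energy-suc n p ⟩
      conv (λ i → 𝔼± d (λ r → expCoeff (r ·± a * r ·± a) i)) (𝔼-energy n) p
        ≤⟨ conv-mono p (λ i → S.𝔼-nonneg d (λ r → expCoeff-nonneg i (square-nonneg _))) 𝔼-expCoeff-square
             (𝔼-energy-nonneg n) (𝔼-energy-≤ n) ⟩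
      conv ((1# + 1#) ^_) (λ i → (1# + 1#) ^ n * fromℕ 4 ^ i) p ≤⟨ conv-geometric p (^-nonneg n (proj₁ 0<2)) ⟩
      (1# + 1#) ^ suc n * fromℕ 4 ^ p ∎

    -- Markov's inequality for the n-th moment: (16 n)^n / n! times the probability is at most 2^n
    -- 4^n = 8^n. Since n! ≤ n^n, the probability is at most (8 n)^n / (16 n)^n.
    upper-tail : ∀ n → .{{NonZero n}} → let open Expectation (signMatrix n d) in
                 (1# + 1#) ^ n * ℙ (λ Φ → ¬ (energy Φ a ≤ fromℕ 16 * fromℕ n)) ≤ 1#
    upper-tail n = *-cancelˡ-≤ 0<8n^n (begin
      (fromℕ 8 * N) ^ n * ((1# + 1#) ^ n * P) ≡⟨ *-assoc _ _ _ ⟨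
      (fromℕ 8 * N) ^ n * (1# + 1#) ^ n * P   ≡⟨ cong (_* P) (^-distrib-* (fromℕ 8 * N) (1# + 1#) n) ⟨
      (fromℕ 8 * N * (1# + 1#)) ^ n * P       ≡⟨ cong (λ x → x ^ n * P) (solve 1 (λ N → c# 8 :* N :* (c# 1 :+ c# 1) := c# 16 :* N) refl N) ⟩
      (fromℕ 16 * N) ^ n * P                  ≡⟨ cong (_* P) (trans (sym (*-identityʳ _)) (cong ((fromℕ 16 * N) ^ n *_) (sym (*-inverseʳ F (<⇒≢ 0<F))))) ⟩
      (fromℕ 16 * N) ^ n * (F * F ⁻¹) * P     ≡⟨ solve 4 (λ a F i P → a :* (F :* i) :* P := F :* (a :* i :* P)) refl ((fromℕ 16 * N) ^ n) F (F ⁻¹) P ⟩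
      F * (expCoeff (fromℕ 16 * N) n * P)     ≤⟨ *-monoˡ-≤ (proj₁ 0<F) (markov {large} _ (λ Φ → expCoeff-nonneg n (energy-nonneg Φ a)) (λ Φ big →
                                                   *-monoʳ-≤ (proj₁ (⁻¹-pos 0<F)) (^-mono-≤ n (*-nonneg (fromℕ-nonneg 16) (fromℕ-nonneg n)) (proj₁ (≰⇒< big))))) ⟩
      F * 𝔼-energy n n                        ≤⟨ *-mono-≤ (proj₁ 0<F) (*-nonneg (^-nonneg n (proj₁ 0<2)) (^-nonneg n (fromℕ-nonneg 4))) F≤N^n (𝔼-energy-≤ n n) ⟩
      N ^ n * ((1# + 1#) ^ n * fromℕ 4 ^ n)   ≡⟨ cong (N ^ n *_) (^-distrib-* (1# + 1#) (fromℕ 4) n) ⟨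
      N ^ n * ((1# + 1#) * fromℕ 4) ^ n       ≡⟨ ^-distrib-* N _ n ⟨
      (N * ((1# + 1#) * fromℕ 4)) ^ n         ≡⟨ cong (_^ n) (solve 1 (λ N → N :* ((c# 1 :+ c# 1) :* c# 4) := c# 8 :* N) refl N) ⟩
      (fromℕ 8 * N) ^ n                       ≡⟨ *-identityʳ _ ⟨
      (fromℕ 8 * N) ^ n * 1#                  ∎)
      where
        open Expectation (signMatrix n d)
        N = fromℕ n
        F = fromℕ (n !)
        large : Pred Ω 0ℓ
        large Φ = ¬ (energy Φ a ≤ fromℕ 16 * fromℕ n)
        P = ℙ large
        0<F : 0# < F
        0<F = fromℕ-pos (n !) {{n ℕₚ.!≢0}}
        F≤N^n : F ≤ N ^ n
        F≤N^n = ≤-trans (fromℕ-mono (n!≤m^n n ℕₚ.≤-refl)) (≤-reflexive (fromℕ-^ n n))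
        0<8n^n : 0# < (fromℕ 8 * N) ^ n
        0<8n^n = ^-pos n (*-pos (fromℕ-pos 8) (fromℕ-pos n))

-- Inner products

module InnerProduct (R : CompleteOrderedField) where
  open OrderedField R
  open Sums R
  open LinearAlgebra R
  open ≤-Reasoning

  infix 5 ⟨_,_⟩
  ⟨_,_⟩ : ∀ {n} → Vector ℝ n → Vector ℝ n → ℝ
  ⟨ u , v ⟩ = sum (λ i → u i * v i)

  ⟨⟩-cong : ∀ {n} {u u′ v v′ : Vector ℝ n} → (∀ i → u i ≡ u′ i) → (∀ i → v i ≡ v′ i) → ⟨ u , v ⟩ ≡ ⟨ u′ , v′ ⟩
  ⟨⟩-cong uu vv = sum-cong-≗ (λ i → cong₂ _*_ (uu i) (vv i))

  ⟨⟩-comm : ∀ {n} (u v : Vector ℝ n) → ⟨ u , v ⟩ ≡ ⟨ v , u ⟩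
  ⟨⟩-comm u v = sum-cong-≗ (λ i → *-comm (u i) (v i))

  ⟨⟩-linearʳ : ∀ {n} (u v w : Vector ℝ n) a b → ⟨ u , (λ i → a * v i + b * w i) ⟩ ≡ a * ⟨ u , v ⟩ + b * ⟨ u , w ⟩
  ⟨⟩-linearʳ u v w a b = begin-equality
    sum (λ i → u i * (a * v i + b * w i)) ≡⟨ sum-cong-≗ (λ i → solve 5 (λ u v w a b → u :* (a :* v :+ b :* w) := a :* (u :* v) :+ b :* (u :* w)) refl (u i) (v i) (w i) a b) ⟩
    sum (λ i → a * (u i * v i) + b * (u i * w i)) ≡⟨ ∑-distrib-+ (λ i → a * (u i * v i)) (λ i → b * (u i * w i)) ⟩
    sum (λ i → a * (u i * v i)) + sum (λ i → b * (u i * w i)) ≡⟨ cong₂ _+_ (sym (*-distribˡ-sum a (λ i → u i * v i))) (sym (*-distribˡ-sum b (λ i → u i * w i))) ⟩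
    a * ⟨ u , v ⟩ + b * ⟨ u , w ⟩ ∎

  ⟨⟩-scaleʳ : ∀ {n} (u v : Vector ℝ n) a → ⟨ u , (λ i → a * v i) ⟩ ≡ a * ⟨ u , v ⟩
  ⟨⟩-scaleʳ u v a = trans (sum-cong-≗ (λ i → solve 3 (λ u v a → u :* (a :* v) := a :* (u :* v)) refl (u i) (v i) a))
    (sym (*-distribˡ-sum a (λ i → u i * v i)))

  ⟨⟩-subʳ : ∀ {n} (u v w : Vector ℝ n) → ⟨ u , v -ᵥ w ⟩ ≡ ⟨ u , v ⟩ - ⟨ u , w ⟩
  ⟨⟩-subʳ u v w = trans (⟨⟩-cong {u = u} (λ _ → refl) (λ i → solve 2 (λ v w → v :- w := c# 1 :* v :+ (:- c# 1) :* w) refl (v i) (w i)))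
    (trans (⟨⟩-linearʳ u v w 1# (- 1#)) (solve 2 (λ v w → c# 1 :* v :+ (:- c# 1) :* w := v :- w) refl ⟨ u , v ⟩ ⟨ u , w ⟩))

  ⟨⟩-sumʳ : ∀ {n k} (u : Vector ℝ n) (c : Vector ℝ k) (V : Fin k → Vector ℝ n) →
            ⟨ u , (λ i → sum (λ j → c j * V j i)) ⟩ ≡ sum (λ j → c j * ⟨ u , V j ⟩)
  ⟨⟩-sumʳ u c V = begin-equality
    sum (λ i → u i * sum (λ j → c j * V j i))   ≡⟨ sum-cong-≗ (λ i → *-distribˡ-sum (u i) (λ j → c j * V j i)) ⟩
    sum (λ i → sum (λ j → u i * (c j * V j i))) ≡⟨ ∑-comm (λ i j → u i * (c j * V j i)) ⟩
    sum (λ j → sum (λ i → u i * (c j * V j i))) ≡⟨ sum-cong-≗ (λ j → ⟨⟩-scaleʳ u (V j) (c j)) ⟩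
    sum (λ j → c j * ⟨ u , V j ⟩)               ∎

  ⟨⟩-definite : ∀ {n} (u : Vector ℝ n) → ⟨ u , u ⟩ ≡ 0# → ∀ i → u i ≡ 0#
  ⟨⟩-definite u uu≡0 i with u i ≟ 0#
  ... | yes u≡0 = u≡0
  ... | no  u≢0 = integral u≢0 (≤-antisym (≤-trans (term≤sum {f = λ i → u i * u i} (λ j → square-nonneg (u j)) i) (≤-reflexive uu≡0)) (square-nonneg (u i)))

-- Gram-Schmidt orthonormalisation

module GramSchmidt (R : CompleteOrderedField) where
  open OrderedField R
  open Completeness R
  open Sums R
  open LinearAlgebra R
  open InnerProduct R
  open ≤-Reasoning

  -- The operator Qᵀ Q. When the nonzero rows of Q are orthonormal, it is the orthogonal projection
  -- onto their span.
  gram : ∀ {k d} → Matrix k d → Vector ℝ d → Vector ℝ d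
  gram Q v l = sum (λ j → ⟨ Q j , v ⟩ * Q j l)

  ⟨⟩-gram : ∀ {k d} (Q : Matrix k d) u v → ⟨ u , gram Q v ⟩ ≡ ⟨ Q *ᵥ u , Q *ᵥ v ⟩
  ⟨⟩-gram Q u v = trans (⟨⟩-sumʳ u (λ j → ⟨ Q j , v ⟩) Q)
    (sum-cong-≗ (λ j → trans (*-comm _ _) (cong (_* ⟨ Q j , v ⟩) (⟨⟩-comm u (Q j)))))

  gram-symmetric : ∀ {k d} (Q : Matrix k d) u v → ⟨ u , gram Q v ⟩ ≡ ⟨ gram Q u , v ⟩
  gram-symmetric Q u v = trans (⟨⟩-gram Q u v) (trans (⟨⟩-comm (Q *ᵥ u) (Q *ᵥ v)) (trans (sym (⟨⟩-gram Q v u)) (⟨⟩-comm v (gram Q u))))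

  gram-cong : ∀ {k d} (Q : Matrix k d) {u v} → (∀ l → u l ≡ v l) → ∀ l → gram Q u l ≡ gram Q v l
  gram-cong Q uv l = sum-cong-≗ (λ j → cong (_* Q j l) (⟨⟩-cong {u = Q j} (λ _ → refl) uv))

  gram-linear : ∀ {k d} (Q : Matrix k d) u v a b l → gram Q (λ i → a * u i + b * v i) l ≡ a * gram Q u l + b * gram Q v l
  gram-linear Q u v a b l = begin-equality
    sum (λ j → ⟨ Q j , (λ i → a * u i + b * v i) ⟩ * Q j l) ≡⟨ sum-cong-≗ (λ j → trans (cong (_* Q j l) (⟨⟩-linearʳ (Q j) u v a b))
       (solve 5 (λ a x b y q → (a :* x :+ b :* y) :* q := q :* (a :* x :+ b :* y)) refl a ⟨ Q j , u ⟩ b ⟨ Q j , v ⟩ (Q j l))) ⟩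
    ⟨ (λ j → Q j l) , (λ j → a * ⟨ Q j , u ⟩ + b * ⟨ Q j , v ⟩) ⟩ ≡⟨ ⟨⟩-linearʳ (λ j → Q j l) (λ j → ⟨ Q j , u ⟩) (λ j → ⟨ Q j , v ⟩) a b ⟩
    a * ⟨ (λ j → Q j l) , (λ j → ⟨ Q j , u ⟩) ⟩ + b * ⟨ (λ j → Q j l) , (λ j → ⟨ Q j , v ⟩) ⟩
      ≡⟨ cong₂ (λ x y → a * x + b * y) (⟨⟩-comm (λ j → Q j l) _) (⟨⟩-comm (λ j → Q j l) _) ⟩
    a * gram Q u l + b * gram Q v l ∎

  -- The vectors may be linearly dependent, in which case some rows have to vanish. Idempotence of
  -- Qᵀ Q is the form of orthonormality that tolerates zero rows, so there can always be exactly m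
  -- rows.
  record OrthonormalFor {d m} (A : Fin m → Vector ℝ d) : Set where
    field
      basis      : Matrix m d
      idempotent : ∀ v l → gram basis (gram basis v) l ≡ gram basis v l
      fixes      : ∀ i l → gram basis (A i) l ≡ A i l

  gramSchmidt : ∀ {d} m (A : Fin m → Vector ℝ d) → OrthonormalFor A
  gramSchmidt zero A = record { basis = λ () ; idempotent = λ _ _ → refl ; fixes = λ () }
  gramSchmidt {d} (suc m) A = record { basis = Q′ ; idempotent = idempotent′ ; fixes = fixes′ }
    where
      open OrthonormalFor (gramSchmidt m (A ∘ suc)) renaming (basis to Q)
      a b q : Vector ℝ d
      a = A zero
      b = a -ᵥ gram Q a
      c : ℝ
      c = √ ⟨ b , b ⟩ ⁻¹
      q l = c * b l
      Q′ : Matrix (suc m) d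
      Q′ zero    = q
      Q′ (suc j) = Q j

      0≤bb : 0# ≤ ⟨ b , b ⟩
      0≤bb = sum-nonneg (λ i → square-nonneg (b i))

      gram-b : ∀ l → gram Q b l ≡ 0#
      gram-b l = begin-equality
        gram Q b l ≡⟨ gram-cong Q (λ i → solve 2 (λ v w → v :- w := c# 1 :* v :+ (:- c# 1) :* w) refl (a i) (gram Q a i)) l ⟩
        gram Q (λ i → 1# * a i + - 1# * gram Q a i) l ≡⟨ gram-linear Q a (gram Q a) 1# (- 1#) l ⟩
        1# * gram Q a l + - 1# * gram Q (gram Q a) l ≡⟨ cong (λ x → 1# * gram Q a l + - 1# * x) (idempotent a l) ⟩
        1# * gram Q a l + - 1# * gram Q a l ≡⟨ solve 1 (λ x → c# 1 :* x :+ (:- c# 1) :* x := c# 0) refl (gram Q a l) ⟩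
        0# ∎

      ⟨b,gram⟩ : ∀ v → ⟨ b , gram Q v ⟩ ≡ 0#
      ⟨b,gram⟩ v = trans (gram-symmetric Q b v) (trans (⟨⟩-cong {v = v} gram-b (λ _ → refl))
        (trans (sum-cong-≗ (λ i → zeroˡ (v i))) (sum-replicate-zero d)))

      ⟨q,_⟩≡ : ∀ v → ⟨ q , v ⟩ ≡ c * ⟨ b , v ⟩
      ⟨q, v ⟩≡ = trans (⟨⟩-comm q v) (trans (⟨⟩-scaleʳ v b c) (cong (c *_) (⟨⟩-comm v b)))

      ⟨q,gram⟩ : ∀ v → ⟨ q , gram Q v ⟩ ≡ 0#
      ⟨q,gram⟩ v = trans ⟨q, gram Q v ⟩≡ (trans (cong (c *_) (⟨b,gram⟩ v)) (zeroʳ c))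

      -- If b = 0 then c is a junk value, which is harmless.
      normalised : ∀ l → c * c * ⟨ b , b ⟩ * b l ≡ b l
      normalised l with ⟨ b , b ⟩ ≟ 0#
      ... | yes bb≡0 = trans (cong (c * c * ⟨ b , b ⟩ *_) (⟨⟩-definite b bb≡0 l)) (trans (zeroʳ _) (sym (⟨⟩-definite b bb≡0 l)))
      ... | no  bb≢0 = begin-equality
          c * c * ⟨ b , b ⟩ * b l ≡⟨ cong (λ x → c * c * x * b l) (√-square 0≤bb) ⟨
          c * c * (r * r) * b l   ≡⟨ solve 3 (λ c r b → c :* c :* (r :* r) :* b := r :* c :* (r :* c) :* b) refl c r (b l) ⟩
          r * c * (r * c) * b l   ≡⟨ cong (λ x → x * x * b l) (*-inverseʳ r (λ r≡0 → bb≢0 (trans (sym (√-square 0≤bb)) (trans (cong (_* r) r≡0) (zeroˡ r))))) ⟩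
          1# * 1# * b l           ≡⟨ solve 1 (λ b → c# 1 :* c# 1 :* b := b) refl (b l) ⟩
          b l                     ∎
        where r = √ ⟨ b , b ⟩

      gram-q : ∀ x v l → gram Q (λ i → x * q i + 1# * v i) l ≡ gram Q v l
      gram-q x v l = begin-equality
        gram Q (λ i → x * q i + 1# * v i) l   ≡⟨ gram-cong Q (λ i → solve 4 (λ x c b v → x :* (c :* b) :+ c# 1 :* v := (x :* c) :* b :+ c# 1 :* v) refl x c (b i) (v i)) l ⟩
        gram Q (λ i → x * c * b i + 1# * v i) l ≡⟨ gram-linear Q b v (x * c) 1# l ⟩
        x * c * gram Q b l + 1# * gram Q v l ≡⟨ cong (λ y → x * c * y + 1# * gram Q v l) (gram-b l) ⟩
        x * c * 0# + 1# * gram Q v l ≡⟨ solve 2 (λ x v → x :* c# 0 :+ c# 1 :* v := v) refl (x * c) (gram Q v l) ⟩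
        gram Q v l ∎

      idempotent′ : ∀ v l → gram Q′ (gram Q′ v) l ≡ gram Q′ v l
      idempotent′ v l = cong₂ _+_ head (begin-equality
          gram Q (gram Q′ v) l ≡⟨ gram-cong Q (λ i → cong (⟨ q , v ⟩ * q i +_) (sym (*-identityˡ _))) l ⟩
          gram Q (λ i → ⟨ q , v ⟩ * q i + 1# * gram Q v i) l ≡⟨ gram-q ⟨ q , v ⟩ (gram Q v) l ⟩
          gram Q (gram Q v) l ≡⟨ idempotent v l ⟩
          gram Q v l ∎)
        where
          head : ⟨ q , gram Q′ v ⟩ * q l ≡ ⟨ q , v ⟩ * q l
          head = begin-equality
            ⟨ q , gram Q′ v ⟩ * q l ≡⟨ cong (_* q l) (⟨⟩-cong {u = q} (λ _ → refl) (λ i → cong (⟨ q , v ⟩ * q i +_) (sym (*-identityˡ _)))) ⟩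
            ⟨ q , (λ i → ⟨ q , v ⟩ * q i + 1# * gram Q v i) ⟩ * q l ≡⟨ cong (_* q l) (⟨⟩-linearʳ q q (gram Q v) ⟨ q , v ⟩ 1#) ⟩
            (⟨ q , v ⟩ * ⟨ q , q ⟩ + 1# * ⟨ q , gram Q v ⟩) * q l ≡⟨ cong₂ (λ x y → (⟨ q , v ⟩ * x + 1# * y) * q l) (trans ⟨q, q ⟩≡ (cong (c *_) (⟨⟩-scaleʳ b b c))) (⟨q,gram⟩ v) ⟩
            (⟨ q , v ⟩ * (c * (c * ⟨ b , b ⟩)) + 1# * 0#) * (c * b l) ≡⟨ solve 4 (λ x c B b → (x :* (c :* (c :* B)) :+ c# 1 :* c# 0) :* (c :* b) := x :* (c :* (c :* c :* B :* b))) refl ⟨ q , v ⟩ c ⟨ b , b ⟩ (b l) ⟩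
            ⟨ q , v ⟩ * (c * (c * c * ⟨ b , b ⟩ * b l)) ≡⟨ cong (λ x → ⟨ q , v ⟩ * (c * x)) (normalised l) ⟩
            ⟨ q , v ⟩ * q l ∎

      fixes′ : ∀ i l → gram Q′ (A i) l ≡ A i l
      fixes′ zero l = begin-equality
        ⟨ q , a ⟩ * q l + gram Q a l ≡⟨ cong (λ x → x * q l + gram Q a l) (trans ⟨q, a ⟩≡ (cong (c *_) ⟨b,a⟩)) ⟩
        c * ⟨ b , b ⟩ * (c * b l) + gram Q a l ≡⟨ cong (_+ gram Q a l) (solve 3 (λ c B b → c :* B :* (c :* b) := c :* c :* B :* b) refl c ⟨ b , b ⟩ (b l)) ⟩
        c * c * ⟨ b , b ⟩ * b l + gram Q a l ≡⟨ cong (_+ gram Q a l) (normalised l) ⟩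
        a l - gram Q a l + gram Q a l ≡⟨ solve 2 (λ a g → a :- g :+ g := a) refl (a l) (gram Q a l) ⟩
        a l ∎
        where
          ⟨b,a⟩ : ⟨ b , a ⟩ ≡ ⟨ b , b ⟩
          ⟨b,a⟩ = sym (trans (⟨⟩-subʳ b a (gram Q a)) (trans (cong (λ x → ⟨ b , a ⟩ - x) (⟨b,gram⟩ a)) (solve 1 (λ x → x :- c# 0 := x) refl ⟨ b , a ⟩)))
      fixes′ (suc i) l = begin-equality
        ⟨ q , A (suc i) ⟩ * q l + gram Q (A (suc i)) l ≡⟨ cong₂ (λ x y → x * q l + y) (trans (⟨⟩-cong {u = q} (λ _ → refl) (λ j → sym (fixes i j))) (⟨q,gram⟩ (A (suc i)))) (fixes i l) ⟩
        0# * q l + A (suc i) l ≡⟨ solve 2 (λ q a → c# 0 :* q :+ a := a) refl (q l) (A (suc i) l) ⟩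
        A (suc i) l ∎

-- Sketches: scaled random signs, or a projection with a random check

module Sketches (em : ExcludedMiddle 0ℓ) (R : CompleteOrderedField) where
  open OrderedField R
  open Completeness R
  open Sums R
  open LinearAlgebra R
  open InnerProduct R
  open GramSchmidt R
  open FiniteProbability em R
  open Rademacher em R
  open UpperTail em R
  open ≤-Reasoning

  -- Row 0 of the sketch is a check: it vanishes on the range of A, so that an
  -- input on which it does not vanish may be rejected outright.
  record Sketch {d m} (A : Matrix d m) (θ : ℕ) (P : Set) (δ : ℝ) (q : ℕ) : Set₁ where
    field
      space : FiniteSpace
    open Expectation space public
    field
      matrix         : Ω → Matrix (suc q) d
      check-column   : ∀ ω i → (matrix ω *ᵥ column A i) zero ≡ 0#
      column-bounded : ∀ ω i → sumSq (matrix ω *ᵥ column A i) ≤ fromℕ 16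
      -- The v p are to be residuals A u - T y, with a step count in place of τ. The bad event
      -- includes passing the check, since for y outside the range the projecting sketch relies on
      -- the check alone.
      sound : ∀ y τ (u : P → Vector ℝ m) η → 0# ≤ η →
              let v : P → Vector ℝ d
                  v p l = (A *ᵥ u p) l - τ * y l
              in (∀ p → η < sumSq (v p)) →
              ℙ (λ ω → (matrix ω *ᵥ y) zero ≡ 0# × ∃[ p ] fromℕ θ * sumSq (matrix ω *ᵥ v p) ≤ η) ≤ δ

  ≤-⁻¹ : ∀ {x p} → 0# < x → x * p ≤ 1# → p ≤ x ⁻¹
  ≤-⁻¹ {x} {p} 0<x xp≤1 = *-cancelˡ-≤ 0<x (≤-trans xp≤1 (≤-reflexive (sym (*-inverseʳ x (<⇒≢ 0<x)))))

  module SignSketch {d m} (A : Matrix d m) (unit : ∀ i → sumSq (column A i) ≡ 1#)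
                    (w : ℕ) .{{_ : NonZero w}} (large : 32 ℕ.* 9 ℕ.^ w ℕ.≤ 10 ℕ.^ w)
                    (k : ℕ) .{{_ : NonZero k}} where
    private
      -- Here k counts blocks of w rows and is not the sparsity; it will be T ℓ with 2^ℓ ≥ m / δ.
      n = w ℕ.* k
      instance
        n≢0 : NonZero n
        n≢0 = ℕₚ.m*n≢0 w k

    open Expectation (signMatrix n d)

    Good : Pred Ω 0ℓ
    Good Φ = ∀ i → energy Φ (column A i) ≤ fromℕ 16 * fromℕ n

    private
      r = √ (fromℕ n)

      rr≡n : r * r ≡ fromℕ n
      rr≡n = √-square (fromℕ-nonneg n)

    -- Zeroing a bad draw makes the column bound hold surely, as acceptance with probability 1
    -- demands. The zero sketch accepts everything, so its price is paid in soundness only.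
    scale : Ω → ℝ
    scale Φ with em {Good Φ}
    ... | yes _ = r ⁻¹
    ... | no  _ = 0#

    scale-good : ∀ {Φ} → Good Φ → scale Φ ≡ r ⁻¹
    scale-good {Φ} good with em {Good Φ}
    ... | yes _   = refl
    ... | no ¬good = ⊥-elim (¬good good)

    r⁻¹r⁻¹n : r ⁻¹ * r ⁻¹ * fromℕ n ≡ 1#
    r⁻¹r⁻¹n = begin-equality
      r ⁻¹ * r ⁻¹ * fromℕ n   ≡⟨ cong (r ⁻¹ * r ⁻¹ *_) rr≡n ⟨
      r ⁻¹ * r ⁻¹ * (r * r)   ≡⟨ solve 2 (λ i r → i :* i :* (r :* r) := r :* i :* (r :* i)) refl (r ⁻¹) r ⟩
      r * r ⁻¹ * (r * r ⁻¹)   ≡⟨ cong (λ x → x * x) (*-inverseʳ r r≢0) ⟩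
      1# * 1#                 ≡⟨ *-identityʳ 1# ⟩
      1#                      ∎
      where
        r≢0 : r ≢ 0#
        r≢0 r≡0 = <⇒≢ (fromℕ-pos n) (trans (sym rr≡n) (trans (cong (_* r) r≡0) (zeroˡ r)))

    -- The check row is trivial here: the sign rows detect distance from any point of the space,
    -- also for y outside the range of A.
    matrix : Ω → Matrix (suc n) d
    matrix Φ zero    l = 0#
    matrix Φ (suc j) l = scale Φ * sign (lookup (lookup Φ j) l)

    ·±-sum : ∀ {d} (r : Vec (Fin 2) d) v → ⟨ sign ∘ lookup r , v ⟩ ≡ r ·± v
    ·±-sum []      v = refl
    ·±-sum (a ∷ r) v = cong (sign a * v zero +_) (·±-sum r (v ∘ suc))

    energy-sum : ∀ {d n} (Φ : Vec (Vec (Fin 2) d) n) v → sumSq (λ j → lookup Φ j ·± v) ≡ energy Φ v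
    energy-sum []      v = refl
    energy-sum (r ∷ Φ) v = cong (r ·± v * r ·± v +_) (energy-sum Φ v)

    row-zero : ∀ Φ v → (matrix Φ *ᵥ v) zero ≡ 0#
    row-zero Φ v = trans (sum-cong-≗ (λ l → zeroˡ (v l))) (sum-replicate-zero d)

    sumSq-matrix : ∀ Φ v → sumSq (matrix Φ *ᵥ v) ≡ scale Φ * scale Φ * energy Φ v
    sumSq-matrix Φ v = begin-equality
      (matrix Φ *ᵥ v) zero * (matrix Φ *ᵥ v) zero + sumSq (λ j → (matrix Φ *ᵥ v) (suc j))
        ≡⟨ cong₂ _+_ (cong (λ x → x * x) (row-zero Φ v)) (sum-cong-≗ (λ j → cong (λ x → x * x) (row j))) ⟩
      0# * 0# + sumSq (λ j → scale Φ * (lookup Φ j ·± v))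
        ≡⟨ solve 1 (λ x → c# 0 :* c# 0 :+ x := x) refl _ ⟩
      sumSq (λ j → scale Φ * (lookup Φ j ·± v))
        ≡⟨ sum-cong-≗ (λ j → solve 2 (λ c x → c :* x :* (c :* x) := c :* c :* (x :* x)) refl (scale Φ) (lookup Φ j ·± v)) ⟩
      sum (λ j → scale Φ * scale Φ * (lookup Φ j ·± v * lookup Φ j ·± v))
        ≡⟨ *-distribˡ-sum (scale Φ * scale Φ) (λ j → lookup Φ j ·± v * lookup Φ j ·± v) ⟨
      scale Φ * scale Φ * sumSq (λ j → lookup Φ j ·± v) ≡⟨ cong (scale Φ * scale Φ *_) (energy-sum Φ v) ⟩
      scale Φ * scale Φ * energy Φ v ∎
      where
        row : ∀ j → (matrix Φ *ᵥ v) (suc j) ≡ scale Φ * (lookup Φ j ·± v)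
        row j = trans (sum-cong-≗ (λ l → *-assoc (scale Φ) (sign (lookup (lookup Φ j) l)) (v l)))
          (trans (sym (*-distribˡ-sum (scale Φ) (λ l → sign (lookup (lookup Φ j) l) * v l))) (cong (scale Φ *_) (·±-sum (lookup Φ j) v)))

    column-bounded : ∀ Φ i → sumSq (matrix Φ *ᵥ column A i) ≤ fromℕ 16
    column-bounded Φ i = ≤-trans (≤-reflexive (sumSq-matrix Φ (column A i))) bound
      where
        bound : scale Φ * scale Φ * energy Φ (column A i) ≤ fromℕ 16
        bound with em {Good Φ}
        ... | yes good = begin
          r ⁻¹ * r ⁻¹ * energy Φ (column A i)     ≤⟨ *-monoˡ-≤ (square-nonneg (r ⁻¹)) (good i) ⟩
          r ⁻¹ * r ⁻¹ * (fromℕ 16 * fromℕ n)      ≡⟨ solve 3 (λ i a n → i :* i :* (a :* n) := a :* (i :* i :* n)) refl (r ⁻¹) (fromℕ 16) (fromℕ n) ⟩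
          fromℕ 16 * (r ⁻¹ * r ⁻¹ * fromℕ n)      ≡⟨ cong (fromℕ 16 *_) r⁻¹r⁻¹n ⟩
          fromℕ 16 * 1#                           ≡⟨ *-identityʳ _ ⟩
          fromℕ 16                                ∎
        ... | no _ = begin
          0# * 0# * energy Φ (column A i) ≡⟨ solve 1 (λ x → c# 0 :* c# 0 :* x := c# 0) refl (energy Φ (column A i)) ⟩
          0#                              ≤⟨ fromℕ-nonneg 16 ⟩
          fromℕ 16                        ∎

    -- Either some column is stretched and the sketch is zeroed, or some v p is shrunk. In a good
    -- draw the scale 1 / n with n = w k turns the factor θ = 4 w into the factor 4 / k of the lower
    -- tail.
    signSketch : ∀ {P N δ} → UnionBound P N →
                 fromℕ m * ((1# + 1#) ^ n) ⁻¹ + fromℕ N * (fromℕ 16 ^ k) ⁻¹ ≤ δ →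
                 Sketch A (4 ℕ.* w) P δ n
    signSketch {P} {N} {δ} ub total = record
      { space = signMatrix n d
      ; matrix = matrix
      ; check-column = λ Φ i → row-zero Φ (column A i)
      ; column-bounded = column-bounded
      ; sound = λ y τ u η 0≤η far →
          let v : P → Vector ℝ d
              v p l = (A *ᵥ u p) l - τ * y l
          in begin
          ℙ (λ Φ → (matrix Φ *ᵥ y) zero ≡ 0# × ∃[ p ] fromℕ (4 ℕ.* w) * sumSq (matrix Φ *ᵥ v p) ≤ η)
            ≤⟨ ℙ-mono (λ Φ e → split v η far Φ (proj₂ e)) ⟩
          ℙ (λ Φ → (∃[ i ] ¬ (energy Φ (column A i) ≤ fromℕ 16 * fromℕ n)) ⊎ (∃[ p ] fromℕ 4 * energy Φ (v p) ≤ fromℕ k * sumSq (v p)))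
            ≤⟨ ℙ-∪ _ _ ⟩
          ℙ (λ Φ → ∃[ i ] ¬ (energy Φ (column A i) ≤ fromℕ 16 * fromℕ n)) + ℙ (λ Φ → ∃[ p ] fromℕ 4 * energy Φ (v p) ≤ fromℕ k * sumSq (v p))
            ≤⟨ +-mono-≤
                 (unionBound-Fin m (signMatrix n d) _ _ (proj₁ (⁻¹-pos 0<2^n)) (λ i → ≤-⁻¹ 0<2^n (upper-tail (column A i) (unit i) n)))
                 (ub (signMatrix n d) _ _ (proj₁ (⁻¹-pos 0<16^k)) (λ p → ≤-⁻¹ 0<16^k
                   (LowerTail.lower-tail (v p) (≤-<-trans 0≤η (far p)) w large k))) ⟩
          fromℕ m * ((1# + 1#) ^ n) ⁻¹ + fromℕ N * (fromℕ 16 ^ k) ⁻¹ ≤⟨ total ⟩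
          δ ∎
      }
      where
        0<2^n : 0# < (1# + 1#) ^ n
        0<2^n = ^-pos n 0<2
        0<16^k : 0# < fromℕ 16 ^ k
        0<16^k = ^-pos k (fromℕ-pos 16)
        split : ∀ (v : P → Vector ℝ d) η → (∀ p → η < sumSq (v p)) → ∀ Φ →
                (∃[ p ] fromℕ (4 ℕ.* w) * sumSq (matrix Φ *ᵥ v p) ≤ η) →
                (∃[ i ] ¬ (energy Φ (column A i) ≤ fromℕ 16 * fromℕ n)) ⊎ (∃[ p ] fromℕ 4 * energy Φ (v p) ≤ fromℕ k * sumSq (v p))
        split v η far Φ (p , small) with Finₚ.all? (λ i → energy Φ (column A i) ≤? fromℕ 16 * fromℕ n)
        ... | no ¬good = inj₁ (Finₚ.¬∀⟶∃¬ m _ (λ i → energy Φ (column A i) ≤? fromℕ 16 * fromℕ n) ¬good)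
        ... | yes good = inj₂ (p , *-cancelˡ-≤ (fromℕ-pos w) (begin
            fromℕ w * (fromℕ 4 * e)                             ≡⟨ *-identityˡ _ ⟨
            1# * (fromℕ w * (fromℕ 4 * e))                      ≡⟨ cong (_* (fromℕ w * (fromℕ 4 * e))) r⁻¹r⁻¹n ⟨
            r ⁻¹ * r ⁻¹ * fromℕ n * (fromℕ w * (fromℕ 4 * e))   ≡⟨ solve 5 (λ i n w f e → i :* i :* n :* (w :* (f :* e)) := n :* (f :* w :* (i :* i :* e))) refl (r ⁻¹) (fromℕ n) (fromℕ w) (fromℕ 4) e ⟩
            fromℕ n * (fromℕ 4 * fromℕ w * (r ⁻¹ * r ⁻¹ * e))   ≡⟨ cong₂ (λ x y → fromℕ n * (x * y)) (sym (fromℕ-* 4 w)) (sym (trans (sumSq-matrix Φ (v p)) (cong (λ x → x * x * e) (scale-good good)))) ⟩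
            fromℕ n * (fromℕ (4 ℕ.* w) * sumSq (matrix Φ *ᵥ v p)) ≤⟨ *-monoˡ-≤ (fromℕ-nonneg n) (≤-trans small (proj₁ (far p))) ⟩
            fromℕ n * sumSq (v p)                               ≡⟨ cong (_* sumSq (v p)) (fromℕ-* w k) ⟩
            fromℕ w * fromℕ k * sumSq (v p)                     ≡⟨ *-assoc _ _ _ ⟩
            fromℕ w * (fromℕ k * sumSq (v p))                   ∎))
          where e = energy Φ (v p)

  indicators≤1 : ∀ n (E : Fin n → Set) → (∀ i j → E i → E j → i ≡ j) → sum (λ i → indicator (E i)) ≤ 1#
  indicators≤1 zero E unique = 0≤1
  indicators≤1 (suc n) E unique with em {E zero}
  ... | yes e = ≤-reflexive (trans (cong (1# +_) (trans (sum-cong-≗ (λ i → indicator-false {E (suc i)} (λ e′ → Finₚ.0≢1+n (unique zero (suc i) e e′)))) (sum-replicate-zero n))) (+-identityʳ 1#))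
  ... | no  _ = ≤-trans (≤-reflexive (+-identityˡ _)) (indicators≤1 n (E ∘ suc) (λ i j e e′ → Finₚ.suc-injective (unique (suc i) (suc j) e e′)))

  fromℕ-injective : ∀ {a b} → fromℕ a ≡ fromℕ b → a ≡ b
  fromℕ-injective {a} {b} eq = ℕₚ.≤-antisym (fromℕ-cancel-≤ {a} {b} (≤-reflexive eq)) (fromℕ-cancel-≤ {b} {a} (≤-reflexive (sym eq)))

  module AntiConcentration (N : ℕ) .{{_ : NonZero N}} where
    private
      module S d = Expectation (power (uniform N) d)
      module U = Expectation (uniform N)

    value : ∀ {d} → Vec (Fin N) d → Vector ℝ d
    value ω l = fromℕ (toℕ (lookup ω l))

    -- Once the other coordinates are fixed, the equation determines coordinate l because w l is
    -- nonzero, so at most one of its N equally likely values fits.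
    anticoncentration : ∀ d (w : Vector ℝ d) l → w l ≢ 0# → ∀ c → S.ℙ d (λ ω → ⟨ value ω , w ⟩ ≡ c) ≤ fromℕ N ⁻¹
    anticoncentration (suc d) w (suc l) wl≢0 c = ≤-trans
      (U.𝔼-mono (λ a → ≤-trans (S.ℙ-mono d (λ ω eq → trans (solve 2 (λ x y → y := x :+ y :- x) refl (fromℕ (toℕ a) * w zero) _) (cong (_- fromℕ (toℕ a) * w zero) eq)))
        (anticoncentration d (w ∘ suc) l wl≢0 (c - fromℕ (toℕ a) * w zero))))
      (≤-reflexive (U.𝔼-const _))
    anticoncentration (suc d) w zero w0≢0 c = begin
      fromℕ N ⁻¹ * sum (λ a → S.ℙ d (E a))  ≡⟨ cong (fromℕ N ⁻¹ *_) (swap N E) ⟩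
      fromℕ N ⁻¹ * S.𝔼 d (λ ω → sum (λ a → indicator (E a ω)))
        ≤⟨ *-monoˡ-≤ (proj₁ (⁻¹-pos (fromℕ-pos N))) (≤-trans (S.𝔼-mono d (λ ω → indicators≤1 N (λ a → E a ω) (unique ω))) (≤-reflexive (S.𝔼-const d 1#))) ⟩
      fromℕ N ⁻¹ * 1# ≡⟨ *-identityʳ _ ⟩
      fromℕ N ⁻¹ ∎
      where
        E : Fin N → Pred (Vec (Fin N) d) 0ℓ
        E a ω = fromℕ (toℕ a) * w zero + ⟨ value ω , w ∘ suc ⟩ ≡ c
        swap : ∀ n (G : Fin n → Pred (Vec (Fin N) d) 0ℓ) → sum (λ a → S.ℙ d (G a)) ≡ S.𝔼 d (λ ω → sum (λ a → indicator (G a ω)))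
        swap zero    G = sym (S.𝔼-const d 0#)
        swap (suc n) G = trans (cong (S.ℙ d (G zero) +_) (swap n (G ∘ suc))) (sym (S.𝔼-+ d _ _))
        unique : ∀ ω i j → E i ω → E j ω → i ≡ j
        unique ω i j ei ej = Finₚ.toℕ-injective (fromℕ-injective (begin-equality
          fromℕ (toℕ i) ≡⟨ solve 2 (λ i j → i := j :+ (i :- j)) refl (fromℕ (toℕ i)) (fromℕ (toℕ j)) ⟩
          fromℕ (toℕ j) + (fromℕ (toℕ i) - fromℕ (toℕ j)) ≡⟨ cong (fromℕ (toℕ j) +_) (integral w0≢0 (begin-equality
             w zero * (fromℕ (toℕ i) - fromℕ (toℕ j)) ≡⟨ solve 4 (λ w i j x → w :* (i :- j) := (i :* w :+ x) :- (j :* w :+ x)) refl (w zero) (fromℕ (toℕ i)) (fromℕ (toℕ j)) ⟨ value ω , w ∘ suc ⟩ ⟩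
             (fromℕ (toℕ i) * w zero + ⟨ value ω , w ∘ suc ⟩) - (fromℕ (toℕ j) * w zero + ⟨ value ω , w ∘ suc ⟩) ≡⟨ cong₂ _-_ ei ej ⟩
             c - c ≡⟨ -‿inverseʳ c ⟩
             0# ∎)) ⟩
          fromℕ (toℕ j) + 0# ≡⟨ +-identityʳ _ ⟩
          fromℕ (toℕ j) ∎))

  module ProjectionSketch {d m} (A : Matrix d m) (unit : ∀ i → sumSq (column A i) ≡ 1#)
                          (N : ℕ) .{{_ : NonZero N}} where
    open OrthonormalFor (gramSchmidt m (column A)) renaming (basis to Q)
    open AntiConcentration N
    open Expectation (power (uniform N) d)

    -- Row 0 is what the projection `gram Q` leaves of a random vector with entries among 0, ..., N
    -- - 1. A smaller δ enlarges N, never the number of rows.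
    matrix : Ω → Matrix (suc m) d
    matrix ω zero    = value ω -ᵥ gram Q (value ω)
    matrix ω (suc j) = Q j

    check : ∀ ω v → (matrix ω *ᵥ v) zero ≡ ⟨ value ω , v -ᵥ gram Q v ⟩
    check ω v = begin-equality
      ⟨ value ω -ᵥ gram Q (value ω) , v ⟩        ≡⟨ ⟨⟩-comm _ v ⟩
      ⟨ v , value ω -ᵥ gram Q (value ω) ⟩        ≡⟨ ⟨⟩-subʳ v (value ω) (gram Q (value ω)) ⟩
      ⟨ v , value ω ⟩ - ⟨ v , gram Q (value ω) ⟩ ≡⟨ cong₂ _-_ (⟨⟩-comm v (value ω)) (trans (gram-symmetric Q v (value ω)) (⟨⟩-comm (gram Q v) (value ω))) ⟩
      ⟨ value ω , v ⟩ - ⟨ value ω , gram Q v ⟩   ≡⟨ ⟨⟩-subʳ (value ω) v (gram Q v) ⟨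
      ⟨ value ω , v -ᵥ gram Q v ⟩                ∎

    isometry : ∀ v → (∀ l → gram Q v l ≡ v l) → sumSq (Q *ᵥ v) ≡ sumSq v
    isometry v fixed = trans (sym (⟨⟩-gram Q v v)) (⟨⟩-cong {u = v} (λ _ → refl) fixed)

    check-fixed : ∀ ω v → (∀ l → gram Q v l ≡ v l) → (matrix ω *ᵥ v) zero ≡ 0#
    check-fixed ω v fixed = trans (check ω v) (trans (sum-cong-≗ (λ l →
      trans (cong (λ x → value ω l * (v l - x)) (fixed l)) (solve 2 (λ a b → a :* (b :- b) := c# 0) refl (value ω l) (v l)))) (sum-replicate-zero d))

    gram-range : ∀ u l → gram Q (A *ᵥ u) l ≡ (A *ᵥ u) l
    gram-range u l = begin-equality
      sum (λ j → ⟨ Q j , A *ᵥ u ⟩ * Q j l) ≡⟨ sum-cong-≗ (λ j → cong (_* Q j l) (trans (⟨⟩-cong {u = Q j} (λ _ → refl) (λ i → sum-cong-≗ (λ s → *-comm (A i s) (u s)))) (⟨⟩-sumʳ (Q j) u (column A)))) ⟩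
      sum (λ j → sum (λ i → u i * ⟨ Q j , column A i ⟩) * Q j l) ≡⟨ sum-cong-≗ (λ j → *-distribʳ-sum (Q j l) (λ i → u i * ⟨ Q j , column A i ⟩)) ⟩
      sum (λ j → sum (λ i → u i * ⟨ Q j , column A i ⟩ * Q j l)) ≡⟨ ∑-comm (λ j i → u i * ⟨ Q j , column A i ⟩ * Q j l) ⟩
      sum (λ i → sum (λ j → u i * ⟨ Q j , column A i ⟩ * Q j l)) ≡⟨ sum-cong-≗ (λ i → trans (sum-cong-≗ (λ j → *-assoc (u i) ⟨ Q j , column A i ⟩ (Q j l)))
           (trans (sym (*-distribˡ-sum (u i) (λ j → ⟨ Q j , column A i ⟩ * Q j l))) (trans (cong (u i *_) (fixes i l)) (*-comm _ _)))) ⟩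
      (A *ᵥ u) l ∎

    -- If the projection moves y, the component it removes is nonzero and the check misses it with
    -- probability at most 1 / N ≤ δ. If it fixes y, it fixes every v p as well; there Q is an
    -- isometry, and as θ ≥ 1 no shrinking can occur.
    projectionSketch : ∀ {θ P δ} → .{{_ : NonZero θ}} → 0# < δ → δ ⁻¹ ≤ fromℕ N → Sketch A θ P δ m
    projectionSketch {θ} {P} {δ} 0<δ δ⁻¹≤N = record
      { space = power (uniform N) d
      ; matrix = matrix
      ; check-column = λ ω i → check-fixed ω (column A i) (fixes i)
      ; column-bounded = λ ω i → begin
          (matrix ω *ᵥ column A i) zero * (matrix ω *ᵥ column A i) zero + sumSq (Q *ᵥ column A i)
            ≡⟨ cong₂ (λ x y → x * x + y) (check-fixed ω (column A i) (fixes i)) (trans (isometry (column A i) (fixes i)) (unit i)) ⟩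
          0# * 0# + 1#  ≤⟨ ≤-via (fromℕ 15) (fromℕ-nonneg 15) (solve 0 (c# 16 := c# 0 :* c# 0 :+ c# 1 :+ c# 15) refl) ⟩
          fromℕ 16 ∎
      ; sound = λ y τ u η 0≤η far → sound y τ u η far
      }
      where
        N⁻¹≤δ : fromℕ N ⁻¹ ≤ δ
        N⁻¹≤δ = *-cancelˡ-≤ (*-pos (fromℕ-pos N) (⁻¹-pos 0<δ)) (begin
          fromℕ N * δ ⁻¹ * fromℕ N ⁻¹   ≡⟨ solve 3 (λ n i e → n :* i :* e := i :* (n :* e)) refl (fromℕ N) (δ ⁻¹) (fromℕ N ⁻¹) ⟩
          δ ⁻¹ * (fromℕ N * fromℕ N ⁻¹) ≡⟨ trans (cong (δ ⁻¹ *_) (*-inverseʳ _ (<⇒≢ (fromℕ-pos N)))) (*-identityʳ _) ⟩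
          δ ⁻¹                          ≤⟨ δ⁻¹≤N ⟩
          fromℕ N                       ≡⟨ trans (cong (fromℕ N *_) (*-inverseʳ δ (<⇒≢ 0<δ))) (*-identityʳ _) ⟨
          fromℕ N * (δ * δ ⁻¹)          ≡⟨ solve 3 (λ n i e → n :* (e :* i) := n :* i :* e) refl (fromℕ N) (δ ⁻¹) δ ⟩
          fromℕ N * δ ⁻¹ * δ            ∎)
        module _ (y : Vector ℝ d) (τ : ℝ) (u : P → Vector ℝ m) (η : ℝ) where
          v : P → Vector ℝ d
          v p l = (A *ᵥ u p) l - τ * y l
          sound : (∀ p → η < sumSq (v p)) →
                  ℙ (λ ω → (matrix ω *ᵥ y) zero ≡ 0# × ∃[ p ] fromℕ θ * sumSq (matrix ω *ᵥ v p) ≤ η) ≤ δ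
          sound far with Finₚ.all? (λ l → gram Q y l ≟ y l)
          ... | no ¬fixed = let l , yl≢ = Finₚ.¬∀⟶∃¬ d _ (λ l → gram Q y l ≟ y l) ¬fixed in
                ≤-trans (ℙ-mono (λ ω e → trans (sym (check ω y)) (proj₁ e)))
                  (≤-trans (anticoncentration d (y -ᵥ gram Q y) l (λ eq → yl≢ (begin-equality
                     gram Q y l ≡⟨ +-identityˡ _ ⟨
                     0# + gram Q y l ≡⟨ cong (_+ gram Q y l) eq ⟨
                     y l - gram Q y l + gram Q y l ≡⟨ solve 2 (λ a b → a :- b :+ b := a) refl (y l) (gram Q y l) ⟩
                     y l ∎)) 0#) N⁻¹≤δ)
          ... | yes fixed = ≤-trans (≤-reflexive (ℙ-impossible (λ { ω (_ , p , small) → <⇒≱ (far p) (begin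
                sumSq (v p)                 ≡⟨ isometry (v p) (fixed-v p) ⟨
                sumSq (Q *ᵥ v p)            ≤⟨ ≤-via _ (square-nonneg ((matrix ω *ᵥ v p) zero)) (+-comm _ _) ⟩
                sumSq (matrix ω *ᵥ v p)     ≡⟨ *-identityˡ _ ⟨
                1# * sumSq (matrix ω *ᵥ v p) ≤⟨ *-monoʳ-≤ (sumSq-nonneg (matrix ω *ᵥ v p)) (≤-trans (≤-reflexive (sym fromℕ-1)) (fromℕ-mono (ℕ.>-nonZero⁻¹ θ))) ⟩
                fromℕ θ * sumSq (matrix ω *ᵥ v p) ≤⟨ small ⟩
                η ∎) }))) (proj₁ 0<δ)
            where
              fixed-v : ∀ p l → gram Q (v p) l ≡ v p l
              fixed-v p l = begin-equality
                gram Q (v p) l ≡⟨ gram-cong Q (λ i → solve 3 (λ a t y → a :- t :* y := c# 1 :* a :+ (:- t) :* y) refl ((A *ᵥ u p) i) τ (y i)) l ⟩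
                gram Q (λ i → 1# * (A *ᵥ u p) i + - τ * y i) l ≡⟨ gram-linear Q (A *ᵥ u p) y 1# (- τ) l ⟩
                1# * gram Q (A *ᵥ u p) l + - τ * gram Q y l ≡⟨ cong₂ (λ a b → 1# * a + - τ * b) (gram-range (u p) l) (fixed l) ⟩
                1# * (A *ᵥ u p) l + - τ * y l ≡⟨ solve 3 (λ a t y → a :- t :* y := c# 1 :* a :+ (:- t) :* y) refl ((A *ᵥ u p) l) τ (y l) ⟨
                v p l ∎

-- The program

infix 5 accumulate[_]
accumulate[_] : ℕ → RealExp → Program
accumulate[ a ] e =
  mem[ lit a ]≔ nat (lit 0) ⨾
  reg[ 3 ]≔ lit 0 ⨾
  while (reg 3 ⊕ lit 1) ≤ⁿ param `q loop
    (mem[ lit a ]≔ mem (lit a) ⊞ e ⨾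
     reg[ 3 ]≔ reg 3 ⊕ lit 1)

-- Register 1 counts the greedy steps, 2 runs over columns, 3 over queries;
-- register 4 holds the selected column and register 5 the scale κ. Cell 0
-- holds ⟨Z , My⟩ (finally ‖Z‖²), cell 1 ⟨Z , M aᵢ⟩, cell 2 the selected
-- coefficient ±κ, and cell 3 + j the entry j of the residual Z.
selectColumn : Program
selectColumn =
  accumulate[ 1 ] (mem (lit 3 ⊕ reg 3) ⊠ `MA[ reg 3 , reg 2 ]) ⨾
  (if (nat (reg 5) ⊠ mem (lit 1)) ≤ʳ mem (lit 0)
   then (mem[ lit 2 ]≔ nat (reg 5) ⨾ reg[ 4 ]≔ reg 2)
   else (if ((nat (lit 0) ⊟ nat (reg 5)) ⊠ mem (lit 1)) ≤ʳ mem (lit 0)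
         then (mem[ lit 2 ]≔ nat (lit 0) ⊟ nat (reg 5) ⨾ reg[ 4 ]≔ reg 2)
         else skip)) ⨾
  reg[ 2 ]≔ reg 2 ⊕ lit 1

updateResidual : Program
updateResidual =
  mem[ lit 3 ⊕ reg 3 ]≔ mem (lit 3 ⊕ reg 3) ⊞ (mem (lit 2) ⊠ `MA[ reg 3 , reg 4 ] ⊟ `outcome[ reg 3 ]) ⨾
  reg[ 3 ]≔ reg 3 ⊕ lit 1

greedyStep : Program
greedyStep =
  accumulate[ 0 ] (mem (lit 3 ⊕ reg 3) ⊠ `outcome[ reg 3 ]) ⨾
  -- The default, column 0 with coefficient +κ, keeps every run a path even when no vertex
  -- qualifies. It relies on m > 0.
  mem[ lit 2 ]≔ nat (reg 5) ⨾
  reg[ 4 ]≔ lit 0 ⨾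
  reg[ 2 ]≔ lit 0 ⨾
  (while (reg 2 ⊕ lit 1) ≤ⁿ param `m loop selectColumn) ⨾
  reg[ 3 ]≔ lit 0 ⨾
  (while (reg 3 ⊕ lit 1) ≤ⁿ param `q loop updateResidual) ⨾
  reg[ 1 ]≔ reg 1 ⊕ lit 1

-- κ and T are found by counting upwards, since expressions contain no roots and no rounding. The
-- residual is the sum over the steps and not their average, hence the threshold (T ε)². Register 0
-- starts at 0, so rejection is the default.
greedyTester : ℕ → ℕ → Program
greedyTester c₀ θ =
  (while (nat (reg 5) ⊠ nat (reg 5)) ≤ʳ nat (param `k) loop (reg[ 5 ]≔ reg 5 ⊕ lit 1)) ⨾
  (while (nat (reg 1) ⊠ (`ε ⊠ `ε)) ≤ʳ (nat (lit c₀) ⊠ nat (param `k)) loop greedyStep) ⨾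
  accumulate[ 0 ] (mem (lit 3 ⊕ reg 3) ⊠ mem (lit 3 ⊕ reg 3)) ⨾
  -- The real test is `≤`; x² ≤ 0 expresses that the check outcome x vanishes.
  (if (`outcome[ lit 0 ] ⊠ `outcome[ lit 0 ]) ≤ʳ nat (lit 0)
   then (if (nat (lit θ) ⊠ mem (lit 0)) ≤ʳ (nat (reg 1) ⊠ `ε ⊠ (nat (reg 1) ⊠ `ε))
         then (reg[ 0 ]≔ lit 1)
         else skip)
   else skip)

update-same : ∀ {A : Set} (f : ℕ → A) i v → update f i v i ≡ v
update-same f i v with i ℕₚ.≟ i
... | yes _  = refl
... | no i≢i = ⊥-elim (i≢i refl)

update-other : ∀ {A : Set} (f : ℕ → A) {i j} v → i ≢ j → update f i v j ≡ f j
update-other f {i} {j} v i≢j with i ℕₚ.≟ j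
... | yes i≡j = ⊥-elim (i≢j i≡j)
... | no  _   = refl

-- A program logic for total correctness with time bounds

module Hoare (R : CompleteOrderedField) (I : Execution.Input R) where
  open OrderedField R
  open Completeness R
  open Execution R
  open Input I

  -- The time is bounded by τ instead of being equal to it, so that branches of different lengths
  -- can be joined.
  Run : Program → State → ℕ → (State → Set) → Set
  Run c s τ Q = ∃[ s′ ] ∃[ t ] (_,_⇓_in-time_ I c s s′ t) × t ℕ.≤ τ × Q s′

  run-weaken : ∀ {c s τ τ′ Q Q′} → τ ℕ.≤ τ′ → (∀ s′ → Q s′ → Q′ s′) → Run c s τ Q → Run c s τ′ Q′
  run-weaken τ≤τ′ QQ′ (s′ , t , run , t≤τ , q) = s′ , t , run , ℕₚ.≤-trans t≤τ τ≤τ′ , QQ′ s′ q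

  infixr 4 _⨾ᵣ_
  _⨾ᵣ_ : ∀ {c₁ c₂ s τ₁ τ₂ Q Q′} → Run c₁ s τ₁ Q → (∀ s′ → Q s′ → Run c₂ s′ τ₂ Q′) → Run (c₁ ⨾ c₂) s (τ₁ ℕ.+ τ₂) Q′
  (s′ , t₁ , run₁ , t₁≤ , q) ⨾ᵣ k with k s′ q
  ... | s″ , t₂ , run₂ , t₂≤ , q′ = s″ , _ , ⇓-seq run₁ run₂ , ℕₚ.+-mono-≤ t₁≤ t₂≤ , q′

  run-skip : ∀ {s} {Q : State → Set} → Q s → Run skip s 1 Q
  run-skip q = _ , _ , ⇓-skip , ℕₚ.≤-refl , q

  run-reg : ∀ {r e s} {Q : State → Set} → Q ⟨ update (registers s) r (⟦_⟧ⁿ I e s) , memory s ⟩ →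
            Run (reg[ r ]≔ e) s (1 ℕ.+ sizeⁿ e) Q
  run-reg q = _ , _ , ⇓-reg , ℕₚ.≤-refl , q

  run-mem : ∀ {a e s} {Q : State → Set} → Q ⟨ registers s , update (memory s) (⟦_⟧ⁿ I a s) (⟦_⟧ʳ I e s) ⟩ →
            Run (mem[ a ]≔ e) s (1 ℕ.+ sizeⁿ a ℕ.+ sizeʳ e) Q
  run-mem q = _ , _ , ⇓-mem , ℕₚ.≤-refl , q

  test? : ∀ b s → Dec (⟦_⟧ᵗ I b s)
  test? (e ≤ⁿ f) s = ⟦_⟧ⁿ I e s ℕₚ.≤? ⟦_⟧ⁿ I f s
  test? (e ≤ʳ f) s = ⟦_⟧ʳ I e s ≤? ⟦_⟧ʳ I f s

  run-if : ∀ {b c₁ c₂ s τ Q} → (⟦_⟧ᵗ I b s → Run c₁ s τ Q) → (¬ ⟦_⟧ᵗ I b s → Run c₂ s τ Q) →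
           Run (if b then c₁ else c₂) s (sizeᵗ b ℕ.+ τ) Q
  run-if {b} {s = s} then′ else′ with test? b s
  ... | yes true with then′ true
  ...   | s′ , t , run , t≤ , q = s′ , _ , ⇓-if-true true run , ℕₚ.+-monoʳ-≤ (sizeᵗ b) t≤ , q
  run-if {b} {s = s} then′ else′ | no false with else′ false
  ...   | s′ , t , run , t≤ , q = s′ , _ , ⇓-if-false false run , ℕₚ.+-monoʳ-≤ (sizeᵗ b) t≤ , q

  module _ {b c} (Inv : ℕ → State → Set) (N : ℕ) {τ : ℕ}
           (continue : ∀ i s → i ℕ.< N → Inv i s → ⟦_⟧ᵗ I b s)
           (stop : ∀ s → Inv N s → ¬ ⟦_⟧ᵗ I b s)
           (body : ∀ i s → i ℕ.< N → Inv i s → Run c s τ (Inv (suc i))) where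

    private
      run-from : ∀ r i s → r ℕ.+ i ≡ N → Inv i s → Run (while b loop c) s (r ℕ.* (sizeᵗ b ℕ.+ τ) ℕ.+ sizeᵗ b) (Inv N)
      run-from zero i s refl inv = s , _ , ⇓-while-false (stop s inv) , ℕₚ.≤-refl , inv
      run-from (suc r) i s eq inv with body i s i<N inv
        where i<N = ℕₚ.≤-trans (ℕ.s≤s (ℕₚ.m≤n+m i r)) (ℕₚ.≤-reflexive eq)
      ... | s₁ , t₁ , run₁ , t₁≤ , inv₁ with run-from r (suc i) s₁ (trans (ℕₚ.+-suc r i) eq) inv₁
      ...   | s₂ , t₂ , run₂ , t₂≤ , inv₂ = s₂ , _ , ⇓-while-true (continue i s i<N inv) run₁ run₂ ,
              ℕₚ.≤-trans (ℕₚ.+-mono-≤ (ℕₚ.+-monoʳ-≤ (sizeᵗ b) t₁≤) t₂≤)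
                (ℕₚ.≤-reflexive (sym (ℕₚ.+-assoc (sizeᵗ b ℕ.+ τ) (r ℕ.* (sizeᵗ b ℕ.+ τ)) (sizeᵗ b)))) , inv₂
        where i<N = ℕₚ.≤-trans (ℕ.s≤s (ℕₚ.m≤n+m i r)) (ℕₚ.≤-reflexive eq)

    -- The number N of iterations is known in advance and the invariant carries the iteration
    -- number, which yields termination and the time bound together.
    run-while : ∀ s → Inv 0 s → Run (while b loop c) s (N ℕ.* (sizeᵗ b ℕ.+ τ) ℕ.+ sizeᵗ b) (Inv N)
    run-while s = run-from N 0 s (ℕₚ.+-identityʳ N)

  -- Counting loops test reg r ⊕ lit 1 ≤ⁿ bound.
  below : ∀ {i n r} → r ≡ i → i ℕ.< n → r ℕ.+ 1 ℕ.≤ n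
  below {i} refl i<n = ℕₚ.≤-trans (ℕₚ.≤-reflexive (ℕₚ.+-comm i 1)) i<n

  not-below : ∀ {n r} → r ≡ n → ¬ (r ℕ.+ 1 ℕ.≤ n)
  not-below {n} refl n+1≤n = ℕₚ.<-irrefl refl (ℕₚ.≤-trans (ℕₚ.≤-reflexive (ℕₚ.+-comm 1 n)) n+1≤n)

  record Agree (a : ℕ) (s s′ : State) : Set where
    constructor agree
    field
      regs : ∀ r → r ≢ 3 → registers s′ r ≡ registers s r
      mems : ∀ b → b ≢ a → memory s′ b ≡ memory s b

  accumulateTime : RealExp → ℕ
  accumulateTime e = 4 ℕ.+ (2 ℕ.+ (q ℕ.* (5 ℕ.+ (5 ℕ.+ sizeʳ e ℕ.+ 4)) ℕ.+ 5))

  -- The summand is evaluated in all states that agree with s outside register 3 and cell a: it may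
  -- depend on the counter, but not on the running total.
  run-accumulate : ∀ a e (f : ℕ → ℝ) s → (∀ s′ → Agree a s s′ → ⟦_⟧ʳ I e s′ ≡ f (registers s′ 3)) →
                   Run (accumulate[ a ] e) s (accumulateTime e) (λ s′ → Agree a s s′ × memory s′ a ≡ sumℕ q f)
  run-accumulate a e f s ev =
    run-mem {Q = λ s₁ → (∀ r → registers s₁ r ≡ registers s r) × (∀ b → b ≢ a → memory s₁ b ≡ memory s b) × memory s₁ a ≡ 0#}
      ((λ _ → refl) , (λ b b≢a → update-other (memory s) _ (b≢a ∘ sym)) , update-same (memory s) a _) ⨾ᵣ
    λ s₁ (rs , ms , m0) →
    run-reg {Q = Inv 0} (agree (λ r r≢3 → trans (update-other (registers s₁) _ (r≢3 ∘ sym)) (rs r)) ms , refl , m0) ⨾ᵣ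
    λ s₂ inv₂ →
    run-weaken ℕₚ.≤-refl (λ { s′ (ag , _ , mq) → ag , mq })
      (run-while Inv q (λ i s′ i<q inv → below (proj₁ (proj₂ inv)) i<q) (λ s′ inv → not-below (proj₁ (proj₂ inv)))
        (λ i s′ i<q (ag , ri , mi) →
          run-mem {Q = λ s″ → Agree a s s″ × registers s″ 3 ≡ i × memory s″ a ≡ sumℕ (suc i) f}
            (agree (Agree.regs ag) (λ b b≢a → trans (update-other (memory s′) _ (b≢a ∘ sym)) (Agree.mems ag b b≢a)) , ri ,
             trans (update-same (memory s′) a _) (cong₂ _+_ mi (trans (ev s′ ag) (cong f ri)))) ⨾ᵣ
          λ s″ (ag″ , ri″ , mi″) →
          run-reg {Q = Inv (suc i)}
            (agree (λ r r≢3 → trans (update-other (registers s″) _ (r≢3 ∘ sym)) (Agree.regs ag″ r r≢3)) (Agree.mems ag″) ,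
             trans (cong (ℕ._+ 1) ri″) (ℕₚ.+-comm i 1) , mi″))
        s₂ inv₂)
    where
      Inv : ℕ → State → Set
      Inv i s′ = Agree a s s′ × registers s′ 3 ≡ i × memory s′ a ≡ sumℕ i f

-- Greedy paths and verification of the program

module GreedyPaths (R : CompleteOrderedField) (κ : ℕ) where
  open OrderedField R

  coef : Fin 2 → ℝ
  coef zero    = fromℕ κ
  coef (suc _) = 0# - fromℕ κ

  -- Depends on the path and κ alone, not on an input: the union bound needs candidate vectors that
  -- are fixed before the query matrix is drawn.
  combination : ∀ {m t} → Vec (Fin 2 × Fin m) t → Fin m → ℝ
  combination [] l = 0#
  combination ((σ , i) ∷ p) l with l Finₚ.≟ i
  ... | yes _ = combination p l + coef σ
  ... | no  _ = combination p l

module GreedyTester (R : CompleteOrderedField) (I : Execution.Input R) (κ : ℕ) where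
  open OrderedField R
  open Completeness R
  open LinearAlgebra R using (_*ₘ_)
  open Execution R
  open Input I
  open Hoare R I
  open GreedyPaths R κ public

  y : ℕ → ℝ
  y = entry outcomes

  col : ℕ → ℕ → ℝ
  col i j = entry₂ (M *ₘ A) j i

  ip : (ℕ → ℝ) → (ℕ → ℝ) → ℝ
  ip f g = sumℕ q (λ j → f j * g j)

  -- The sketched vertex ±κ φᵢ minus the outcomes has inner product at most 0 with the residual Z.
  Admissible : (ℕ → ℝ) → Fin 2 → ℕ → Set
  Admissible Z σ i = coef σ * ip Z (col i) ≤ ip Z y

  -- Conditional, because for a general y no vertex need be admissible; the program then falls back
  -- on its default.
  GreedyChoice : (ℕ → ℝ) → Fin 2 → Fin m → Set
  GreedyChoice Z σ i = (∃[ σ′ ] ∃[ i′ ] Admissible Z σ′ (toℕ {m} i′)) → Admissible Z σ (toℕ i)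

  residual : ∀ {t} → Vec (Fin 2 × Fin m) t → ℕ → ℝ
  residual []            j = 0#
  residual ((σ , i) ∷ p) j = residual p j + (coef σ * col (toℕ i) j - y j)

  Greedy : ∀ {t} → Vec (Fin 2 × Fin m) t → Set
  Greedy []            = ⊤
  Greedy ((σ , i) ∷ p) = GreedyChoice (residual p) σ i × Greedy p

  cells : State → ℕ → ℝ
  cells s j = memory s (3 ℕ.+ j)

  sumℕ-cong : ∀ n {f g} → (∀ i → i ℕ.< n → f i ≡ g i) → sumℕ n f ≡ sumℕ n g
  sumℕ-cong zero    eq = refl
  sumℕ-cong (suc n) eq = cong₂ _+_ (sumℕ-cong n (λ i i<n → eq i (ℕₚ.m<n⇒m<1+n i<n))) (eq n ℕₚ.≤-refl)

  ip-cong : ∀ {f f′} g → (∀ j → j ℕ.< q → f j ≡ f′ j) → ip f g ≡ ip f′ g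
  ip-cong g eq = sumℕ-cong q (λ j j<q → cong (_* g j) (eq j j<q))

  record Base (s₀ s : State) : Set where
    constructor base
    field
      reg0 : registers s 0 ≡ registers s₀ 0
      reg1 : registers s 1 ≡ registers s₀ 1
      reg5 : registers s 5 ≡ registers s₀ 5

  SameCells : State → State → Set
  SameCells s₀ s = ∀ j → cells s j ≡ cells s₀ j

  Selected : (ℕ → ℝ) → ℕ → State → Set
  Selected Z i s = ∃[ σ ] ∃[ l ] (memory s 2 ≡ coef σ × registers s 4 ≡ toℕ {m} l ×
                   (Admissible Z σ (toℕ l) ⊎ (∀ σ′ i′ → i′ ℕ.< i → ¬ Admissible Z σ′ i′)))


  selectTime : ℕ
  selectTime = accumulateTime (mem (lit 3 ⊕ reg 3) ⊠ `MA[ reg 3 , reg 2 ]) ℕ.+ (8 ℕ.+ (11 ℕ.+ 9) ℕ.+ 4)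

  module _ (s₀ : State) (κ≡ : registers s₀ 5 ≡ κ) where
    private
      Z : ℕ → ℝ
      Z = cells s₀

    SelectInv : ℕ → State → Set
    SelectInv i s = (Base s₀ s × SameCells s₀ s) × registers s 2 ≡ i × memory s 0 ≡ ip Z y × Selected Z i s

    run-selectColumn : ∀ i s → i ℕ.< m → SelectInv i s → Run selectColumn s selectTime (SelectInv (suc i))
    run-selectColumn i s i<m ((base r0 r1 r5 , same) , r2 , m0 , selected) =
      run-accumulate 1 _ (λ j → Z j * col i j) s (λ s′ ag → cong₂ _*_
          (trans (Agree.mems ag (3 ℕ.+ registers s′ 3) (λ ())) (same (registers s′ 3)))
          (cong (entry₂ (M *ₘ A) (registers s′ 3)) (trans (Agree.regs ag 2 (λ ())) r2))) ⨾ᵣ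
       λ s₁ (ag , m1) →
       let b0 = trans (Agree.regs ag 0 (λ ())) r0
           b1 = trans (Agree.regs ag 1 (λ ())) r1
           b5 = trans (Agree.regs ag 5 (λ ())) r5
           same₁ : SameCells s₀ s₁
           same₁ j = trans (Agree.mems ag (3 ℕ.+ j) (λ ())) (same j)
           r2₁ = trans (Agree.regs ag 2 (λ ())) r2
           m0₁ = trans (Agree.mems ag 0 (λ ())) m0
           κ₁ : fromℕ (registers s₁ 5) ≡ fromℕ κ
           κ₁ = cong fromℕ (trans b5 κ≡)
           good : ∀ {x} σ → x ≡ coef σ → x * memory s₁ 1 ≤ memory s₁ 0 → Admissible Z σ i
           good σ x≡ le = subst₂ _≤_ (cong₂ _*_ x≡ m1) m0₁ le
           chosen : ∀ σ → Admissible Z σ i → Admissible Z σ (toℕ (fromℕ< i<m))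
           chosen σ = subst (Admissible Z σ) (sym (Finₚ.toℕ-fromℕ< i<m))
       in
       run-if {Q = λ s₂ → (Base s₀ s₂ × SameCells s₀ s₂) × registers s₂ 2 ≡ i × memory s₂ 0 ≡ ip Z y × Selected Z (suc i) s₂}
         (λ true → run-weaken (ℕₚ.m≤m+n 6 14) (λ _ Q → Q)
           (run-mem {Q = λ s₂ → (Base s₀ s₂ × SameCells s₀ s₂) × registers s₂ 2 ≡ i × memory s₂ 0 ≡ ip Z y × memory s₂ 2 ≡ coef zero}
             ((base b0 b1 b5 , same₁) , r2₁ , m0₁ , κ₁) ⨾ᵣ
           λ s₂ ((base r0 r1 r5 , same) , r2 , m0 , m2) →
           run-reg ((base r0 r1 r5 , same) , r2 , m0 ,
             zero , fromℕ< i<m , m2 , trans r2 (sym (Finₚ.toℕ-fromℕ< i<m)) , inj₁ (chosen zero (good zero κ₁ true)))))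
         (λ false → run-if
           (λ true →
             run-mem {Q = λ s₂ → (Base s₀ s₂ × SameCells s₀ s₂) × registers s₂ 2 ≡ i × memory s₂ 0 ≡ ip Z y × memory s₂ 2 ≡ coef (suc zero)}
               ((base b0 b1 b5 , same₁) , r2₁ , m0₁ , cong (λ x → 0# - x) κ₁) ⨾ᵣ
             λ s₂ ((base r0 r1 r5 , same) , r2 , m0 , m2) →
             run-reg ((base r0 r1 r5 , same) , r2 , m0 ,
               suc zero , fromℕ< i<m , m2 , trans r2 (sym (Finₚ.toℕ-fromℕ< i<m)) , inj₁ (chosen (suc zero) (good (suc zero) (cong (λ x → 0# - x) κ₁) true))))
           (λ false′ → run-weaken (ℕₚ.m≤m+n 1 _) (λ _ Q → Q) (run-skip ((base b0 b1 b5 , same₁) , r2₁ , m0₁ , keep selected s₁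
             (trans (Agree.mems ag 2 (λ ())) refl) (Agree.regs ag 4 (λ ()))
             (λ { zero → λ adm → false (subst₂ _≤_ (sym (cong₂ _*_ κ₁ m1)) (sym m0₁) adm)
                ; (suc zero) → λ adm → false′ (subst₂ _≤_ (sym (cong₂ _*_ (cong (λ x → 0# - x) κ₁) m1)) (sym m0₁) adm) }))))) ⨾ᵣ
       λ s₂ ((base r0 r1 r5 , same) , r2 , m0 , sel) →
       run-reg ((base r0 r1 r5 , same) , trans (cong (ℕ._+ 1) r2) (ℕₚ.+-comm i 1) , m0 , sel)
      where
        keep : Selected Z i s → ∀ s₁ → memory s₁ 2 ≡ memory s 2 → registers s₁ 4 ≡ registers s 4 →
               (∀ σ → ¬ Admissible Z σ i) → Selected Z (suc i) s₁
        keep (σ , l , m2 , r4 , inj₁ adm)  s₁ m2₁ r4₁ none = σ , l , trans m2₁ m2 , trans r4₁ r4 , inj₁ adm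
        keep (σ , l , m2 , r4 , inj₂ none) s₁ m2₁ r4₁ none-i = σ , l , trans m2₁ m2 , trans r4₁ r4 , inj₂ λ σ′ i′ i′<1+i adm →
          none-below i′ i′<1+i σ′ adm
          where
            none-below : ∀ i′ → i′ ℕ.< suc i → ∀ σ′ → ¬ Admissible Z σ′ i′
            none-below i′ i′<1+i σ′ with i′ ℕₚ.≟ i
            ... | yes refl = none-i σ′
            ... | no i′≢i  = none σ′ i′ (ℕₚ.≤∧≢⇒< (ℕₚ.≤-pred i′<1+i) i′≢i)

  selected⇒greedyChoice : ∀ Z s → Selected Z m s → ∃[ σ ] ∃[ l ] (memory s 2 ≡ coef σ × registers s 4 ≡ toℕ l × GreedyChoice Z σ l)
  selected⇒greedyChoice Z s (σ , l , m2 , r4 , inj₁ adm)  = σ , l , m2 , r4 , λ _ → adm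
  selected⇒greedyChoice Z s (σ , l , m2 , r4 , inj₂ none) = σ , l , m2 , r4 , λ (σ′ , i′ , adm) → ⊥-elim (none σ′ (toℕ i′) (Finₚ.toℕ<n i′) adm)

  module _ (s₀ : State) where
    UpdateInv : ℕ → State → Set
    UpdateInv j s = (Base s₀ s × memory s 2 ≡ memory s₀ 2 × registers s 4 ≡ registers s₀ 4) × registers s 3 ≡ j ×
      (∀ i → i ℕ.< j → cells s i ≡ cells s₀ i + (memory s₀ 2 * col (registers s₀ 4) i - y i)) ×
      (∀ i → j ℕ.≤ i → cells s i ≡ cells s₀ i)

    run-updateResidual : ∀ j s → j ℕ.< q → UpdateInv j s → Run updateResidual s 22 (UpdateInv (suc j))
    run-updateResidual j s j<q ((base r0 r1 r5 , m2 , r4) , refl , done , todo) =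
      run-mem {Q = λ s₁ → (Base s₀ s₁ × memory s₁ 2 ≡ memory s₀ 2 × registers s₁ 4 ≡ registers s₀ 4) × registers s₁ 3 ≡ j ×
        (∀ i → i ℕ.< suc j → cells s₁ i ≡ cells s₀ i + (memory s₀ 2 * col (registers s₀ 4) i - y i)) ×
        (∀ i → suc j ℕ.≤ i → cells s₁ i ≡ cells s₀ i)}
        ((base r0 r1 r5 , trans (update-other (memory s) {3 ℕ.+ j} {2} new (λ ())) m2 , r4) , refl , done′ , (λ i j<i →
          trans (update-other (memory s) {3 ℕ.+ j} {3 ℕ.+ i} _ (λ eq → ℕₚ.<⇒≢ j<i (ℕₚ.+-cancelˡ-≡ 3 j i eq))) (todo i (ℕₚ.<⇒≤ j<i)))) ⨾ᵣ
      λ s₁ ((base r0 r1 r5 , m2 , r4) , r3 , done , todo) →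
      run-reg ((base r0 r1 r5 , m2 , r4) , trans (cong (ℕ._+ 1) r3) (ℕₚ.+-comm j 1) , done , todo)
      where
        new : ℝ
        new = cells s j + (memory s 2 * col (registers s 4) j - y j)
        done′ : ∀ i → i ℕ.< suc j → update (memory s) (3 ℕ.+ j) new (3 ℕ.+ i) ≡ cells s₀ i + (memory s₀ 2 * col (registers s₀ 4) i - y i)
        done′ i i<1+j with i ℕₚ.≟ j
        ... | yes refl = trans (update-same (memory s) (3 ℕ.+ j) new) (cong₂ _+_ (todo j ℕₚ.≤-refl)
                (cong (_- y j) (cong₂ (λ x l → x * col l j) m2 r4)))
        ... | no i≢j   = trans (update-other (memory s) {3 ℕ.+ j} {3 ℕ.+ i} new (λ eq → i≢j (sym (ℕₚ.+-cancelˡ-≡ 3 j i eq))))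
                (done i (ℕₚ.≤∧≢⇒< (ℕₚ.≤-pred i<1+j) i≢j))

  -- The program stores only the residual; the path that explains it exists in the invariant alone.
  MainInv : ℕ → State → Set
  MainInv t s = registers s 0 ≡ 0 × registers s 1 ≡ t × registers s 5 ≡ κ ×
    Σ[ p ∈ Vec (Fin 2 × Fin m) t ] ((∀ j → j ℕ.< q → cells s j ≡ residual p j) × Greedy p)

  stepTime : ℕ
  stepTime = accumulateTime (mem (lit 3 ⊕ reg 3) ⊠ `outcome[ reg 3 ]) ℕ.+ (4 ℕ.+ (2 ℕ.+ (2 ℕ.+
    (m ℕ.* (5 ℕ.+ selectTime) ℕ.+ 5 ℕ.+ (2 ℕ.+ (q ℕ.* (5 ℕ.+ 22) ℕ.+ 5 ℕ.+ 4))))))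

  run-greedyStep : .{{NonZero m}} → ∀ t s → MainInv t s → Run greedyStep s stepTime (MainInv (suc t))
  run-greedyStep t s (r0 , r1 , r5 , p , Z≡ , greedy) =
    run-accumulate 0 _ (λ j → Z j * y j) s (λ s′ ag → cong (_* y (registers s′ 3)) (Agree.mems ag (3 ℕ.+ registers s′ 3) (λ ()))) ⨾ᵣ
    λ s₁ (ag , m0) →
    run-mem {Q = λ s₂ → (Base s s₂ × SameCells s s₂) × memory s₂ 0 ≡ ip Z y × memory s₂ 2 ≡ coef zero}
      ((base (Agree.regs ag 0 (λ ())) (Agree.regs ag 1 (λ ())) (Agree.regs ag 5 (λ ())) , (λ j → Agree.mems ag (3 ℕ.+ j) (λ ()))) , m0 ,
       cong fromℕ (trans (Agree.regs ag 5 (λ ())) r5)) ⨾ᵣ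
    λ s₂ ((base b0 b1 b5 , same) , m0 , m2) →
    run-reg {Q = λ s₃ → (Base s s₃ × SameCells s s₃) × memory s₃ 0 ≡ ip Z y × memory s₃ 2 ≡ coef zero × registers s₃ 4 ≡ 0}
      ((base b0 b1 b5 , same) , m0 , m2 , refl) ⨾ᵣ
    λ s₃ ((base b0 b1 b5 , same) , m0 , m2 , r4) →
    run-reg {Q = SelectInv s r5 0}
      ((base b0 b1 b5 , same) , refl , m0 , zero , fromℕ< 0<m , m2 , trans r4 (sym (Finₚ.toℕ-fromℕ< 0<m)) , inj₂ (λ _ _ ())) ⨾ᵣ
    λ s₄ inv₄ →
    run-while (SelectInv s r5) m (λ i s′ i<m inv → below (proj₁ (proj₂ inv)) i<m) (λ s′ inv → not-below (proj₁ (proj₂ inv)))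
      (run-selectColumn s r5) s₄ inv₄ ⨾ᵣ
    λ s₅ ((b₅ , same₅) , _ , _ , selected) →
    let σ , l , m2 , r4 , choice = selected⇒greedyChoice Z s₅ selected in
    run-reg {Q = λ s₆ → UpdateInv s₅ 0 s₆}
      ((base refl refl refl , refl , refl) , refl , (λ _ ()) , (λ _ _ → refl)) ⨾ᵣ
    λ s₆ inv₆ →
    run-while (UpdateInv s₅) q (λ j s′ j<q inv → below (proj₁ (proj₂ inv)) j<q) (λ s′ inv → not-below (proj₁ (proj₂ inv)))
      (run-updateResidual s₅) s₆ inv₆ ⨾ᵣ
    λ s₇ ((base c0 c1 c5 , _) , _ , done , _) →
    run-reg (trans c0 (trans (Base.reg0 b₅) r0) , trans (cong (ℕ._+ 1) (trans c1 (trans (Base.reg1 b₅) r1))) (ℕₚ.+-comm t 1) ,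
      trans c5 (trans (Base.reg5 b₅) r5) , (σ , l) ∷ p ,
      (λ j j<q → trans (done j j<q) (cong₂ _+_ (trans (same₅ j) (Z≡ j j<q)) (cong (_- y j) (cong₂ (λ x i → x * col i j) m2 r4)))) ,
      (λ (σ′ , i′ , adm) → subst₂ _≤_ (cong (coef σ *_) (ip-cong (col (toℕ l)) Z≡)) (ip-cong y Z≡)
         (choice (σ′ , i′ , subst₂ _≤_ (cong (coef σ′ *_) (sym (ip-cong (col (toℕ i′)) Z≡))) (sym (ip-cong y Z≡)) adm))) , greedy)
    where
      Z : ℕ → ℝ
      Z = cells s
      0<m : 0 ℕ.< m
      0<m = ℕ.>-nonZero⁻¹ m

  Verdict : Set → State → Set
  Verdict P s = (P × registers s 0 ≡ 1) ⊎ (¬ P × registers s 0 ≡ 0)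

  Passes : ℕ → ℕ → (ℕ → ℝ) → Set
  Passes θ T Z = y 0 * y 0 ≤ 0# × fromℕ θ * ip Z Z ≤ fromℕ T * ε * (fromℕ T * ε)

  testerTime : ℕ → ℕ
  testerTime T = κ ℕ.* (8 ℕ.+ 4) ℕ.+ 8 ℕ.+ (T ℕ.* (12 ℕ.+ stepTime) ℕ.+ 12 ℕ.+
    (accumulateTime (mem (lit 3 ⊕ reg 3) ⊠ mem (lit 3 ⊕ reg 3)) ℕ.+ (8 ℕ.+ (15 ℕ.+ 2))))

  module _ .{{m≢0 : NonZero m}} (c₀ θ T : ℕ)
           (κ-least : ∀ i → i ℕ.< κ → fromℕ i * fromℕ i ≤ fromℕ k) (κ-large : ¬ (fromℕ κ * fromℕ κ ≤ fromℕ k))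
           (T-least : ∀ t → t ℕ.< T → fromℕ t * (ε * ε) ≤ fromℕ c₀ * fromℕ k) (T-large : ¬ (fromℕ T * (ε * ε) ≤ fromℕ c₀ * fromℕ k)) where

    run-greedyTester : Run (greedyTester c₀ θ) initial (testerTime T)
      (λ s → Σ[ p ∈ Vec (Fin 2 × Fin m) T ] (Greedy p × Verdict (Passes θ T (residual p)) s))
    run-greedyTester =
      run-while (λ i s → registers s 0 ≡ 0 × registers s 1 ≡ 0 × registers s 5 ≡ i × (∀ j → cells s j ≡ 0#)) κ
        (λ { i s i<κ (_ , _ , refl , _) → κ-least i i<κ })
        (λ { s (_ , _ , refl , _) → κ-large })
        (λ { i s i<κ (r0 , r1 , refl , z) → run-reg (r0 , r1 , ℕₚ.+-comm i 1 , z) })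
        initial (refl , refl , refl , λ _ → refl) ⨾ᵣ
      λ s₁ (r0 , r1 , r5 , z) →
      run-while MainInv T
        (λ { t s t<T (_ , refl , _) → T-least t t<T })
        (λ { s (_ , refl , _) → T-large })
        (λ t s t<T inv → run-greedyStep t s inv)
        s₁ (r0 , r1 , r5 , [] , (λ j _ → z j) , tt) ⨾ᵣ
      λ s₂ (r0 , r1 , r5 , p , Z≡ , greedy) →
      run-accumulate 0 _ (λ j → cells s₂ j * cells s₂ j) s₂ (λ s′ ag →
        let eq = Agree.mems ag (3 ℕ.+ registers s′ 3) (λ ()) in cong₂ _*_ eq eq) ⨾ᵣ
      λ s₃ (ag , m0) →
      let r0′ = trans (Agree.regs ag 0 (λ ())) r0
          r1′ = cong (λ t → fromℕ t * ε * (fromℕ t * ε)) (trans (Agree.regs ag 1 (λ ())) r1)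
          norm : fromℕ θ * memory s₃ 0 ≡ fromℕ θ * ip (residual p) (residual p)
          norm = cong (fromℕ θ *_) (trans m0 (sumℕ-cong q (λ j j<q → cong (λ x → x * x) (Z≡ j j<q))))
      in
      run-weaken ℕₚ.≤-refl (λ s v → p , greedy , v)
        (run-if
          (λ zero-check → run-if
            (λ small → run-reg (inj₁ ((zero-check , subst₂ _≤_ norm r1′ small) , refl)))
            (λ large → run-weaken (ℕₚ.m≤m+n 1 1) (λ _ Q → Q) (run-skip (inj₂ ((λ (_ , small) → large (subst₂ _≤_ (sym norm) (sym r1′) small)) , r0′)))))
          (λ nonzero → run-weaken (ℕₚ.m≤m+n 1 16) (λ _ Q → Q) (run-skip (inj₂ ((λ (zero-check , _) → nonzero zero-check) , r0′)))))

-- Norms, supports and Cauchy-Schwarz for sparse vectors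

module Support (R : CompleteOrderedField) where
  open OrderedField R
  open Completeness R
  open Sums R
  open LinearAlgebra R
  open InnerProduct R
  open ≤-Reasoning

  private
    sum-squares : ∀ {d} (v : Vector ℝ d) → sum (λ i → v i ^ 2) ≡ ⟨ v , v ⟩
    sum-squares v = sum-cong-≗ (λ i → square (v i))

    ⟨⟩-nonneg : ∀ {d} (v : Vector ℝ d) → 0# ≤ ⟨ v , v ⟩
    ⟨⟩-nonneg v = sum-nonneg (λ i → square-nonneg (v i))

  ‖‖₂-square : ∀ {d} (v : Vector ℝ d) → ‖ v ‖₂ * ‖ v ‖₂ ≡ ⟨ v , v ⟩
  ‖‖₂-square v = trans (√-square (subst (0# ≤_) (sym (sum-squares v)) (⟨⟩-nonneg v))) (sum-squares v)

  ‖‖₂≡1 : ∀ {d} (v : Vector ℝ d) → ‖ v ‖₂ ≡ 1# → ⟨ v , v ⟩ ≡ 1#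
  ‖‖₂≡1 v eq = trans (sym (‖‖₂-square v)) (trans (cong₂ _*_ eq eq) (*-identityʳ 1#))

  <‖‖₂ : ∀ {d} (v : Vector ℝ d) {ε} → 0# ≤ ε → ε < ‖ v ‖₂ → ε * ε < ⟨ v , v ⟩
  <‖‖₂ v {ε} 0≤ε ε<v = ≰⇒< λ vv≤εε → <⇒≱ ε<v (square-cancel-≤ 0≤ε (≤-trans (≤-reflexive (‖‖₂-square v)) vv≤εε))

  nonzero# : ℝ → ℕ
  nonzero# x with x ≟ 0#
  ... | yes _ = 0
  ... | no  _ = 1

  count : ∀ {n} → Vector ℝ n → ℕ
  count {zero}  x = 0
  count {suc n} x = nonzero# (x zero) ℕ.+ count (x ∘ suc)

  ‖‖₀≡count : ∀ {n} (x : Vector ℝ n) → ‖ x ‖₀ ≡ count x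
  ‖‖₀≡count x = go {x = x} id
    where
      go : ∀ {n k} {x : Vector ℝ k} (f : Fin n → Fin k) →
           length (filter (λ i → ¬? (x i ≟ 0#)) (List.tabulate f)) ≡ count (x ∘ f)
      go {zero}  f = refl
      go {suc n} {x = x} f with x (f zero) ≟ 0#
      ... | yes _ = go (f ∘ suc)
      ... | no  _ = cong suc (go (f ∘ suc))

  count-cong : ∀ {n} {x x′ : Vector ℝ n} → (∀ i → x′ i ≡ x i) → count x′ ≡ count x
  count-cong {zero}  eq = refl
  count-cong {suc n} eq = cong₂ ℕ._+_ (cong nonzero# (eq zero)) (count-cong (eq ∘ suc))

  nonzero#≤1 : ∀ x → nonzero# x ℕ.≤ 1
  nonzero#≤1 x with x ≟ 0#
  ... | yes _ = ℕ.z≤n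
  ... | no  _ = ℕₚ.≤-refl

  count-change : ∀ {n} {x x′ : Vector ℝ n} i → (∀ l → l ≢ i → x′ l ≡ x l) → count x′ ℕ.≤ suc (count x)
  count-change {suc n} {x} {x′} zero eq = ℕₚ.+-mono-≤ (nonzero#≤1 (x′ zero))
    (ℕₚ.≤-trans (ℕₚ.≤-reflexive (count-cong (λ l → eq (suc l) (λ ())))) (ℕₚ.m≤n+m (count (x ∘ suc)) (nonzero# (x zero))))
  count-change {suc n} {x} {x′} (suc i) eq = ℕₚ.≤-trans
    (ℕₚ.+-mono-≤ (ℕₚ.≤-reflexive (cong nonzero# (eq zero (λ ())))) (count-change i (λ l l≢i → eq (suc l) (l≢i ∘ Finₚ.suc-injective))))
    (ℕₚ.≤-reflexive (ℕₚ.+-suc (nonzero# (x zero)) (count (x ∘ suc))))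

  count-scale : ∀ {n} c (x : Vector ℝ n) → count (λ i → c * x i) ℕ.≤ count x
  count-scale {zero}  c x = ℕ.z≤n
  count-scale {suc n} c x = ℕₚ.+-mono-≤ head (count-scale c (x ∘ suc))
    where
      head : nonzero# (c * x zero) ℕ.≤ nonzero# (x zero)
      head with c * x zero ≟ 0# | x zero ≟ 0#
      ... | yes _   | _       = ℕ.z≤n
      ... | no cx≢0 | yes x≡0 = ⊥-elim (cx≢0 (trans (cong (c *_) x≡0) (zeroʳ c)))
      ... | no _    | no _    = ℕₚ.≤-refl

  count-zero : ∀ n → count {n} (const 0#) ≡ 0
  count-zero zero = refl
  count-zero (suc n) with 0# ≟ 0#
  ... | yes _  = count-zero n
  ... | no 0≢0 = ⊥-elim (0≢0 refl)

  χ : ℝ → ℝ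
  χ x = fromℕ (nonzero# x)

  suppSum : ∀ {n} → Vector ℝ n → Vector ℝ n → ℝ
  suppSum x f = sum (λ i → χ (x i) * f i)

  suppSum-≤ : ∀ {n} (x f : Vector ℝ n) {b} → (∀ i → f i ≤ b) → suppSum x f ≤ fromℕ (count x) * b
  suppSum-≤ {zero}  x f {b} f≤b = ≤-reflexive (sym (zeroˡ b))
  suppSum-≤ {suc n} x f {b} f≤b = begin
    χ (x zero) * f zero + suppSum (x ∘ suc) (f ∘ suc)  ≤⟨ +-mono-≤ (*-monoˡ-≤ (fromℕ-nonneg (nonzero# (x zero))) (f≤b zero)) (suppSum-≤ (x ∘ suc) (f ∘ suc) (f≤b ∘ suc)) ⟩
    χ (x zero) * b + fromℕ (count (x ∘ suc)) * b       ≡⟨ distribʳ b _ _ ⟨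
    (χ (x zero) + fromℕ (count (x ∘ suc))) * b         ≡⟨ cong (_* b) (fromℕ-+ (nonzero# (x zero)) (count (x ∘ suc))) ⟨
    fromℕ (count x) * b                                ∎

  χ-absorb : ∀ x → x * χ x ≡ x
  χ-absorb x with x ≟ 0#
  ... | yes x≡0 = trans (zeroʳ x) (sym x≡0)
  ... | no _    = trans (cong (x *_) fromℕ-1) (*-identityʳ x)

  χ-idem : ∀ x → χ x * χ x ≡ χ x
  χ-idem x with x ≟ 0#
  ... | yes _ = zeroˡ 0#
  ... | no _  = trans (cong₂ _*_ fromℕ-1 fromℕ-1) (trans (*-identityʳ 1#) (sym fromℕ-1))

  -- Cauchy–Schwarz restricted to the support of x: expand ‖c′ - ⟨x,c⟩ x‖² ≥ 0,
  -- where c′ is c cut down to the support.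
  supp-cauchy : ∀ {n} (x c : Vector ℝ n) → ⟨ x , x ⟩ ≡ 1# → ⟨ x , c ⟩ * ⟨ x , c ⟩ ≤ suppSum x (λ i → c i * c i)
  supp-cauchy x c xx≡1 = ≤-via ⟨ e , e ⟩ (⟨⟩-nonneg e) (begin-equality
      suppSum x (λ i → c i * c i)               ≡⟨ sum-cong-≗ (λ i → trans (cong (_* (c i * c i)) (sym (χ-idem (x i)))) (solve 2 (λ h c → h :* h :* (c :* c) := h :* c :* (h :* c)) refl (χ (x i)) (c i))) ⟩
      ⟨ c′ , c′ ⟩                               ≡⟨ solve 2 (λ w C → C := w :* w :+ (C :- w :* w :- w :* (w :- w :* c# 1))) refl w ⟨ c′ , c′ ⟩ ⟩
      w * w + (⟨ c′ , c′ ⟩ - w * w - w * (w - w * 1#)) ≡⟨ cong (w * w +_) (sym ee) ⟩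
      w * w + ⟨ e , e ⟩                         ∎)
    where
      w = ⟨ x , c ⟩
      c′ e : Vector ℝ _
      c′ i = χ (x i) * c i
      e = c′ -ᵥ (λ i → w * x i)
      xc′ : ⟨ x , c′ ⟩ ≡ w
      xc′ = sum-cong-≗ (λ i → trans (sym (*-assoc (x i) _ _)) (cong (_* c i) (χ-absorb (x i))))
      e· : ∀ v → ⟨ v , e ⟩ ≡ ⟨ v , c′ ⟩ - w * ⟨ v , x ⟩
      e· v = trans (⟨⟩-subʳ v c′ (λ i → w * x i)) (cong (λ y → ⟨ v , c′ ⟩ - y) (⟨⟩-scaleʳ v x w))
      ee : ⟨ e , e ⟩ ≡ ⟨ c′ , c′ ⟩ - w * w - w * (w - w * 1#)
      ee = begin-equality
        ⟨ e , e ⟩                       ≡⟨ e· e ⟩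
        ⟨ e , c′ ⟩ - w * ⟨ e , x ⟩      ≡⟨ cong₂ (λ a b → a - w * b) (trans (⟨⟩-comm e c′) (e· c′)) (trans (⟨⟩-comm e x) (e· x)) ⟩
        ⟨ c′ , c′ ⟩ - w * ⟨ c′ , x ⟩ - w * (⟨ x , c′ ⟩ - w * ⟨ x , x ⟩) ≡⟨ cong₂ (λ a b → ⟨ c′ , c′ ⟩ - w * a - w * b) (trans (⟨⟩-comm c′ x) xc′) (cong₂ (λ a b → a - w * b) xc′ xx≡1) ⟩
        ⟨ c′ , c′ ⟩ - w * w - w * (w - w * 1#) ∎


-- Analysis of the greedy steps

module GreedyAnalysis (R : CompleteOrderedField) {d m q : ℕ} (k : ℕ) (ε δ : CompleteOrderedField.ℝ R)
                      (A : LinearAlgebra.Matrix R d m) (M : LinearAlgebra.Matrix R q d)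
                      (z : Vector (CompleteOrderedField.ℝ R) d) (κ : ℕ) where
  open OrderedField R
  open Completeness R
  open Sums R
  open LinearAlgebra R
  open InnerProduct R
  open Support R
  open Execution R using (Input; entry; entry₂)
  open ≤-Reasoning

  input : Input
  input = record { d = d ; m = m ; k = k ; q = q ; ε = ε ; δ = δ ; A = A ; M = M ; outcomes = M *ᵥ z }

  open GreedyTester R input κ

  φ : Fin m → Vector ℝ q
  φ i = M *ᵥ column A i

  entry-toℕ : ∀ {n} (v : Vector ℝ n) j → entry v (toℕ j) ≡ v j
  entry-toℕ {n} v j with toℕ j ℕₚ.<? n
  ... | yes j<n = cong v (Finₚ.fromℕ<-toℕ j j<n)
  ... | no  j≮n = ⊥-elim (j≮n (Finₚ.toℕ<n j))

  y-toℕ : ∀ j → y (toℕ j) ≡ (M *ᵥ z) j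
  y-toℕ = entry-toℕ (M *ᵥ z)

  col-toℕ : ∀ i j → col (toℕ i) (toℕ j) ≡ φ i j
  col-toℕ i j = trans (entry-toℕ (λ j → entry ((M *ₘ A) j) (toℕ i)) j) (entry-toℕ ((M *ₘ A) j) i)

  ip-⟨⟩ : ∀ {f g : ℕ → ℝ} {u v : Vector ℝ q} → (∀ j → f (toℕ j) ≡ u j) → (∀ j → g (toℕ j) ≡ v j) → ip f g ≡ ⟨ u , v ⟩
  ip-⟨⟩ {f} {g} fu gv = trans (sym (sum≡sumℕ q (λ j → f j * g j))) (⟨⟩-cong fu gv)

  -- The residual in the original space, of which the program holds the sketch.
  vec : ∀ {t} → Vec (Fin 2 × Fin m) t → Vector ℝ d
  vec []            l = 0#
  vec ((σ , i) ∷ p) l = vec p l + (coef σ * A l i - z l)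

  *ᵥ-step : ∀ (r : Vector ℝ d) u v w c → ⟨ r , (λ l → u l + (c * v l - w l)) ⟩ ≡ ⟨ r , u ⟩ + (c * ⟨ r , v ⟩ - ⟨ r , w ⟩)
  *ᵥ-step r u v w c = begin-equality
    ⟨ r , (λ l → u l + (c * v l - w l)) ⟩ ≡⟨ ⟨⟩-cong {u = r} (λ _ → refl) (λ l → solve 4 (λ u c v w → u :+ (c :* v :- w) := c# 1 :* (c# 1 :* u :+ c :* v) :+ (:- c# 1) :* w) refl (u l) c (v l) (w l)) ⟩
    ⟨ r , (λ l → 1# * (1# * u l + c * v l) + - 1# * w l) ⟩ ≡⟨ ⟨⟩-linearʳ r (λ l → 1# * u l + c * v l) w 1# (- 1#) ⟩
    1# * ⟨ r , (λ l → 1# * u l + c * v l) ⟩ + - 1# * ⟨ r , w ⟩ ≡⟨ cong (λ x → 1# * x + - 1# * ⟨ r , w ⟩) (⟨⟩-linearʳ r u v 1# c) ⟩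
    1# * (1# * ⟨ r , u ⟩ + c * ⟨ r , v ⟩) + - 1# * ⟨ r , w ⟩ ≡⟨ solve 4 (λ u c v w → c# 1 :* (c# 1 :* u :+ c :* v) :+ (:- c# 1) :* w := u :+ (c :* v :- w)) refl ⟨ r , u ⟩ c ⟨ r , v ⟩ ⟨ r , w ⟩ ⟩
    ⟨ r , u ⟩ + (c * ⟨ r , v ⟩ - ⟨ r , w ⟩) ∎

  residual≡ : ∀ {t} (p : Vec (Fin 2 × Fin m) t) j → residual p (toℕ j) ≡ (M *ᵥ vec p) j
  residual≡ []            j = sym (trans (sum-cong-≗ (λ l → zeroʳ (M j l))) (sum-replicate-zero d))
  residual≡ ((σ , i) ∷ p) j = trans
    (cong₂ _+_ (residual≡ p j) (cong₂ (λ a b → coef σ * a - b) (col-toℕ i j) (y-toℕ j)))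
    (sym (*ᵥ-step (M j) (vec p) (column A i) z (coef σ)))

  combination-count : ∀ {t} (p : Vec (Fin 2 × Fin m) t) → count (combination p) ℕ.≤ t
  combination-count []            = ℕₚ.≤-reflexive (count-zero m)
  combination-count ((σ , i) ∷ p) = ℕₚ.≤-trans (count-change {x = combination p} i unchanged) (ℕ.s≤s (combination-count p))
    where
      unchanged : ∀ l → l ≢ i → combination ((σ , i) ∷ p) l ≡ combination p l
      unchanged l l≢i with l Finₚ.≟ i
      ... | yes l≡i = ⊥-elim (l≢i l≡i)
      ... | no  _   = refl

  private
    delta : Fin m → ℝ → Vector ℝ m
    delta i c l with l Finₚ.≟ i
    ... | yes _ = c
    ... | no  _ = 0#

    combination≡ : ∀ {t} σ i (p : Vec (Fin 2 × Fin m) t) l → combination ((σ , i) ∷ p) l ≡ combination p l + delta i (coef σ) l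
    combination≡ σ i p l with l Finₚ.≟ i
    ... | yes _ = refl
    ... | no  _ = sym (+-identityʳ _)

  sum-delta : ∀ {n} (r : Vector ℝ n) i (e : Vector ℝ n) {c} → e i ≡ c → (∀ l → l ≢ i → e l ≡ 0#) → ⟨ r , e ⟩ ≡ c * r i
  sum-delta {suc n} r zero e ei≡ rest = trans (cong₂ _+_ (trans (cong (r zero *_) ei≡) (*-comm _ _))
    (trans (sum-cong-≗ (λ l → trans (cong (r (suc l) *_) (rest (suc l) (λ ()))) (zeroʳ _))) (sum-replicate-zero n))) (+-identityʳ _)
  sum-delta {suc n} r (suc i) e ei≡ rest = trans (cong₂ _+_ (trans (cong (r zero *_) (rest zero (λ ()))) (zeroʳ _))
    (sum-delta (r ∘ suc) i (e ∘ suc) ei≡ (λ l l≢i → rest (suc l) (l≢i ∘ Finₚ.suc-injective)))) (+-identityˡ _)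

  private
    delta-same : ∀ i c → delta i c i ≡ c
    delta-same i c with i Finₚ.≟ i
    ... | yes _  = refl
    ... | no i≢i = ⊥-elim (i≢i refl)

    delta-other : ∀ i c l → l ≢ i → delta i c l ≡ 0#
    delta-other i c l l≢i with l Finₚ.≟ i
    ... | yes l≡i = ⊥-elim (l≢i l≡i)
    ... | no _    = refl

  vec≡ : ∀ {t} (p : Vec (Fin 2 × Fin m) t) l → vec p l ≡ (A *ᵥ combination p) l - fromℕ t * z l
  vec≡ [] l = sym (trans (cong (λ x → x - 0# * z l) (trans (sum-cong-≗ (λ i → zeroʳ (A l i))) (sum-replicate-zero m)))
    (solve 1 (λ z → c# 0 :- c# 0 :* z := c# 0) refl (z l)))
  vec≡ {suc t} ((σ , i) ∷ p) l = begin-equality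
    vec p l + (coef σ * A l i - z l) ≡⟨ cong (_+ (coef σ * A l i - z l)) (vec≡ p l) ⟩
    (A *ᵥ combination p) l - fromℕ t * z l + (coef σ * A l i - z l)
      ≡⟨ solve 4 (λ a t z b → a :- t :* z :+ (b :- z) := (a :+ b) :- (c# 1 :+ t) :* z) refl ((A *ᵥ combination p) l) (fromℕ t) (z l) (coef σ * A l i) ⟩
    (A *ᵥ combination p) l + coef σ * A l i - fromℕ (suc t) * z l ≡⟨ cong (_- fromℕ (suc t) * z l) (sym step) ⟩
    (A *ᵥ combination ((σ , i) ∷ p)) l - fromℕ (suc t) * z l ∎
    where
      step : (A *ᵥ combination ((σ , i) ∷ p)) l ≡ (A *ᵥ combination p) l + coef σ * A l i
      step = begin-equality
        ⟨ A l , combination ((σ , i) ∷ p) ⟩ ≡⟨ sum-cong-≗ (λ s → trans (cong (A l s *_) (combination≡ σ i p s)) (distribˡ (A l s) _ _)) ⟩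
        sum (λ s → A l s * combination p s + A l s * delta i (coef σ) s) ≡⟨ ∑-distrib-+ (λ s → A l s * combination p s) (λ s → A l s * delta i (coef σ) s) ⟩
        ⟨ A l , combination p ⟩ + ⟨ A l , delta i (coef σ) ⟩ ≡⟨ cong (⟨ A l , combination p ⟩ +_) (sum-delta (A l) i (delta i (coef σ)) (delta-same i (coef σ)) (delta-other i (coef σ))) ⟩
        ⟨ A l , combination p ⟩ + coef σ * A l i ∎

  -- The average combination / t is t-sparse, so y is far from its image.
  far⇒vec-large : ∀ t (p : Vec (Fin 2 × Fin m) (suc t)) → 0# < ε →
    (∀ (x : Vector ℝ m) → ‖ x ‖₀ ℕ.≤ suc t → ε < ‖ (A *ᵥ x) -ᵥ z ‖₂) →
    fromℕ (suc t) * ε * (fromℕ (suc t) * ε) < ⟨ vec p , vec p ⟩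
  far⇒vec-large t p 0<ε far = subst₂ _<_
      (solve 2 (λ T e → T :* T :* (e :* e) := T :* e :* (T :* e)) refl T ε) scaled
      (*-monoˡ-< (*-pos 0<T 0<T) (<‖‖₂ ((A *ᵥ x) -ᵥ z) (proj₁ 0<ε) (far x sparse)))
    where
      T = fromℕ (suc t)
      0<T : 0# < T
      0<T = fromℕ-pos (suc t)
      x : Vector ℝ m
      x i = T ⁻¹ * combination p i
      sparse : ‖ x ‖₀ ℕ.≤ suc t
      sparse = ℕₚ.≤-trans (ℕₚ.≤-reflexive (‖‖₀≡count x)) (ℕₚ.≤-trans (count-scale (T ⁻¹) (combination p)) (combination-count p))
      row : ∀ l → T * ((A *ᵥ x) -ᵥ z) l ≡ vec p l
      row l = begin-equality
        T * ((A *ᵥ x) l - z l) ≡⟨ cong (λ a → T * (a - z l)) (⟨⟩-scaleʳ (A l) (combination p) (T ⁻¹)) ⟩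
        T * (T ⁻¹ * (A *ᵥ combination p) l - z l) ≡⟨ solve 4 (λ T i a z → T :* (i :* a :- z) := (T :* i) :* a :- T :* z) refl T (T ⁻¹) ((A *ᵥ combination p) l) (z l) ⟩
        T * T ⁻¹ * (A *ᵥ combination p) l - T * z l ≡⟨ cong (λ a → a * (A *ᵥ combination p) l - T * z l) (*-inverseʳ T (<⇒≢ 0<T)) ⟩
        1# * (A *ᵥ combination p) l - T * z l ≡⟨ cong (_- T * z l) (*-identityˡ _) ⟩
        (A *ᵥ combination p) l - T * z l ≡⟨ vec≡ p l ⟨
        vec p l ∎
      scaled : T * T * ⟨ (A *ᵥ x) -ᵥ z , (A *ᵥ x) -ᵥ z ⟩ ≡ ⟨ vec p , vec p ⟩
      scaled = trans (*-distribˡ-sum (T * T) (λ l → ((A *ᵥ x) -ᵥ z) l * ((A *ᵥ x) -ᵥ z) l))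
        (sum-cong-≗ (λ l → trans (solve 2 (λ T a → T :* T :* (a :* a) := T :* a :* (T :* a)) refl T (((A *ᵥ x) -ᵥ z) l)) (cong (λ a → a * a) (row l))))

  passes⇒small : ∀ θ T (p : Vec (Fin 2 × Fin m) T) → Passes θ T (residual p) →
    fromℕ θ * ⟨ M *ᵥ vec p , M *ᵥ vec p ⟩ ≤ fromℕ T * ε * (fromℕ T * ε)
  passes⇒small θ T p (_ , small) = subst (λ n → fromℕ θ * n ≤ fromℕ T * ε * (fromℕ T * ε)) (ip-⟨⟩ (residual≡ p) (residual≡ p)) small

  module _ .{{_ : NonZero m}} (x : Vector ℝ m) (xx≡1 : ⟨ x , x ⟩ ≡ 1#) (sparse : count x ℕ.≤ k) (z≡ : ∀ l → z l ≡ (A *ᵥ x) l)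
           (κ-lower : ¬ (fromℕ κ * fromℕ κ ≤ fromℕ k)) (κ-upper : fromℕ κ * fromℕ κ ≤ fromℕ 4 * fromℕ k)
           (φ-bounded : ∀ i → ⟨ φ i , φ i ⟩ ≤ fromℕ 16) where

    Mz : ∀ j → (M *ᵥ z) j ≡ sum (λ i → x i * φ i j)
    Mz j = begin-equality
      ⟨ M j , z ⟩                            ≡⟨ ⟨⟩-cong {u = M j} (λ _ → refl) (λ l → trans (z≡ l) (sum-cong-≗ (λ i → *-comm (A l i) (x i)))) ⟩
      ⟨ M j , (λ l → sum (λ i → x i * A l i)) ⟩ ≡⟨ ⟨⟩-sumʳ (M j) x (column A) ⟩
      sum (λ i → x i * φ i j)                ∎

    ⟨-,Mz⟩ : ∀ Z → ⟨ Z , M *ᵥ z ⟩ ≡ ⟨ x , (λ i → ⟨ Z , φ i ⟩) ⟩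
    ⟨-,Mz⟩ Z = trans (⟨⟩-cong {u = Z} (λ _ → refl) Mz) (⟨⟩-sumʳ Z x φ)

    private
      sparse-sum : ∀ f {b} → 0# ≤ b → (∀ i → f i ≤ b) → suppSum x f ≤ fromℕ k * b
      sparse-sum f 0≤b f≤b = ≤-trans (suppSum-≤ x f f≤b) (*-monoʳ-≤ 0≤b (fromℕ-mono sparse))

    -- Each entry of M z is ⟨x , ·⟩ of a row of sketched columns, so Cauchy-Schwarz on the support
    -- of x applies entrywise. Exchanging the sums leaves at most k squared column norms.
    Mz-bounded : ⟨ M *ᵥ z , M *ᵥ z ⟩ ≤ fromℕ k * fromℕ 16
    Mz-bounded = begin
      ⟨ M *ᵥ z , M *ᵥ z ⟩                              ≡⟨ ⟨⟩-cong Mz Mz ⟩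
      sum (λ j → ⟨ x , (λ i → φ i j) ⟩ * ⟨ x , (λ i → φ i j) ⟩) ≤⟨ sum-mono (λ j → supp-cauchy x (λ i → φ i j) xx≡1) ⟩
      sum (λ j → suppSum x (λ i → φ i j * φ i j))      ≡⟨ ∑-comm (λ j i → χ (x i) * (φ i j * φ i j)) ⟩
      sum (λ i → sum (λ j → χ (x i) * (φ i j * φ i j))) ≡⟨ sum-cong-≗ (λ i → *-distribˡ-sum (χ (x i)) (λ j → φ i j * φ i j)) ⟨
      suppSum x (λ i → ⟨ φ i , φ i ⟩)                  ≤⟨ sparse-sum _ (fromℕ-nonneg 16) φ-bounded ⟩
      fromℕ k * fromℕ 16                               ∎

    -- Let w = ⟨Z , M z⟩ = Σ xᵢ cᵢ with cᵢ = ⟨Z , φ i⟩. If no vertex were admissible, κ cᵢ and -κ cᵢ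
    -- would both exceed w, so κ² cᵢ² < w² for all i. Cauchy-Schwarz on the support then gives κ² w²
    -- ≤ k w², against k < κ².
    admissible : ∀ (Z : Vector ℝ q) → ∃[ σ ] ∃[ i ] coef σ * ⟨ Z , φ i ⟩ ≤ ⟨ Z , M *ᵥ z ⟩
    admissible Z with Finₚ.any? (λ i → coef zero * ⟨ Z , φ i ⟩ ≤? ⟨ Z , M *ᵥ z ⟩) | Finₚ.any? (λ i → coef (suc zero) * ⟨ Z , φ i ⟩ ≤? ⟨ Z , M *ᵥ z ⟩)
    ... | yes found | _         = zero , found
    ... | no _      | yes found = suc zero , found
    ... | no none⁺  | no none⁻  = ⊥-elim (<⇒≱ (*-monoˡ-< 0<ww (≰⇒< κ-lower)) (begin
          w * w * (K * K)                           ≡⟨ *-comm _ _ ⟩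
          K * K * (w * w)                           ≤⟨ *-monoˡ-≤ (square-nonneg K) (≤-trans (≤-reflexive (cong (λ a → a * a) (⟨-,Mz⟩ Z))) (supp-cauchy x c xx≡1)) ⟩
          K * K * suppSum x (λ i → c i * c i)       ≡⟨ *-distribˡ-sum (K * K) (λ i → χ (x i) * (c i * c i)) ⟩
          sum (λ i → K * K * (χ (x i) * (c i * c i))) ≡⟨ sum-cong-≗ (λ i → solve 3 (λ K h c → K :* K :* (h :* (c :* c)) := h :* (K :* c :* (K :* c))) refl K (χ (x i)) (c i)) ⟩
          suppSum x (λ i → K * c i * (K * c i))     ≤⟨ sparse-sum (λ i → K * c i * (K * c i)) (square-nonneg w) (λ i → proj₁ (Kc<w i)) ⟩
          fromℕ k * (w * w)                         ≡⟨ *-comm _ _ ⟩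
          w * w * fromℕ k                           ∎))
      where
        K = fromℕ κ
        w = ⟨ Z , M *ᵥ z ⟩
        c : Vector ℝ m
        c i = ⟨ Z , φ i ⟩
        Kc<w : ∀ i → K * c i * (K * c i) < w * w
        -- The product of the two positive gaps κ c - w and -κ c - w is w² - κ² c².
        Kc<w i = <-via ((K * c i - w) * ((0# - K) * c i - w)) (*-pos (0<- (≰⇒< (λ le → none⁺ (i , le)))) (0<- (≰⇒< (λ le → none⁻ (i , le)))))
          (solve 3 (λ K c w → w :* w := K :* c :* (K :* c) :+ (K :* c :- w) :* ((c# 0 :- K) :* c :- w)) refl K (c i) w)
        0<ww : 0# < w * w
        -- The final contradiction needs w ≠ 0, which any single column provides.
        0<ww = ≤-<-trans (square-nonneg (K * c i₀)) (Kc<w i₀)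
          where i₀ = fromℕ< {0} {m} (ℕ.>-nonZero⁻¹ m)

    coef-square : ∀ σ → coef σ * coef σ ≡ fromℕ κ * fromℕ κ
    coef-square zero    = refl
    coef-square (suc _) = solve 1 (λ K → (c# 0 :- K) :* (c# 0 :- K) := K :* K) refl (fromℕ κ)

    -- The step vector c φ - Y does not correlate positively with the residual, so each step adds at
    -- most its squared norm. That is at most 2 (c² ‖φ‖² + ‖Y‖²) ≤ 2 (4 k · 16 + 16 k) = 160 k.
    greedy-bounded : ∀ {t} (p : Vec (Fin 2 × Fin m) t) → Greedy p → ⟨ M *ᵥ vec p , M *ᵥ vec p ⟩ ≤ fromℕ t * (fromℕ 160 * fromℕ k)
    greedy-bounded [] _ = ≤-reflexive (trans (sum-cong-≗ (λ j → trans (cong₂ _*_ (zero-row j) (zero-row j)) (zeroˡ 0#)))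
        (trans (sum-replicate-zero q) (sym (zeroˡ _))))
      where
        zero-row : ∀ j → (M *ᵥ vec []) j ≡ 0#
        zero-row j = trans (sum-cong-≗ (λ l → zeroʳ (M j l))) (sum-replicate-zero d)
    greedy-bounded {suc t} ((σ , i) ∷ p) (choice , greedy) = begin
      ⟨ M *ᵥ vec ((σ , i) ∷ p) , M *ᵥ vec ((σ , i) ∷ p) ⟩ ≡⟨ ⟨⟩-cong step step ⟩
      ⟨ (λ j → Z j + (c * φ i j - Y j)) , (λ j → Z j + (c * φ i j - Y j)) ⟩ ≤⟨ sum-mono (λ j →
          -- (c φ - Y)² ≤ 2 (c φ)² + 2 Y², with slack (c φ + Y)².
          ≤-via ((c * φ i j + Y j) * (c * φ i j + Y j)) (square-nonneg _)
          (solve 4 (λ Z c f Y → Z :* Z :+ ((c# 1 :+ c# 1) :* (c :* (Z :* f) :- Z :* Y) :+ (c# 1 :+ c# 1) :* (c :* c :* (f :* f) :+ Y :* Y)) :=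
             (Z :+ (c :* f :- Y)) :* (Z :+ (c :* f :- Y)) :+ (c :* f :+ Y) :* (c :* f :+ Y)) refl (Z j) c (φ i j) (Y j))) ⟩
      sum (λ j → Z j * Z j + ((1# + 1#) * (c * (Z j * φ i j) - Z j * Y j) + (1# + 1#) * (c * c * (φ i j * φ i j) + Y j * Y j))) ≡⟨ expand ⟩
      ⟨ Z , Z ⟩ + ((1# + 1#) * (c * ⟨ Z , φ i ⟩ - ⟨ Z , Y ⟩) + (1# + 1#) * (c * c * ⟨ φ i , φ i ⟩ + ⟨ Y , Y ⟩))
        ≤⟨ +-mono-≤ (greedy-bounded p greedy) (+-mono-≤ (*-monoˡ-≤ (proj₁ 0<2) descent) (*-monoˡ-≤ (proj₁ 0<2)
             (+-mono-≤ (*-mono-≤ (square-nonneg c) (fromℕ-nonneg 16) (≤-trans (≤-reflexive (coef-square σ)) κ-upper) (φ-bounded i)) Mz-bounded))) ⟩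
      fromℕ t * (fromℕ 160 * fromℕ k) + ((1# + 1#) * 0# + (1# + 1#) * (fromℕ 4 * fromℕ k * fromℕ 16 + fromℕ k * fromℕ 16))
        ≡⟨ solve 2 (λ t k → t :* (c# 160 :* k) :+ ((c# 1 :+ c# 1) :* c# 0 :+ (c# 1 :+ c# 1) :* (c# 4 :* k :* c# 16 :+ k :* c# 16)) := (c# 1 :+ t) :* (c# 160 :* k)) refl (fromℕ t) (fromℕ k) ⟩
      fromℕ (suc t) * (fromℕ 160 * fromℕ k) ∎
      where
        c = coef σ
        Z Y : Vector ℝ q
        Z = M *ᵥ vec p
        Y = M *ᵥ z
        step : ∀ j → (M *ᵥ vec ((σ , i) ∷ p)) j ≡ Z j + (c * φ i j - Y j)
        step j = *ᵥ-step (M j) (vec p) (column A i) z c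
        descent : c * ⟨ Z , φ i ⟩ - ⟨ Z , Y ⟩ ≤ 0#
        descent = ≤-trans (+-monoˡ-≤ (- ⟨ Z , Y ⟩) (subst₂ _≤_ (cong (c *_) (ip-⟨⟩ (residual≡ p) (col-toℕ i))) (ip-⟨⟩ (residual≡ p) y-toℕ)
            (choice (let σ′ , i′ , adm = admissible Z in σ′ , i′ ,
              subst₂ _≤_ (cong (coef σ′ *_) (sym (ip-⟨⟩ (residual≡ p) (col-toℕ i′)))) (sym (ip-⟨⟩ (residual≡ p) y-toℕ)) adm))))
          (≤-reflexive (-‿inverseʳ ⟨ Z , Y ⟩))
        expand : sum (λ j → Z j * Z j + ((1# + 1#) * (c * (Z j * φ i j) - Z j * Y j) + (1# + 1#) * (c * c * (φ i j * φ i j) + Y j * Y j))) ≡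
                 ⟨ Z , Z ⟩ + ((1# + 1#) * (c * ⟨ Z , φ i ⟩ - ⟨ Z , Y ⟩) + (1# + 1#) * (c * c * ⟨ φ i , φ i ⟩ + ⟨ Y , Y ⟩))
        expand = sums (λ j → Z j * Z j) (λ j → Z j * φ i j) (λ j → Z j * Y j) (λ j → φ i j * φ i j) (λ j → Y j * Y j)
          where
            sums : ∀ {n} (a b e f g : Vector ℝ n) → sum (λ j → a j + ((1# + 1#) * (c * b j - e j) + (1# + 1#) * (c * c * f j + g j))) ≡
                   sum a + ((1# + 1#) * (c * sum b - sum e) + (1# + 1#) * (c * c * sum f + sum g))
            sums {zero} a b e f g = solve 1 (λ c → c# 0 := c# 0 :+ ((c# 1 :+ c# 1) :* (c :* c# 0 :- c# 0) :+ (c# 1 :+ c# 1) :* (c :* c :* c# 0 :+ c# 0))) refl c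
            sums {suc n} a b e f g = trans (cong (a zero + ((1# + 1#) * (c * b zero - e zero) + (1# + 1#) * (c * c * f zero + g zero)) +_)
                (sums (a ∘ suc) (b ∘ suc) (e ∘ suc) (f ∘ suc) (g ∘ suc)))
              (solve 11 (λ c a b e f g a′ b′ e′ f′ g′ →
                 a :+ ((c# 1 :+ c# 1) :* (c :* b :- e) :+ (c# 1 :+ c# 1) :* (c :* c :* f :+ g)) :+
                 (a′ :+ ((c# 1 :+ c# 1) :* (c :* b′ :- e′) :+ (c# 1 :+ c# 1) :* (c :* c :* f′ :+ g′))) :=
                 a :+ a′ :+ ((c# 1 :+ c# 1) :* (c :* (b :+ b′) :- (e :+ e′)) :+ (c# 1 :+ c# 1) :* (c :* c :* (f :+ f′) :+ (g :+ g′)))) refl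
                 c (a zero) (b zero) (e zero) (f zero) (g zero) (sum (a ∘ suc)) (sum (b ∘ suc)) (sum (e ∘ suc)) (sum (f ∘ suc)) (sum (g ∘ suc)))

-- The integer scale κ

module IntegerSquareRoot (k : ℕ) .{{_ : NonZero k}} where
  private
    k<[1+k]² : k ℕ.< suc k ℕ.* suc k
    k<[1+k]² = ℕₚ.m≤m*n (suc k) (suc k)

    found : ∃[ n ] (k ℕ.< n ℕ.* n) × (∀ j → j ℕ.< n → ¬ (k ℕ.< j ℕ.* j))
    found = least (λ n → k ℕₚ.<? n ℕ.* n) (suc k) k<[1+k]²

  abstract
    κ : ℕ
    κ = proj₁ found

    k<κ² : k ℕ.< κ ℕ.* κ
    k<κ² = proj₁ (proj₂ found)

    below-κ : ∀ j → j ℕ.< κ → j ℕ.* j ℕ.≤ k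
    below-κ j j<κ = ℕₚ.≮⇒≥ (proj₂ (proj₂ found) j j<κ)

  private
    j<1+j² : ∀ j → j ℕ.≤ j ℕ.* j
    j<1+j² zero    = ℕ.z≤n
    j<1+j² (suc j) = ℕₚ.m≤m*n (suc j) (suc j)

    -- As k ≥ 1, the least such n is at least 2. For n = j + 2 minimality gives (j + 1)² ≤ k, and (j
    -- + 2)² ≤ 4 (j + 1)².
    bounds : ∀ n → k ℕ.< n ℕ.* n → (∀ j → j ℕ.< n → j ℕ.* j ℕ.≤ k) → n ℕ.≤ suc k × n ℕ.* n ℕ.≤ 4 ℕ.* k
    bounds zero () _
    bounds (suc zero) k<1 _ = ⊥-elim (ℕₚ.<⇒≱ k<1 (ℕ.>-nonZero⁻¹ k))
    bounds (suc (suc j)) _ below = ℕ.s≤s (ℕₚ.≤-trans (j<1+j² (suc j)) (below (suc j) ℕₚ.≤-refl)) ,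
      ℕₚ.≤-trans (ℕₚ.≤-trans (ℕₚ.m≤m+n (suc (suc j) ℕ.* suc (suc j)) (3 ℕ.* (j ℕ.* j) ℕ.+ 4 ℕ.* j)) (ℕₚ.≤-reflexive
        (solve 1 (λ j → (con 2 :+ j) :* (con 2 :+ j) :+ (con 3 :* (j :* j) :+ con 4 :* j) := con 4 :* ((con 1 :+ j) :* (con 1 :+ j))) refl j)))
        (ℕₚ.*-monoʳ-≤ 4 (below (suc j) ℕₚ.≤-refl))
      where open Data.Nat.Solver.+-*-Solver

  κ≤1+k : κ ℕ.≤ suc k
  κ≤1+k = proj₁ (bounds κ k<κ² below-κ)

  κ²≤4k : κ ℕ.* κ ℕ.≤ 4 ℕ.* k
  κ²≤4k = proj₂ (bounds κ k<κ² below-κ)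

-- Bounding the number of steps

module RunningTime where
  open Data.Nat.Solver.+-*-Solver

  -- `accumulateTime` for an expression of size σ, free of any input. With the sizes 7, 8 and 9 of
  -- the accumulated expressions, `cost` and `testerTime` agree by computation.
  accumulateCost : ℕ → ℕ → ℕ
  accumulateCost q σ = 4 ℕ.+ (2 ℕ.+ (q ℕ.* (5 ℕ.+ (5 ℕ.+ σ ℕ.+ 4)) ℕ.+ 5))

  stepCost : ℕ → ℕ → ℕ
  stepCost q m = accumulateCost q 7 ℕ.+ (4 ℕ.+ (2 ℕ.+ (2 ℕ.+
    (m ℕ.* (5 ℕ.+ (accumulateCost q 8 ℕ.+ (8 ℕ.+ (11 ℕ.+ 9) ℕ.+ 4))) ℕ.+ 5 ℕ.+ (2 ℕ.+ (q ℕ.* (5 ℕ.+ 22) ℕ.+ 5 ℕ.+ 4))))))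

  cost : ℕ → ℕ → ℕ → ℕ → ℕ
  cost κ T q m = κ ℕ.* (8 ℕ.+ 4) ℕ.+ 8 ℕ.+ (T ℕ.* (12 ℕ.+ stepCost q m) ℕ.+ 12 ℕ.+ (accumulateCost q 9 ℕ.+ (8 ℕ.+ (15 ℕ.+ 2))))

  accumulateCost-mono : ∀ {q q′} σ → q ℕ.≤ q′ → accumulateCost q σ ℕ.≤ accumulateCost q′ σ
  accumulateCost-mono σ q≤ = ℕₚ.+-monoʳ-≤ 6 (ℕₚ.+-monoˡ-≤ 5 (ℕₚ.*-monoˡ-≤ (5 ℕ.+ (5 ℕ.+ σ ℕ.+ 4)) q≤))

  stepCost-mono : ∀ {q q′ m m′} → q ℕ.≤ q′ → m ℕ.≤ m′ → stepCost q m ℕ.≤ stepCost q′ m′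
  stepCost-mono q≤ m≤ = ℕₚ.+-mono-≤ (accumulateCost-mono 7 q≤) (ℕₚ.+-monoʳ-≤ 8 (ℕₚ.+-mono-≤
    (ℕₚ.+-monoˡ-≤ 5 (ℕₚ.*-mono-≤ m≤ (ℕₚ.+-monoʳ-≤ 5 (ℕₚ.+-monoˡ-≤ 32 (accumulateCost-mono 8 q≤)))))
    (ℕₚ.+-monoʳ-≤ 2 (ℕₚ.+-monoˡ-≤ 4 (ℕₚ.+-monoˡ-≤ 5 (ℕₚ.*-monoˡ-≤ 27 q≤))))))

  cost-bound : ∀ κ T q m → q ℕ.≤ suc m → cost κ T q m ℕ.≤ 165 ℕ.* (κ ℕ.+ suc T ℕ.* (suc m ℕ.* suc m))
  cost-bound κ T q m q≤ = ℕₚ.≤-trans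
    (ℕₚ.+-monoʳ-≤ (κ ℕ.* 12 ℕ.+ 8) (ℕₚ.+-mono-≤ (ℕₚ.+-monoˡ-≤ 12 (ℕₚ.*-monoʳ-≤ T (ℕₚ.+-monoʳ-≤ 12 (stepCost-mono q≤ (ℕₚ.n≤1+n m)))))
      (ℕₚ.+-monoˡ-≤ 25 (accumulateCost-mono 9 q≤))))
    -- The padding is the difference of the two polynomials, which turns the bound into an identity
    -- for the solver.
    (ℕₚ.≤-trans (ℕₚ.m≤m+n _ (153 ℕ.* κ ℕ.+ T ℕ.* (190 ℕ.* m ℕ.+ 143 ℕ.* (m ℕ.* m)) ℕ.+ (86 ℕ.+ 307 ℕ.* m ℕ.+ 165 ℕ.* (m ℕ.* m))))
      (ℕₚ.≤-reflexive (solve 3 (λ κ T m →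
        let p = con 1 :+ m
            acc : ℕ → Polynomial 3
            acc σ = con 4 :+ (con 2 :+ (p :* (con 5 :+ (con 5 :+ con σ :+ con 4)) :+ con 5))
            step = acc 7 :+ (con 4 :+ (con 2 :+ (con 2 :+ (p :* (con 5 :+ (acc 8 :+ con 32)) :+ con 5 :+ (con 2 :+ (p :* con 27 :+ con 5 :+ con 4))))))
        in κ :* con 12 :+ con 8 :+ (T :* (con 12 :+ step) :+ con 12 :+ (acc 9 :+ con 25)) :+
           (con 153 :* κ :+ T :* (con 190 :* m :+ con 143 :* (m :* m)) :+ (con 86 :+ con 307 :* m :+ con 165 :* (m :* m)))
           := con 165 :* (κ :+ (con 1 :+ T) :* (p :* p))) refl κ T m)))

-- Choice of the parameters

module Parameters (em : ExcludedMiddle 0ℓ) (R : CompleteOrderedField) (w : ℕ)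
                  (2≤w : 2 ℕ.≤ w) (4w≤165 : 4 ℕ.* w ℕ.≤ 165) (large : 32 ℕ.* 9 ℕ.^ w ℕ.≤ 10 ℕ.^ w) where
  open OrderedField R
  open Completeness R
  open Sequences R
  open LinearAlgebra R
  open Support R
  open FiniteProbability em R
  open Rademacher em R
  open Sketches em R
  open ≤-Reasoning

  instance
    w≢0 : NonZero w
    w≢0 = ℕ.>-nonZero (ℕₚ.≤-trans (ℕ.s≤s ℕ.z≤n) 2≤w)

  θ : ℕ
  θ = 4 ℕ.* w

  -- Abstract, so that these numerals are never unfolded.
  abstract
    c₀ C : ℕ
    -- T ε² ≥ c₀ k puts θ times the greedy bound 160 k T below (T ε)². In C, 165 comes from
    -- `cost-bound`, and c₀ + 3 is 1 for κ plus c₀ + 2 for T + 1. The same C serves the number of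
    -- queries, for which 4 w ≤ 165 is assumed.
    c₀ = θ ℕ.* 160
    C  = 165 ℕ.* (c₀ ℕ.+ 3)

    c₀≡ : fromℕ c₀ ≡ fromℕ θ * fromℕ 160
    c₀≡ = fromℕ-* θ 160

    C≡ : fromℕ C ≡ fromℕ 165 * (fromℕ c₀ + fromℕ 3)
    C≡ = trans (fromℕ-* 165 (c₀ ℕ.+ 3)) (cong (fromℕ 165 *_) (fromℕ-+ c₀ 3))

  instance
    θ≢0 : NonZero θ
    θ≢0 = ℕₚ.m*n≢0 4 w

  exceeds : ∀ x → ∃[ n ] x < fromℕ n
  exceeds x with em {∃[ n ] x < fromℕ n}
  ... | yes found = found
  ... | no none   = ⊥-elim (archimedean x λ n → decidable-stable (fromℕ n ≤? x) λ n≰x → none (n , ≰⇒< n≰x))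

  private
    a c W : ℝ
    a = fromℕ 165
    c = fromℕ c₀
    W = fromℕ w

    0≤c : 0# ≤ c
    0≤c = fromℕ-nonneg c₀

    0≤a-1 : 0# ≤ a - 1#
    0≤a-1 = ≤-trans (fromℕ-nonneg 164) (≤-reflexive (solve 0 (c# 164 := c# 165 :- c# 1) refl))

    0≤a : 0# ≤ a
    0≤a = fromℕ-nonneg 165


  2≤C* : ∀ {x} → 0# ≤ x → fromℕ 2 ≤ fromℕ C * (1# + x)
  2≤C* {x} 0≤x = ≤-trans (≤-via ((fromℕ 2 * (a - 1#)) + (a * (1# + c) + a * (c + fromℕ 3) * x))
    (+-nonneg (*-nonneg (fromℕ-nonneg 2) 0≤a-1) (+-nonneg (*-nonneg 0≤a (+-nonneg 0≤1 0≤c))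
      (*-nonneg (*-nonneg 0≤a (+-nonneg 0≤c (fromℕ-nonneg 3))) 0≤x)))
    (solve 3 (λ a c x → a :* (c :+ c# 3) :* (c# 1 :+ x) := c# 2 :+ (c# 2 :* (a :- c# 1) :+ (a :* (c# 1 :+ c) :+ a :* (c :+ c# 3) :* x))) refl a c x))
    (≤-reflexive (cong (_* (1# + x)) (sym C≡)))

  sketchSize≤ : ∀ {x n} → 0# ≤ x → fromℕ n ≤ W * ((c + 1#) * (fromℕ 4 * x)) → fromℕ (suc n) ≤ fromℕ C * (1# + x)
  sketchSize≤ {x} {n} 0≤x n≤ = begin
    1# + fromℕ n                               ≤⟨ +-monoʳ-≤ 1# n≤ ⟩
    1# + W * ((c + 1#) * (fromℕ 4 * x))        ≡⟨ solve 3 (λ W c x → c# 1 :+ W :* ((c :+ c# 1) :* (c# 4 :* x)) := c# 1 :+ (c# 4 :* W) :* ((c :+ c# 1) :* x)) refl W c x ⟩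
    1# + fromℕ 4 * W * ((c + 1#) * x)          ≤⟨ +-monoʳ-≤ 1# (*-monoʳ-≤ (*-nonneg (+-nonneg 0≤c 0≤1) 0≤x) (≤-trans (≤-reflexive (sym (fromℕ-* 4 w))) (fromℕ-mono 4w≤165))) ⟩
    1# + a * ((c + 1#) * x)                    ≤⟨ ≤-via ((a - 1#) + ((a + a) + (a * c + (a + a) * x)))
                                                    (+-nonneg 0≤a-1 (+-nonneg (+-nonneg 0≤a 0≤a) (+-nonneg (*-nonneg 0≤a 0≤c) (*-nonneg (+-nonneg 0≤a 0≤a) 0≤x))))
                                                    (solve 3 (λ a c x → a :* (c :+ c# 3) :* (c# 1 :+ x) := c# 1 :+ a :* ((c :+ c# 1) :* x) :+ ((a :- c# 1) :+ ((a :+ a) :+ (a :* c :+ (a :+ a) :* x)))) refl a c x) ⟩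
    a * (c + fromℕ 3) * (1# + x)               ≡⟨ cong (_* (1# + x)) C≡ ⟨
    fromℕ C * (1# + x)                         ∎

  half : ∀ {x b δ} → 0# < b → (1# + 1#) * x ≤ δ * b → (1# + 1#) * (x * b ⁻¹) ≤ δ
  half {x} {b} {δ} 0<b 2x≤δb = begin
    (1# + 1#) * (x * b ⁻¹) ≡⟨ *-assoc _ _ _ ⟨
    (1# + 1#) * x * b ⁻¹   ≤⟨ *-monoʳ-≤ (proj₁ (⁻¹-pos 0<b)) 2x≤δb ⟩
    δ * b * b ⁻¹           ≡⟨ *-assoc _ _ _ ⟩
    δ * (b * b ⁻¹)         ≡⟨ trans (cong (δ *_) (*-inverseʳ b (<⇒≢ 0<b))) (*-identityʳ δ) ⟩
    δ                      ∎

  module Choice (ε δ : ℝ) (0<ε : 0# < ε) (ε<1 : ε < 1#) (0<δ : 0# < δ) (δ<1 : δ < 1#)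
           (d k m : ℕ) .{{_ : NonZero d}} .{{_ : NonZero k}} .{{_ : NonZero m}}
           (A : Matrix d m) (unit : ∀ i → ‖ column A i ‖₂ ≡ 1#) where

    unit′ : ∀ i → sumSq (column A i) ≡ 1#
    unit′ i = ‖‖₂≡1 (column A i) (unit i)

    0<ε² : 0# < ε * ε
    0<ε² = *-pos 0<ε 0<ε

    inverse≥1 : ∀ {x} → 0# < x → x < 1# → 1# ≤ x ⁻¹
    inverse≥1 {x} 0<x x<1 = *-cancelˡ-≤ 0<x (≤-trans (≤-reflexive (*-identityʳ x)) (≤-trans (proj₁ x<1) (≤-reflexive (sym (*-inverseʳ x (<⇒≢ 0<x))))))

    1≤ε⁻¹ : 1# ≤ ε ⁻¹
    1≤ε⁻¹ = inverse≥1 0<ε ε<1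

    1≤δ⁻¹ : 1# ≤ δ ⁻¹
    1≤δ⁻¹ = inverse≥1 0<δ δ<1

    1≤fromℕ : ∀ n → .{{NonZero n}} → 1# ≤ fromℕ n
    1≤fromℕ n = ≤-trans (≤-reflexive (sym fromℕ-1)) (fromℕ-mono (ℕ.>-nonZero⁻¹ n))

    E : ℝ
    E = fromℕ k * ε ⁻¹ ^ 2

    1≤E : 1# ≤ E
    1≤E = ≤-trans (≤-reflexive (sym (*-identityʳ 1#))) (*-mono-≤ 0≤1 (^-nonneg 2 (≤-trans 0≤1 1≤ε⁻¹)) (1≤fromℕ k) (1≤^ 2 1≤ε⁻¹))

    0≤E : 0# ≤ E
    0≤E = ≤-trans 0≤1 1≤E

    continues? : ∀ t → Dec (fromℕ t * (ε * ε) ≤ fromℕ c₀ * fromℕ k)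
    continues? t = fromℕ t * (ε * ε) ≤? fromℕ c₀ * fromℕ k

    private
      stepCount : ∃[ t ] ¬ (fromℕ t * (ε * ε) ≤ fromℕ c₀ * fromℕ k) × (∀ j → j ℕ.< t → ¬ ¬ (fromℕ j * (ε * ε) ≤ fromℕ c₀ * fromℕ k))
      stepCount = least (λ t → ¬? (continues? t)) N λ le → <⇒≱ Nlarge (*-cancelˡ-≤ 0<ε² (begin
          ε * ε * fromℕ N       ≡⟨ *-comm _ _ ⟩
          fromℕ N * (ε * ε)     ≤⟨ le ⟩
          fromℕ c₀ * fromℕ k    ≡⟨ trans (cong (fromℕ c₀ * fromℕ k *_) (*-inverseʳ _ (<⇒≢ 0<ε²))) (*-identityʳ _) ⟨
          fromℕ c₀ * fromℕ k * (ε * ε * (ε * ε) ⁻¹) ≡⟨ solve 3 (λ c e i → c :* (e :* i) := e :* (c :* i)) refl (fromℕ c₀ * fromℕ k) (ε * ε) ((ε * ε) ⁻¹) ⟩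
          ε * ε * (fromℕ c₀ * fromℕ k * (ε * ε) ⁻¹) ∎))
        where
          N = proj₁ (exceeds (fromℕ c₀ * fromℕ k * (ε * ε) ⁻¹))
          Nlarge = proj₂ (exceeds (fromℕ c₀ * fromℕ k * (ε * ε) ⁻¹))

      Stop : ℕ → Set
      Stop t = ¬ (fromℕ t * (ε * ε) ≤ fromℕ c₀ * fromℕ k)

      -- Zero steps never satisfy the stopping condition, so T is a successor; division by T and the
      -- bound on T both rest on this.
      predecessor : ∃[ t ] Stop t × (∀ j → j ℕ.< t → ¬ Stop j) → ∃[ t ] Stop (suc t) × (∀ j → j ℕ.< suc t → ¬ Stop j)
      predecessor (zero  , stop , _)  = ⊥-elim (stop (≤-trans (≤-reflexive (zeroˡ _)) (*-nonneg (fromℕ-nonneg c₀) (fromℕ-nonneg k))))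
      predecessor (suc t , stop , go) = t , stop , go

    abstract
      T′ : ℕ
      T′ = proj₁ (predecessor stepCount)

      T-large : ¬ (fromℕ (suc T′) * (ε * ε) ≤ fromℕ c₀ * fromℕ k)
      T-large = proj₁ (proj₂ (predecessor stepCount))

      T-least : ∀ t → t ℕ.< suc T′ → fromℕ t * (ε * ε) ≤ fromℕ c₀ * fromℕ k
      T-least t t<T = decidable-stable (continues? t) (proj₂ (proj₂ (predecessor stepCount)) t t<T)

    T : ℕ
    T = suc T′

    -- The last value before stopping still satisfies T′ ε² ≤ c₀ k, and the final step is paid for
    -- by 1 ≤ E.
    T≤ : fromℕ T ≤ (c + 1#) * E
    T≤ = begin
      1# + fromℕ T′   ≤⟨ +-mono-≤ 1≤E (*-cancelˡ-≤ 0<ε² (begin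
         ε * ε * fromℕ T′ ≡⟨ *-comm _ _ ⟩
         fromℕ T′ * (ε * ε) ≤⟨ T-least T′ ℕₚ.≤-refl ⟩
         c * fromℕ k    ≡⟨ solve 2 (λ c k → c :* k := c :* k :* (c# 1 :* c# 1)) refl c (fromℕ k) ⟩
         c * fromℕ k * (1# * 1#) ≡⟨ cong (λ x → c * fromℕ k * (x * x)) (*-inverseʳ ε (<⇒≢ 0<ε)) ⟨
         c * fromℕ k * (ε * ε ⁻¹ * (ε * ε ⁻¹)) ≡⟨ solve 4 (λ c k e i → c :* k :* (e :* i :* (e :* i)) := e :* e :* (c :* (k :* (i :* (i :* c# 1))))) refl c (fromℕ k) ε (ε ⁻¹) ⟩
         ε * ε * (c * E) ∎)) ⟩
      E + c * E       ≡⟨ solve 2 (λ c E → E :+ c :* E := (c :+ c# 1) :* E) refl c E ⟩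
      (c + 1#) * E    ∎

    K≤ : fromℕ T ≤ fromℕ C * E
    K≤ = ≤-trans T≤ (≤-trans (*-monoʳ-≤ 0≤E (≤-via ((a - 1#) * (c + 1#) + (a + a))
        (+-nonneg (*-nonneg 0≤a-1 (+-nonneg 0≤c 0≤1)) (+-nonneg 0≤a 0≤a))
        (solve 2 (λ a c → a :* (c :+ c# 3) := (c :+ c# 1) :+ ((a :- c# 1) :* (c :+ c# 1) :+ (a :+ a))) refl a c)))
      (≤-reflexive (cong (_* E) (sym C≡))))

    Path : Set
    Path = Vec (Fin 2 × Fin m) T

    pathCount : ℕ
    pathCount = (2 ℕ.* m) ℕ.^ T

    unionBound-Path : UnionBound Path pathCount
    unionBound-Path = unionBound-Vec {a = 2 ℕ.* m} (unionBound-× {a = 2} {m} (unionBound-Fin 2) (unionBound-Fin m)) T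

    L : ℝ
    L = log (fromℕ m * δ ⁻¹)

    1≤m/δ : 1# ≤ fromℕ m * δ ⁻¹
    1≤m/δ = ≤-trans (≤-reflexive (sym (*-identityʳ 1#))) (*-mono-≤ 0≤1 (≤-trans 0≤1 1≤δ⁻¹) (1≤fromℕ m) 1≤δ⁻¹)

    0≤L : 0# ≤ L
    0≤L = *-cancelˡ-≤ 0<2 (≤-trans (≤-reflexive (zeroʳ _)) (log-lower 0 _ 1≤m/δ))

    0≤EL : 0# ≤ E * L
    0≤EL = *-nonneg 0≤E 0≤L

    fromℕ≤2^ : ∀ n → fromℕ n ≤ (1# + 1#) ^ n
    fromℕ≤2^ zero    = 0≤1
    fromℕ≤2^ (suc n) = ≤-trans (+-mono-≤ (1≤^ n 1≤2) (fromℕ≤2^ n)) (≤-reflexive (solve 1 (λ x → x :+ x := (c# 1 :+ c# 1) :* x) refl _))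

    private
      -- The least ℓ with 2^ℓ ≥ m / δ is at least 2, because m / δ > 2. Hence ℓ ≤ 2 (ℓ - 1), and
      -- 2^(ℓ - 1) < m / δ gives ℓ - 1 ≤ 2 L. Only here does m ≥ 2 keep the logarithm away from 0.
      logarithm : 2 ℕ.≤ m → ∃[ ℓ ] (fromℕ m * δ ⁻¹ ≤ (1# + 1#) ^ ℓ × fromℕ ℓ ≤ fromℕ 4 * L × NonZero ℓ)
      logarithm 2≤m = let ℓ , covers , below = found in ℓ , covers , bounds ℓ covers below
        where
          N = proj₁ (exceeds (fromℕ m * δ ⁻¹))
          Nlarge = proj₂ (exceeds (fromℕ m * δ ⁻¹))
          found : ∃[ ℓ ] (fromℕ m * δ ⁻¹ ≤ (1# + 1#) ^ ℓ) × (∀ j → j ℕ.< ℓ → ¬ (fromℕ m * δ ⁻¹ ≤ (1# + 1#) ^ j))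
          found = least (λ n → fromℕ m * δ ⁻¹ ≤? (1# + 1#) ^ n) N (≤-trans (proj₁ Nlarge) (fromℕ≤2^ N))
          2<m/δ : ∀ {x} → x ≤ 1# + 1# → ¬ (fromℕ m * δ ⁻¹ ≤ x)
          2<m/δ x≤2 m/δ≤x = <⇒≱ δ<1 (begin
            1#               ≡⟨ *-inverseʳ δ (<⇒≢ 0<δ) ⟨
            δ * δ ⁻¹         ≤⟨ *-monoˡ-≤ (proj₁ 0<δ) (*-cancelˡ-≤ 0<2 (begin
              (1# + 1#) * δ ⁻¹ ≤⟨ *-monoʳ-≤ (≤-trans 0≤1 1≤δ⁻¹) (≤-trans (≤-reflexive (solve 0 (c# 1 :+ c# 1 := c# 2) refl)) (fromℕ-mono 2≤m)) ⟩
              fromℕ m * δ ⁻¹   ≤⟨ ≤-trans m/δ≤x x≤2 ⟩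
              1# + 1#          ≡⟨ *-identityʳ _ ⟨
              (1# + 1#) * 1#   ∎)) ⟩
            δ * 1#           ≡⟨ *-identityʳ δ ⟩
            δ                ∎)
          bounds : ∀ ℓ → fromℕ m * δ ⁻¹ ≤ (1# + 1#) ^ ℓ → (∀ j → j ℕ.< ℓ → ¬ (fromℕ m * δ ⁻¹ ≤ (1# + 1#) ^ j)) →
                   fromℕ ℓ ≤ fromℕ 4 * L × NonZero ℓ
          bounds zero       covers _ = ⊥-elim (2<m/δ 1≤2 covers)
          bounds (suc zero) covers _ = ⊥-elim (2<m/δ (≤-reflexive (*-identityʳ _)) covers)
          bounds (suc (suc j)) _ below = (begin
              fromℕ (suc (suc j))                       ≤⟨ ≤-via (fromℕ j) (fromℕ-nonneg j) (solve 1 (λ j → (c# 1 :+ j) :+ (c# 1 :+ j) := c# 1 :+ (c# 1 :+ j) :+ j) refl (fromℕ j)) ⟩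
              fromℕ (suc j) + fromℕ (suc j)             ≤⟨ +-mono-≤ lower lower ⟩
              (1# + 1#) * L + (1# + 1#) * L             ≡⟨ solve 1 (λ L → (c# 1 :+ c# 1) :* L :+ (c# 1 :+ c# 1) :* L := c# 4 :* L) refl L ⟩
              fromℕ 4 * L                               ∎) , _
            where lower = log-lower (suc j) _ (proj₁ (≰⇒< (below (suc j) ℕₚ.≤-refl)))

    module _ (2≤m : 2 ℕ.≤ m) (ℓ : ℕ) {{_ : NonZero ℓ}} (covers : fromℕ m * δ ⁻¹ ≤ (1# + 1#) ^ ℓ) where
      private
        Q H N : ℝ
        Q = (1# + 1#) ^ ℓ
        H = Q * Q
        N = fromℕ pathCount

        m≤δQ : fromℕ m ≤ δ * Q
        m≤δQ = begin
          fromℕ m                ≡⟨ trans (cong (fromℕ m *_) (*-inverseʳ δ (<⇒≢ 0<δ))) (*-identityʳ _) ⟨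
          fromℕ m * (δ * δ ⁻¹)   ≡⟨ solve 3 (λ m d i → m :* (d :* i) := d :* (m :* i)) refl (fromℕ m) δ (δ ⁻¹) ⟩
          δ * (fromℕ m * δ ⁻¹)   ≤⟨ *-monoˡ-≤ (proj₁ 0<δ) covers ⟩
          δ * Q                  ∎

        0≤Q : 0# ≤ Q
        0≤Q = ^-nonneg ℓ (proj₁ 0<2)

        0≤H : 0# ≤ H
        0≤H = *-nonneg 0≤Q 0≤Q

        1≤Q : 1# ≤ Q
        1≤Q = 1≤^ ℓ 1≤2

        1≤H : 1# ≤ H
        1≤H = ≤-trans (≤-reflexive (sym (*-identityʳ 1#))) (*-mono-≤ 0≤1 0≤Q 1≤Q 1≤Q)

        m≤Q : fromℕ m ≤ Q
        m≤Q = ≤-trans m≤δQ (≤-trans (*-monoʳ-≤ 0≤Q (proj₁ δ<1)) (≤-reflexive (*-identityˡ Q)))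

        2≤m′ : 1# + 1# ≤ fromℕ m
        2≤m′ = ≤-trans (≤-reflexive (solve 0 (c# 1 :+ c# 1 := c# 2) refl)) (fromℕ-mono 2≤m)

        N≤H^T : N ≤ H ^ T
        N≤H^T = ≤-trans (≤-reflexive (fromℕ-^ (2 ℕ.* m) T)) (^-mono-≤ T (fromℕ-nonneg (2 ℕ.* m)) (begin
          fromℕ (2 ℕ.* m)      ≤⟨ fromℕ-mono (ℕₚ.*-monoˡ-≤ m 2≤m) ⟩
          fromℕ (m ℕ.* m)      ≡⟨ fromℕ-* m m ⟩
          fromℕ m * fromℕ m    ≤⟨ *-mono-≤ (fromℕ-nonneg m) 0≤Q m≤Q m≤Q ⟩
          H                    ∎))

        Q≤H^T : Q ≤ H ^ T
        Q≤H^T = begin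
          Q                ≡⟨ *-identityʳ Q ⟨
          Q * 1#           ≤⟨ *-monoˡ-≤ 0≤Q 1≤Q ⟩
          H                ≡⟨ *-identityʳ H ⟨
          H * 1#           ≤⟨ *-monoˡ-≤ 0≤H (1≤^ T′ 1≤H) ⟩
          H ^ T            ∎

        16^ : fromℕ 16 ^ (T ℕ.* ℓ) ≡ H ^ T * H ^ T
        16^ = begin-equality
          fromℕ 16 ^ (T ℕ.* ℓ) ≡⟨ cong (fromℕ 16 ^_) (ℕₚ.*-comm T ℓ) ⟩
          fromℕ 16 ^ (ℓ ℕ.* T) ≡⟨ ^-assocʳ (fromℕ 16) ℓ T ⟨
          (fromℕ 16 ^ ℓ) ^ T   ≡⟨ cong (λ x → (x ^ ℓ) ^ T) (solve 0 (c# 16 := (c# 1 :+ c# 1) :* (c# 1 :+ c# 1) :* ((c# 1 :+ c# 1) :* (c# 1 :+ c# 1))) refl) ⟩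
          ((t * t * (t * t)) ^ ℓ) ^ T ≡⟨ cong (_^ T) (trans (^-distrib-* (t * t) (t * t) ℓ) (cong₂ _*_ (^-distrib-* t t ℓ) (^-distrib-* t t ℓ))) ⟩
          (H * H) ^ T          ≡⟨ ^-distrib-* H H T ⟩
          H ^ T * H ^ T        ∎
          where t = 1# + 1#

      -- Each summand is at most δ / 2. With Q = 2^ℓ one has 2 ≤ m ≤ δ Q and m ≤ Q. So 2 m ≤ δ Q²,
      -- and the (2 m)^T ≤ Q^(2 T) paths face 16^(T ℓ) = Q^(4 T); the surplus Q^(2 T) is at least Q
      -- ≥ 2 / δ.
      failure≤δ : fromℕ m * ((1# + 1#) ^ (w ℕ.* (T ℕ.* ℓ))) ⁻¹ + fromℕ pathCount * (fromℕ 16 ^ (T ℕ.* ℓ)) ⁻¹ ≤ δ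
      failure≤δ = *-cancelˡ-≤ 0<2 (begin
        (1# + 1#) * (fromℕ m * ((1# + 1#) ^ (w ℕ.* (T ℕ.* ℓ))) ⁻¹ + N * (fromℕ 16 ^ (T ℕ.* ℓ)) ⁻¹) ≡⟨ distribˡ _ _ _ ⟩
        (1# + 1#) * (fromℕ m * ((1# + 1#) ^ (w ℕ.* (T ℕ.* ℓ))) ⁻¹) + (1# + 1#) * (N * (fromℕ 16 ^ (T ℕ.* ℓ)) ⁻¹)
          ≤⟨ +-mono-≤ (half (^-pos (w ℕ.* (T ℕ.* ℓ)) 0<2) bad-columns) (half (^-pos (T ℕ.* ℓ) (fromℕ-pos 16)) bad-paths) ⟩
        δ + δ ≡⟨ solve 1 (λ d → d :+ d := (c# 1 :+ c# 1) :* d) refl δ ⟩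
        (1# + 1#) * δ ∎)
        where
          bad-columns : (1# + 1#) * fromℕ m ≤ δ * (1# + 1#) ^ (w ℕ.* (T ℕ.* ℓ))
          bad-columns = begin
            (1# + 1#) * fromℕ m   ≡⟨ *-comm _ _ ⟩
            fromℕ m * (1# + 1#)   ≤⟨ *-mono-≤ (fromℕ-nonneg m) 0≤Q m≤δQ (≤-trans 2≤m′ m≤Q) ⟩
            δ * Q * Q             ≡⟨ *-assoc δ Q Q ⟩
            δ * (Q * Q)           ≡⟨ cong (δ *_) (^-homo-* (1# + 1#) ℓ ℓ) ⟨
            -- 2 ℓ ≤ w T ℓ because w ≥ 2 and T ≥ 1.
            δ * (1# + 1#) ^ (ℓ ℕ.+ ℓ) ≤⟨ *-monoˡ-≤ (proj₁ 0<δ) (^-monoʳ-≤ 1≤2 (ℕₚ.≤-trans (ℕₚ.≤-reflexive (cong (ℓ ℕ.+_) (sym (ℕₚ.+-identityʳ ℓ)))) (ℕₚ.*-mono-≤ 2≤w (ℕₚ.m≤n*m ℓ T)))) ⟩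
            δ * (1# + 1#) ^ (w ℕ.* (T ℕ.* ℓ)) ∎
          bad-paths : (1# + 1#) * N ≤ δ * fromℕ 16 ^ (T ℕ.* ℓ)
          bad-paths = begin
            (1# + 1#) * N          ≤⟨ *-mono-≤ (proj₁ 0<2) (^-nonneg T 0≤H) (≤-trans 2≤m′ m≤δQ) N≤H^T ⟩
            δ * Q * H ^ T          ≤⟨ *-monoʳ-≤ (^-nonneg T 0≤H) (*-monoˡ-≤ (proj₁ 0<δ) Q≤H^T) ⟩
            δ * H ^ T * H ^ T      ≡⟨ *-assoc _ _ _ ⟩
            δ * (H ^ T * H ^ T)    ≡⟨ cong (δ *_) 16^ ⟨
            δ * fromℕ 16 ^ (T ℕ.* ℓ) ∎

    projection : Sketch A θ Path δ m
    projection = ProjectionSketch.projectionSketch A unit′ (suc N) 0<δ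
        (≤-trans (proj₁ Nlarge) (fromℕ-mono (ℕₚ.n≤1+n N)))
      where
        N = proj₁ (exceeds (δ ⁻¹))
        Nlarge = proj₂ (exceeds (δ ⁻¹))

    size≤ : ∀ ℓ → fromℕ ℓ ≤ fromℕ 4 * L → fromℕ (w ℕ.* (T ℕ.* ℓ)) ≤ W * ((c + 1#) * (fromℕ 4 * (E * L)))
    size≤ ℓ ℓ≤ = begin
      fromℕ (w ℕ.* (T ℕ.* ℓ))                 ≡⟨ trans (fromℕ-* w (T ℕ.* ℓ)) (cong (W *_) (fromℕ-* T ℓ)) ⟩
      W * (fromℕ T * fromℕ ℓ)                 ≤⟨ *-monoˡ-≤ (fromℕ-nonneg w) (*-mono-≤ (fromℕ-nonneg T) (*-nonneg (fromℕ-nonneg 4) 0≤L) T≤ ℓ≤) ⟩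
      W * ((c + 1#) * E * (fromℕ 4 * L))      ≡⟨ cong (W *_) (solve 4 (λ c E f L → (c :+ c# 1) :* E :* (f :* L) := (c :+ c# 1) :* (f :* (E :* L))) refl c E (fromℕ 4) L) ⟩
      W * ((c + 1#) * (fromℕ 4 * (E * L)))    ∎

    -- The running time must not depend on δ, so at most m + 1 queries can be
    -- afforded: once the random sketch would be larger, project instead.
    abstract
      sketch : ∃[ n ] Sketch A θ Path δ n × n ℕ.≤ m × fromℕ (suc n) ≤ fromℕ C * (1# + E * L)
      sketch = choose (2 ℕₚ.≤? m)
        where
          signs : 2 ℕ.≤ m → ∀ ℓ {{_ : NonZero ℓ}} → fromℕ m * δ ⁻¹ ≤ (1# + 1#) ^ ℓ → fromℕ ℓ ≤ fromℕ 4 * L →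
                  Dec (w ℕ.* (T ℕ.* ℓ) ℕ.≤ m) → ∃[ n ] Sketch A θ Path δ n × n ℕ.≤ m × fromℕ (suc n) ≤ fromℕ C * (1# + E * L)
          signs 2≤m ℓ covers ℓ≤ (yes n≤m) = w ℕ.* (T ℕ.* ℓ) ,
            SignSketch.signSketch A unit′ w large (T ℕ.* ℓ) {{ℕₚ.m*n≢0 T ℓ}} {N = pathCount} unionBound-Path (failure≤δ 2≤m ℓ covers) ,
            n≤m , sketchSize≤ {n = w ℕ.* (T ℕ.* ℓ)} 0≤EL (size≤ ℓ ℓ≤)
          -- The random sketch would have more than m rows, so m + 1 queries obey the bound
          -- established for it.
          signs 2≤m ℓ covers ℓ≤ (no n≰m) = m , projection , ℕₚ.≤-refl ,
            ≤-trans (fromℕ-mono (ℕ.s≤s (ℕₚ.<⇒≤ (ℕₚ.≰⇒> n≰m)))) (sketchSize≤ {n = w ℕ.* (T ℕ.* ℓ)} 0≤EL (size≤ ℓ ℓ≤))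
          choose : Dec (2 ℕ.≤ m) → ∃[ n ] Sketch A θ Path δ n × n ℕ.≤ m × fromℕ (suc n) ≤ fromℕ C * (1# + E * L)
          -- For m = 1 there are two queries, which the constant term of the query bound covers.
          choose (no 2≰m)  = m , projection , ℕₚ.≤-refl , ≤-trans (fromℕ-mono (ℕₚ.≰⇒> 2≰m)) (2≤C* 0≤EL)
          choose (yes 2≤m) = let ℓ , covers , ℓ≤ , ℓ≢0 = logarithm 2≤m in
            signs 2≤m ℓ {{ℓ≢0}} covers ℓ≤ (w ℕ.* (T ℕ.* ℓ) ℕₚ.≤? m)

    -- With S = m + k + 1 / ε, the step count is O(k / ε²) = O(S³) and a step costs O((m + 1)²) =
    -- O(S²), whence the exponent 5. The bound q ≤ m + 1 keeps δ out.
    runtime : ∀ q → q ℕ.≤ suc m → fromℕ (RunningTime.cost (IntegerSquareRoot.κ k) T q m) ≤ fromℕ C * (fromℕ m + fromℕ k + ε ⁻¹) ^ 5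
    runtime q q≤ = begin
      fromℕ (RunningTime.cost κ T q m)                 ≤⟨ fromℕ-mono (RunningTime.cost-bound κ T q m q≤) ⟩
      fromℕ (165 ℕ.* (κ ℕ.+ suc T ℕ.* (suc m ℕ.* suc m))) ≡⟨ trans (fromℕ-* 165 (κ ℕ.+ suc T ℕ.* (suc m ℕ.* suc m))) (cong (a *_) (trans (fromℕ-+ κ (suc T ℕ.* (suc m ℕ.* suc m))) (cong (fromℕ κ +_) (trans (fromℕ-* (suc T) (suc m ℕ.* suc m)) (cong (fromℕ (suc T) *_) (fromℕ-* (suc m) (suc m))))))) ⟩
      a * (fromℕ κ + fromℕ (suc T) * (fromℕ (suc m) * fromℕ (suc m)))
        ≤⟨ *-monoˡ-≤ 0≤a (+-mono-≤ κ≤S (*-mono-≤ (fromℕ-nonneg (suc T)) 0≤SS 1+T≤ (*-mono-≤ (fromℕ-nonneg (suc m)) 0≤S 1+m≤S 1+m≤S))) ⟩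
      a * (S + (c + fromℕ 2) * (S * (S * S)) * (S * S)) ≤⟨ *-monoˡ-≤ 0≤a (+-monoˡ-≤ _ S≤S⁵) ⟩
      a * (S ^ 5 + (c + fromℕ 2) * (S * (S * S)) * (S * S)) ≡⟨ solve 3 (λ a c S → a :* (S :* (S :* (S :* (S :* (S :* c# 1)))) :+ (c :+ c# 2) :* (S :* (S :* S)) :* (S :* S)) :=
                                                              a :* (c :+ c# 3) :* (S :* (S :* (S :* (S :* (S :* c# 1)))))) refl a c S ⟩
      a * (c + fromℕ 3) * S ^ 5                        ≡⟨ cong (_* S ^ 5) C≡ ⟨
      fromℕ C * S ^ 5                                  ∎
      where
        open IntegerSquareRoot k
        i S : ℝ
        i = ε ⁻¹
        S = fromℕ m + fromℕ k + i
        0≤i : 0# ≤ i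
        0≤i = ≤-trans 0≤1 1≤ε⁻¹
        0≤S : 0# ≤ S
        0≤S = +-nonneg (+-nonneg (fromℕ-nonneg m) (fromℕ-nonneg k)) 0≤i
        0≤SS : 0# ≤ S * S
        0≤SS = *-nonneg 0≤S 0≤S
        i≤S : i ≤ S
        i≤S = ≤-via _ (+-nonneg (fromℕ-nonneg m) (fromℕ-nonneg k)) (+-comm _ i)
        1≤S : 1# ≤ S
        1≤S = ≤-trans 1≤ε⁻¹ i≤S
        k≤S : fromℕ k ≤ S
        k≤S = ≤-via _ (+-nonneg (fromℕ-nonneg m) 0≤i) (solve 3 (λ m k i → m :+ k :+ i := k :+ (m :+ i)) refl (fromℕ m) (fromℕ k) i)
        1+m≤S : fromℕ (suc m) ≤ S
        1+m≤S = ≤-trans (+-monoˡ-≤ (fromℕ m) (1≤fromℕ k)) (≤-via i 0≤i (solve 3 (λ m k i → m :+ k :+ i := k :+ m :+ i) refl (fromℕ m) (fromℕ k) i))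
        κ≤S : fromℕ κ ≤ S
        κ≤S = ≤-trans (fromℕ-mono κ≤1+k) (≤-trans (+-monoˡ-≤ (fromℕ k) (1≤fromℕ m)) (≤-via i 0≤i refl))
        E≤SSS : E ≤ S * (S * S)
        E≤SSS = *-mono-≤ (fromℕ-nonneg k) 0≤SS k≤S (≤-trans (≤-reflexive (square i)) (*-mono-≤ 0≤i 0≤S i≤S i≤S))
        1+T≤ : fromℕ (suc T) ≤ (c + fromℕ 2) * (S * (S * S))
        1+T≤ = begin
          1# + fromℕ T           ≤⟨ +-mono-≤ 1≤E T≤ ⟩
          E + (c + 1#) * E       ≡⟨ solve 2 (λ c E → E :+ (c :+ c# 1) :* E := (c :+ c# 2) :* E) refl c E ⟩
          (c + fromℕ 2) * E      ≤⟨ *-monoˡ-≤ (+-nonneg 0≤c (fromℕ-nonneg 2)) E≤SSS ⟩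
          (c + fromℕ 2) * (S * (S * S)) ∎
        S≤S⁵ : S ≤ S ^ 5
        S≤S⁵ = ≤-trans (≤-reflexive (sym (*-identityʳ S))) (*-monoˡ-≤ 0≤S (1≤^ 4 1≤S))

-- Completeness, soundness and assembly of the tester

module Correctness (em : ExcludedMiddle 0ℓ) (R : CompleteOrderedField) (w : ℕ)
               (2≤w : 2 ℕ.≤ w) (4w≤165 : 4 ℕ.* w ℕ.≤ 165) (large : 32 ℕ.* 9 ℕ.^ w ℕ.≤ 10 ℕ.^ w) where
  open OrderedField R
  open Sums R
  open LinearAlgebra R
  open InnerProduct R
  open Support R
  open Execution R using (HaltsIn; initial; entry; registers)
  open Testing R
  open Sketches em R
  open Parameters em R w 2≤w 4w≤165 large
  open ≤-Reasoning

  module _ (ε δ : ℝ) (0<ε : 0# < ε) (ε<1 : ε < 1#) (0<δ : 0# < δ) (δ<1 : δ < 1#)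
           (d k m : ℕ) .{{_ : NonZero d}} .{{_ : NonZero k}} .{{m≢0 : NonZero m}}
           (A : Matrix d m) (unit : ∀ i → ‖ column A i ‖₂ ≡ 1#) where

    open IntegerSquareRoot k
    open Choice ε δ 0<ε ε<1 0<δ δ<1 d k m A unit

    n : ℕ
    n = proj₁ sketch

    open Sketch (proj₁ (proj₂ sketch))

    program : Program
    program = greedyTester c₀ θ

    tester : Tester program ε δ k A
    tester = record
      { q = suc n
      ; queries = record { space = probabilitySpace ; matrix = matrix ; measurable = λ _ _ _ → tt }
      }

    private
      module T = Tester tester

    κ-lower : ¬ (fromℕ κ * fromℕ κ ≤ fromℕ k)
    κ-lower le = ℕₚ.<⇒≱ k<κ² (fromℕ-cancel-≤ {κ ℕ.* κ} {k} (≤-trans (≤-reflexive (fromℕ-* κ κ)) le))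

    κ-least : ∀ j → j ℕ.< κ → fromℕ j * fromℕ j ≤ fromℕ k
    κ-least j j<κ = ≤-trans (≤-reflexive (sym (fromℕ-* j j))) (fromℕ-mono (below-κ j j<κ))

    κ-upper : fromℕ κ * fromℕ κ ≤ fromℕ 4 * fromℕ k
    κ-upper = ≤-trans (≤-reflexive (sym (fromℕ-* κ κ))) (≤-trans (fromℕ-mono κ²≤4k) (≤-reflexive (fromℕ-* 4 k)))

    module _ (y : Vector ℝ d) (ω : Ω) where
      open GreedyAnalysis R k ε δ A (matrix ω) y κ hiding (input)
      open GreedyTester R (T.input y ω) κ using (residual; Greedy; Passes; Verdict; run-greedyTester; ip; testerTime)
      open Hoare R (T.input y ω) using (Run)

      run : Run program initial (testerTime T) (λ s → Σ[ p ∈ Path ] (Greedy p × Verdict (Passes θ T (residual p)) s))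
      run = run-greedyTester c₀ θ T κ-least κ-lower T-least T-large

      halts : ∃[ t ] HaltsIn program (T.input y ω) t × fromℕ t ≤ fromℕ C * (fromℕ m + fromℕ k + ε ⁻¹) ^ 5
      halts = let s , t , run , t≤ , _ = run in
        t , (s , run) , ≤-trans (fromℕ-mono t≤) (runtime (suc n) (ℕ.s≤s (proj₁ (proj₂ (proj₂ sketch)))))

      accepts : ∀ (x : Vector ℝ m) → Sp m k x → (∀ i → y i ≡ (A *ᵥ x) i) → T.Accept y ω
      accepts x (x∈S , sparse) y≡ = let s , t , halted , _ , p , greedy , verdict = run in s , t , halted , accepted s p greedy verdict
        where
          xx≡1 : ⟨ x , x ⟩ ≡ 1#
          xx≡1 = ‖‖₂≡1 x x∈S
          sparse′ : count x ℕ.≤ k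
          sparse′ = ℕₚ.≤-trans (ℕₚ.≤-reflexive (sym (‖‖₀≡count x))) sparse
          y₀≡0 : entry (matrix ω *ᵥ y) 0 ≡ 0#
          y₀≡0 = trans (y-toℕ zero) (trans (Mz x xx≡1 sparse′ y≡ κ-lower κ-upper (column-bounded ω) zero)
            (trans (sum-cong-≗ (λ i → trans (cong (x i *_) (check-column ω i)) (zeroʳ (x i)))) (sum-replicate-zero m)))
          check : entry (matrix ω *ᵥ y) 0 * entry (matrix ω *ᵥ y) 0 ≡ 0#
          check = trans (cong (λ a → a * a) y₀≡0) (zeroˡ 0#)
          small : ∀ (p : Path) → Greedy p → fromℕ θ * ip (residual p) (residual p) ≤ fromℕ T * ε * (fromℕ T * ε)
          small p greedy = begin
            fromℕ θ * ip (residual p) (residual p)     ≡⟨ cong (fromℕ θ *_) (ip-⟨⟩ (residual≡ p) (residual≡ p)) ⟩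
            fromℕ θ * ⟨ matrix ω *ᵥ vec p , matrix ω *ᵥ vec p ⟩                        ≤⟨ *-monoˡ-≤ (fromℕ-nonneg θ) (greedy-bounded x xx≡1 sparse′ y≡ κ-lower κ-upper (column-bounded ω) p greedy) ⟩
            fromℕ θ * (fromℕ T * (fromℕ 160 * fromℕ k)) ≡⟨ solve 4 (λ θ T a k → θ :* (T :* (a :* k)) := T :* (θ :* a :* k)) refl (fromℕ θ) (fromℕ T) (fromℕ 160) (fromℕ k) ⟩
            fromℕ T * (fromℕ θ * fromℕ 160 * fromℕ k)  ≡⟨ cong (λ x → fromℕ T * (x * fromℕ k)) c₀≡ ⟨
            -- The loop has stopped, so c₀ k < T ε².
            fromℕ T * (fromℕ c₀ * fromℕ k)             ≤⟨ *-monoˡ-≤ (fromℕ-nonneg T) (proj₁ (≰⇒< T-large)) ⟩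
            fromℕ T * (fromℕ T * (ε * ε))              ≡⟨ solve 2 (λ T e → T :* (T :* (e :* e)) := T :* e :* (T :* e)) refl (fromℕ T) ε ⟩
            fromℕ T * ε * (fromℕ T * ε)                ∎
          accepted : ∀ s p → Greedy p → Verdict (Passes θ T (residual p)) s → registers s 0 ≢ 0
          accepted s p greedy (inj₁ (_ , accept)) r≡0 = ℕₚ.1+n≢0 (trans (sym accept) r≡0)
          accepted s p greedy (inj₂ (fails , _)) _ = fails (≤-reflexive check , small p greedy)

      -- The path taken by the program depends on ω; quantifying over all paths gives an event about
      -- vectors fixed in advance, to which the soundness of the sketch applies.
      Bad : Set
      Bad = (matrix ω *ᵥ y) zero ≡ 0# × Σ[ p ∈ Path ] fromℕ θ * ⟨ matrix ω *ᵥ target p , matrix ω *ᵥ target p ⟩ ≤ fromℕ T * ε * (fromℕ T * ε)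
        where
          open GreedyPaths R κ using (combination)
          target : Path → Vector ℝ d
          target p l = (A *ᵥ combination p) l - fromℕ T * y l

      rejects : ¬ Bad → T.Reject y ω
      rejects good = let s , t , halted , _ , p , _ , verdict = run in s , t , halted , rejected s p verdict
        where
          square≡0 : ∀ {x} → x * x ≡ 0# → x ≡ 0#
          square≡0 {x} xx≡0 with x ≟ 0#
          ... | yes x≡0 = x≡0
          ... | no  x≢0 = integral x≢0 xx≡0
          bad : ∀ p → Passes θ T (residual p) → Bad
          bad p passes = trans (sym (y-toℕ zero)) (square≡0 (≤-antisym (proj₁ passes) (square-nonneg _))) , p ,
            ≤-trans (≤-reflexive (cong (fromℕ θ *_) (sum-cong-≗ (λ j → cong (λ a → a * a) (⟨⟩-cong {u = matrix ω j} (λ _ → refl) (λ l → sym (vec≡ p l)))))))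
              (passes⇒small θ T p passes)
          rejected : ∀ s p → Verdict (Passes θ T (residual p)) s → registers s 0 ≡ 0
          rejected s p (inj₁ (passes , _)) = ⊥-elim (good (bad p passes))
          rejected s p (inj₂ (_ , reject)) = reject

    soundness : ∀ y → (∀ (x : Vector ℝ m) → ‖ x ‖₀ ℕ.≤ T → ε < ‖ (A *ᵥ x) -ᵥ y ‖₂) → 1# - δ ≤ ℙ (T.Reject y)
    soundness y far = begin
      1# - δ                   ≤⟨ +-monoʳ-≤ 1# (neg-mono-≤ bad≤δ) ⟩
      1# - ℙ (Bad y)           ≡⟨ ℙ-∁ (Bad y) ⟨
      ℙ (λ ω → ¬ Bad y ω)      ≤⟨ ℙ-mono (rejects y) ⟩
      ℙ (T.Reject y)           ∎
      where
        open GreedyPaths R κ using (combination)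
        bad≤δ : ℙ (Bad y) ≤ δ
        bad≤δ = sound y (fromℕ T) combination (fromℕ T * ε * (fromℕ T * ε)) (square-nonneg _) λ p →
          subst (fromℕ T * ε * (fromℕ T * ε) <_) (sum-cong-≗ (λ l → cong (λ a → a * a) (vec≡ p l))) (far⇒vec-large T′ p 0<ε far)
          where
            -- Both lemmas concern vectors before sketching, so they are taken at an empty query
            -- matrix, outside any draw.
            open GreedyAnalysis R k ε δ A (λ (_ : Fin 0) (_ : Fin d) → 0#) y κ using (vec≡; far⇒vec-large)

    correct : fromℕ T.q ≤ fromℕ C * (1# + fromℕ k * (ε ⁻¹) ^ 2 * log (fromℕ m * δ ⁻¹))
     × (∀ (y : Vector ℝ d) → (∃[ x ] (Sp m k x × (∀ i → y i ≡ (A *ᵥ x) i))) →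
          T.IsEvent (T.Accept y) × T.Pr (T.Accept y) ≡ 1#)
     × (∃[ K ] (fromℕ K ≤ fromℕ C * (fromℕ k * (ε ⁻¹) ^ 2)
         × (∀ (y : Vector ℝ d) → (∀ (x : Vector ℝ m) → ‖ x ‖₀ ℕ.≤ K → ε < ‖ (A *ᵥ x) -ᵥ y ‖₂) →
              T.IsEvent (T.Reject y) × 1# - δ ≤ T.Pr (T.Reject y))))
     × T.RunsWithin (fromℕ C * (fromℕ m + fromℕ k + ε ⁻¹) ^ 5)
    correct = proj₂ (proj₂ (proj₂ sketch)) ,
      (λ y (x , x∈Sp , y≡) → tt , ℙ-sure (λ ω → accepts y ω x x∈Sp y≡)) ,
      (T , K≤ , λ y far → tt , soundness y far) ,
      halts

theorem1 : ExcludedMiddle 0ℓ →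
    (R : CompleteOrderedField) →
    let open CompleteOrderedField R
        open LinearAlgebra R
        open Testing R
    in
    Σ[ program ∈ Program ] Σ[ C ∈ ℕ ] Σ[ c ∈ ℕ ]
    (∀ (ε δ : ℝ) → 0# < ε → ε < 1# → 0# < δ → δ < 1# →
     ∀ (d k m : ℕ) → .{{_ : NonZero d}} → .{{_ : NonZero k}} → .{{_ : NonZero m}} →
     ∀ (A : Matrix d m) → (∀ i → ‖ column A i ‖₂ ≡ 1#) →
     Σ[ tester ∈ Tester program ε δ k A ]
     let open Tester tester in
       fromℕ q ≤ fromℕ C * (1# + fromℕ k * (ε ⁻¹) ^ 2 * log (fromℕ m * δ ⁻¹))
     × (∀ (y : Vector ℝ d) → (∃[ x ] (Sp m k x × (∀ i → y i ≡ (A *ᵥ x) i))) →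
          IsEvent (Accept y) × Pr (Accept y) ≡ 1#)
     × (∃[ K ] (fromℕ K ≤ fromℕ C * (fromℕ k * (ε ⁻¹) ^ 2)
         × (∀ (y : Vector ℝ d) → (∀ (x : Vector ℝ m) → ‖ x ‖₀ ℕ.≤ K → ε < ‖ (A *ᵥ x) -ᵥ y ‖₂) →
              IsEvent (Reject y) × 1# - δ ≤ Pr (Reject y))))
     × RunsWithin (fromℕ C * (fromℕ m + fromℕ k + ε ⁻¹) ^ c))
theorem1 em R = greedyTester P.c₀ P.θ , P.C , 5 , λ ε δ 0<ε ε<1 0<δ δ<1 d k m A unit →
    T.tester ε δ 0<ε ε<1 0<δ δ<1 d k m A unit , T.correct ε δ 0<ε ε<1 0<δ δ<1 d k m A unit
  where
    2≤33 : 2 ℕ.≤ 33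
    2≤33 = ℕₚ.≤ᵇ⇒≤ 2 33 tt
    132≤165 : 132 ℕ.≤ 165
    132≤165 = ℕₚ.≤ᵇ⇒≤ 132 165 tt
    -- 33 is the least possible exponent: log 32 / log (10 / 9) is about 32.9.
    32·9^33≤10^33 : 32 ℕ.* 9 ℕ.^ 33 ℕ.≤ 10 ℕ.^ 33
    32·9^33≤10^33 = ℕₚ.≤ᵇ⇒≤ (32 ℕ.* 9 ℕ.^ 33) (10 ℕ.^ 33) tt
    module P = Parameters em R 33 2≤33 132≤165 32·9^33≤10^33
    module T = Correctness em R 33 2≤33 132≤165 32·9^33≤10^33
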